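{- The following decision problem (finite satisfiability of $\mathrm{FO}^2(\leq_1,\precsim_2)$) is EXPSPACE-hard. Input: a two-variable first-order sentence $\varphi$ over a vocabulary consisting of the binary relation symbols $\leq_1$, $\precsim_2$ and arbitrarily many unary relation symbols. Question: is there a finite structure with non-empty universe satisfying $\varphi$ in which $\leq_1$ is interpreted as a linear order and $\precsim_2$ as a total preorder?
   Context: Two-variable logic $\mathrm{FO}^2$ is first-order logic (with equality) restricted to formulas using at most the two variables $x$ and $y$ (which may be re-quantified). There is no bound on the number of unary relation symbols, and there are no other non-unary relation symbols than those listed. A total preorder is a transitive binary relation $\precsim$ such that for all $u,v$ one has $u\precsim v$ or $v\precsim u$ (in particular it is reflexive). A linear order is an antisymmetric total preorder. -}

module Defs where

open import Data.Bool.Base using (Bool; true; false; T)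
open import Data.Fin.Base using (Fin)
open import Data.List.Base using (List; []; _∷_; _++_; map; reverse; replicate; length)
open import Data.Maybe.Base using (Maybe; just; nothing)
open import Data.Nat.Base using (ℕ; zero; suc; _+_; _*_; _^_; _≤_)
open import Data.Product.Base using (Σ; ∃; ∃-syntax; Σ-syntax; _×_; _,_)
open import Data.Sum.Base using (_⊎_)
open import Data.Vec.Base as Vec using (Vec; _∷_)
open import Function.Bundles using (_⇔_)
open import Relation.Binary.PropositionalEquality using (_≡_; _≢_)
open import Relation.Binary.Structures using (IsTotalOrder; IsTotalPreorder)
open import Relation.Nullary using (¬_)

Word : Set
Word = List Bool

Language : Set₁
Language = Word → Set

------------------------------------------------------------------------
-- Deterministic Turing machines

data Symbol (a : ℕ) : Set where
  blank : Symbol a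
  bit   : Bool → Symbol a
  aux   : Fin a → Symbol a

data Move : Set where
  left stay right : Move

-- A machine with k + 1 tapes, each infinite in both directions.  The machine
-- halts where δ is nothing; it then accepts or rejects according to its state.
record TM (k : ℕ) : Set where
  field
    states  : ℕ
    symbols : ℕ
    start   : Fin states
    accept  : Fin states → Bool
    δ       : Fin states → Vec (Symbol symbols) (suc k) →
              Maybe (Fin states × Vec (Symbol symbols × Move) (suc k))

-- The cells of a tape that were initially non-blank or have been visited, in
-- order: before is listed from the head outwards, all other cells are blank.
record Tape (a : ℕ) : Set where
  constructor tape
  field
    before  : List (Symbol a)
    current : Symbol a
    after   : List (Symbol a)

cells : ∀ {a} → Tape a → List (Symbol a)
cells (tape ls s rs) = reverse ls ++ s ∷ rs

act : ∀ {a} → Tape a → Symbol a × Move → Tape a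
act (tape []       _ rs)       (s , left)  = tape [] blank (s ∷ rs)
act (tape (l ∷ ls) _ rs)       (s , left)  = tape ls l (s ∷ rs)
act (tape ls       _ rs)       (s , stay)  = tape ls s rs
act (tape ls       _ [])       (s , right) = tape (s ∷ ls) blank []
act (tape ls       _ (r ∷ rs)) (s , right) = tape (s ∷ ls) r rs

blankTape : ∀ {a} → Tape a
blankTape = tape [] blank []

inputTape : ∀ {a} → Word → Tape a
inputTape []      = blankTape
inputTape (b ∷ w) = tape [] (bit b) (map bit w)

_contains_ : ∀ {a} → Tape a → Word → Set
t contains w = ∃[ i ] ∃[ j ]
  cells t ≡ replicate i blank ++ map bit w ++ replicate j blank

module _ {k : ℕ} (M : TM k) where
  open TM M

  record Config : Set where
    constructor config
    field
      state : Fin states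
      tapes : Vec (Tape symbols) (suc k)

  open Config

  next : Config → Maybe (Fin states × Vec (Symbol symbols × Move) (suc k))
  next c = δ (state c) (Vec.map Tape.current (tapes c))

  Halted : Config → Set
  Halted c = next c ≡ nothing

  step : Config → Config
  step c with next c
  ... | nothing       = c
  ... | just (q , as) = config q (Vec.zipWith act (tapes c) as)

  -- The input is on the first tape, with the head on its first symbol.
  initial : Word → Config
  initial w = config start (inputTape w ∷ Vec.replicate k blankTape)

  run : ℕ → Word → Config
  run zero    w = initial w
  run (suc t) w = step (run t w)

  space : Config → ℕ
  space c = Vec.sum (Vec.map (λ t → length (cells t)) (tapes c))

  Accepts : Word → Set
  Accepts w = ∃[ t ] Halted (run t w) × T (accept (state (run t w)))

  Halts : Word → Set
  Halts w = ∃[ t ] Halted (run t w)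

  DecidesInSpace : (ℕ → ℕ) → Language → Set
  DecidesInSpace s A = ∀ w →
      Halts w
    × (∀ t → space (run t w) ≤ s (length w))
    × (A w ⇔ Accepts w)

  -- The output is read off the last tape.
  ComputesInTime : (ℕ → ℕ) → (Word → Word) → Set
  ComputesInTime b f = ∀ w → ∃[ t ]
      t ≤ b (length w)
    × Halted (run t w)
    × Vec.last (tapes (run t w)) contains f w

------------------------------------------------------------------------
-- Hardness for exponential space under polynomial-time many-one reductions

-- Every polynomial with natural coefficients is dominated by one of these.
poly : ℕ → ℕ → ℕ → ℕ
poly c d n = c * n ^ d + c

-- One tape suffices here: the number of tapes does not affect the class.
EXPSPACE : Language → Set
EXPSPACE A = Σ[ M ∈ TM 0 ] ∃[ c ] ∃[ d ] DecidesInSpace M (λ n → 2 ^ poly c d n) A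

PolyTime : (Word → Word) → Set
PolyTime f = ∃[ k ] Σ[ M ∈ TM k ] ∃[ c ] ∃[ d ] ComputesInTime M (poly c d) f

_≤ᵖ_ : Language → Language → Set
A ≤ᵖ B = Σ[ f ∈ (Word → Word) ] PolyTime f × (∀ w → A w ⇔ B (f w))

EXPSPACE-hard : Language → Set₁
EXPSPACE-hard B = ∀ (A : Language) → EXPSPACE A → A ≤ᵖ B

------------------------------------------------------------------------
-- Two-variable logic over ≤₁, ≾₂ and unary relation symbols

data Var : Set where
  x y : Var

-- Unary relation symbols are named by binary words, so that the length of a
-- name counts towards the length of the formula.
Name : Set
Name = Word

infix  8 _≐_ _≤₁_ _≾₂_
infix  7 ∼_
infixr 6 _∧_
infixr 5 _∨_

data FO² : Set where
  _≐_ _≤₁_ _≾₂_ : Var → Var → FO²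
  P             : Name → Var → FO²
  ∼_            : FO² → FO²
  _∧_ _∨_       : FO² → FO² → FO²
  ∃′ ∀′         : Var → FO² → FO²

_freeIn_ : Var → FO² → Set
v freeIn (u ≐ u′)  = v ≡ u ⊎ v ≡ u′
v freeIn (u ≤₁ u′) = v ≡ u ⊎ v ≡ u′
v freeIn (u ≾₂ u′) = v ≡ u ⊎ v ≡ u′
v freeIn P _ u     = v ≡ u
v freeIn (∼ φ)     = v freeIn φ
v freeIn (φ ∧ ψ)   = v freeIn φ ⊎ v freeIn ψ
v freeIn (φ ∨ ψ)   = v freeIn φ ⊎ v freeIn ψ
v freeIn ∃′ u φ    = v ≢ u × v freeIn φ
v freeIn ∀′ u φ    = v ≢ u × v freeIn φ

Sentence : FO² → Set
Sentence φ = ∀ v → ¬ (v freeIn φ)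

-- Finite structures, up to isomorphism: the universe is Fin (suc n), and
-- relations on it are given by their characteristic functions.
record Structure : Set where
  field
    n     : ℕ
    le₁   : Fin (suc n) → Fin (suc n) → Bool
    le₂   : Fin (suc n) → Fin (suc n) → Bool
    unary : Name → Fin (suc n) → Bool

    linearOrder₁   : IsTotalOrder    _≡_ (λ a b → T (le₁ a b))
    totalPreorder₂ : IsTotalPreorder _≡_ (λ a b → T (le₂ a b))

  Universe : Set
  Universe = Fin (suc n)

  Assignment : Set
  Assignment = Var → Universe

open Structure using (Universe; Assignment)

_[_≔_] : {A : Set} → (Var → A) → Var → A → (Var → A)
(s [ x ≔ a ]) x = a
(s [ x ≔ a ]) y = s y
(s [ y ≔ a ]) x = s x
(s [ y ≔ a ]) y = a

-- Satisfaction is decidable, so the constructive connectives agree with the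
-- classical ones.
_⊨[_]_ : (𝔄 : Structure) → Assignment 𝔄 → FO² → Set
𝔄 ⊨[ s ] (u ≐ v)  = s u ≡ s v
𝔄 ⊨[ s ] (u ≤₁ v) = T (Structure.le₁ 𝔄 (s u) (s v))
𝔄 ⊨[ s ] (u ≾₂ v) = T (Structure.le₂ 𝔄 (s u) (s v))
𝔄 ⊨[ s ] P p u    = T (Structure.unary 𝔄 p (s u))
𝔄 ⊨[ s ] (∼ φ)    = ¬ (𝔄 ⊨[ s ] φ)
𝔄 ⊨[ s ] (φ ∧ ψ)  = (𝔄 ⊨[ s ] φ) × (𝔄 ⊨[ s ] ψ)
𝔄 ⊨[ s ] (φ ∨ ψ)  = (𝔄 ⊨[ s ] φ) ⊎ (𝔄 ⊨[ s ] ψ)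
𝔄 ⊨[ s ] ∃′ u φ   = Σ[ a ∈ Universe 𝔄 ] (𝔄 ⊨[ s [ u ≔ a ] ] φ)
𝔄 ⊨[ s ] ∀′ u φ   = (a : Universe 𝔄) → (𝔄 ⊨[ s [ u ≔ a ] ] φ)

_⊨_ : Structure → FO² → Set
𝔄 ⊨ φ = ∀ (s : Assignment 𝔄) → 𝔄 ⊨[ s ] φ

------------------------------------------------------------------------
-- The decision problem

pattern 𝟘 = false
pattern 𝟙 = true

⌜_⌝ᵛ : Var → Word
⌜ x ⌝ᵛ = 𝟘 ∷ []
⌜ y ⌝ᵛ = 𝟙 ∷ []

⌜_⌝ⁿ : Name → Word
⌜ []    ⌝ⁿ = 𝟘 ∷ []
⌜ b ∷ p ⌝ⁿ = 𝟙 ∷ b ∷ ⌜ p ⌝ⁿ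

-- Polish notation with a prefix-free code of the constructors; the encoding is
-- therefore injective.
⌜_⌝ : FO² → Word
⌜ u ≐ v  ⌝ = 𝟘 ∷ 𝟘 ∷ 𝟘 ∷ ⌜ u ⌝ᵛ ++ ⌜ v ⌝ᵛ
⌜ u ≤₁ v ⌝ = 𝟘 ∷ 𝟘 ∷ 𝟙 ∷ ⌜ u ⌝ᵛ ++ ⌜ v ⌝ᵛ
⌜ u ≾₂ v ⌝ = 𝟘 ∷ 𝟙 ∷ 𝟘 ∷ ⌜ u ⌝ᵛ ++ ⌜ v ⌝ᵛ
⌜ P p u  ⌝ = 𝟘 ∷ 𝟙 ∷ 𝟙 ∷ ⌜ p ⌝ⁿ ++ ⌜ u ⌝ᵛ
⌜ ∼ φ    ⌝ = 𝟙 ∷ 𝟘 ∷ 𝟘 ∷ ⌜ φ ⌝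
⌜ φ ∧ ψ  ⌝ = 𝟙 ∷ 𝟘 ∷ 𝟙 ∷ ⌜ φ ⌝ ++ ⌜ ψ ⌝
⌜ φ ∨ ψ  ⌝ = 𝟙 ∷ 𝟙 ∷ 𝟘 ∷ ⌜ φ ⌝ ++ ⌜ ψ ⌝
⌜ ∃′ u φ ⌝ = 𝟙 ∷ 𝟙 ∷ 𝟙 ∷ 𝟘 ∷ ⌜ u ⌝ᵛ ++ ⌜ φ ⌝
⌜ ∀′ u φ ⌝ = 𝟙 ∷ 𝟙 ∷ 𝟙 ∷ 𝟙 ∷ ⌜ u ⌝ᵛ ++ ⌜ φ ⌝

FinSat-FO²⟨≤₁,≾₂⟩ : Language
FinSat-FO²⟨≤₁,≾₂⟩ w = Σ[ φ ∈ FO² ]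
  w ≡ ⌜ φ ⌝ × Sentence φ × Σ[ 𝔄 ∈ Structure ] 𝔄 ⊨ φ

{-# OPTIONS --safe #-}

-- A machine M with space bound 2 ^ p is simulated on a circular tape of 2 ^ m
-- cells, m = p + 2, whose addresses are relative to the head.  A configuration is
-- one class of ≾₂ with a cell for every address, the bits of the address being
-- unary predicates; the borrows of the subtraction of 1 make the predecessor of an
-- address definable bit by bit.
--
-- Neither order has a definable successor.  Instead, ≤₁ lists the configurations
-- as c₀ c₂ c₁ c₄ c₃ c₆ c₅ … and ≾₂ as c₁ c₀ c₃ c₂ c₅ c₄ …, so that c and c′ are
-- ordered differently by ≤₁ and ≾₂ exactly if they are neighbours; their numbers
-- modulo 4 tell which one comes first.  Since M is deterministic and halts, it
-- suffices to require an initial configuration, a next one for each that is not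
-- halted, and acceptance of the halted ones.
--
-- The formula is written by a machine obtained from a program over stacks.

module Submission where

open import Data.Product.Base using (_,_)
open import Defs

-- Two variables only allow one cell to be compared with one other, and this shapes the encoding.
-- Addresses are relative to the head because a transition then shifts all of them alike, by one or
-- not at all: cells of consecutive configurations correspond by equality or predecessor of
-- addresses, and the head is where the subtraction borrows out of the top digit. The scanned symbol
-- would need a third element, so every cell carries a copy of it. Of the two extra address bits,
-- one gives each side of the head its own half of the circle; the other keeps the seam between the
-- halves blank, so that content may cross it. Since ≤₁ orders cells and not configurations, the
-- step to a neighbour is demanded between extreme cells of the two classes. Parity alone could not
-- orient the steps: in the intended model both neighbours of a configuration lie on the same side
-- of it in ≤₁ and on the other side in ≾₂, so the previous one and the next one differ only modulo
-- 4.

-- Unique readability of encoded formulas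

module Parsing where

  open import Data.List.Base using (List; []; _∷_; _++_)
  open import Data.List.Properties using (++-assoc)
  open import Data.Maybe.Base using (Maybe; just; nothing; _>>=_)
  open import Data.Maybe.Properties using (just-injective)
  open import Data.Nat.Base using (ℕ; zero; suc; _≤_; s≤s; _⊔_)
  open import Data.Nat.Properties using (≤-trans; m≤m⊔n; m≤n⊔m)
  open import Data.Product.Base using (_×_; _,_; proj₁)
  open import Relation.Binary.PropositionalEquality

  parseVar : Word → Maybe (Var × Word)
  parseVar []      = nothing
  parseVar (𝟘 ∷ r) = just (x , r)
  parseVar (𝟙 ∷ r) = just (y , r)

  parseName : Word → Maybe (Name × Word)
  parseName (𝟘 ∷ r)     = just ([] , r)
  parseName (𝟙 ∷ b ∷ r) = parseName r >>= λ where (p , r′) → just (b ∷ p , r′)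
  parseName _           = nothing

  parseVars : (Var → Var → FO²) → Word → Maybe (FO² × Word)
  parseVars k r = parseVar r >>= λ where
    (u , r′) → parseVar r′ >>= λ where (v , r″) → just (k u v , r″)

  -- The number is fuel, bounding the nesting depth: a second subformula is read from the remainder
  -- that the first one leaves, which is not structurally smaller.
  parse : ℕ → Word → Maybe (FO² × Word)
  parse₁ : (FO² → FO²) → ℕ → Word → Maybe (FO² × Word)
  parse₂ : (FO² → FO² → FO²) → ℕ → Word → Maybe (FO² × Word)

  parse zero    _                   = nothing
  parse (suc n) (𝟘 ∷ 𝟘 ∷ 𝟘 ∷ r)     = parseVars _≐_ r
  parse (suc n) (𝟘 ∷ 𝟘 ∷ 𝟙 ∷ r)     = parseVars _≤₁_ r
  parse (suc n) (𝟘 ∷ 𝟙 ∷ 𝟘 ∷ r)     = parseVars _≾₂_ r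
  parse (suc n) (𝟘 ∷ 𝟙 ∷ 𝟙 ∷ r)     = parseName r >>= λ where
    (p , r′) → parseVar r′ >>= λ where (u , r″) → just (P p u , r″)
  parse (suc n) (𝟙 ∷ 𝟘 ∷ 𝟘 ∷ r)     = parse₁ ∼_ n r
  parse (suc n) (𝟙 ∷ 𝟘 ∷ 𝟙 ∷ r)     = parse₂ _∧_ n r
  parse (suc n) (𝟙 ∷ 𝟙 ∷ 𝟘 ∷ r)     = parse₂ _∨_ n r
  parse (suc n) (𝟙 ∷ 𝟙 ∷ 𝟙 ∷ 𝟘 ∷ r) = parseVar r >>= λ where (u , r′) → parse₁ (∃′ u) n r′
  parse (suc n) (𝟙 ∷ 𝟙 ∷ 𝟙 ∷ 𝟙 ∷ r) = parseVar r >>= λ where (u , r′) → parse₁ (∀′ u) n r′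
  parse (suc n) _                   = nothing

  parse₁ k n r = parse n r >>= λ where (φ , r′) → just (k φ , r′)
  parse₂ k n r = parse n r >>= λ where
    (φ , r′) → parse n r′ >>= λ where (ψ , r″) → just (k φ ψ , r″)

  parseVar-⌜⌝ : ∀ u r → parseVar (⌜ u ⌝ᵛ ++ r) ≡ just (u , r)
  parseVar-⌜⌝ x r = refl
  parseVar-⌜⌝ y r = refl

  parseName-⌜⌝ : ∀ p r → parseName (⌜ p ⌝ⁿ ++ r) ≡ just (p , r)
  parseName-⌜⌝ []      r = refl
  parseName-⌜⌝ (b ∷ p) r rewrite parseName-⌜⌝ p r = refl

  parseVars-⌜⌝ : ∀ k u v r → parseVars k ((⌜ u ⌝ᵛ ++ ⌜ v ⌝ᵛ) ++ r) ≡ just (k u v , r)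
  parseVars-⌜⌝ k u v r
    rewrite ++-assoc ⌜ u ⌝ᵛ ⌜ v ⌝ᵛ r | parseVar-⌜⌝ u (⌜ v ⌝ᵛ ++ r) | parseVar-⌜⌝ v r = refl

  depth : FO² → ℕ
  depth (u ≐ v)  = 1
  depth (u ≤₁ v) = 1
  depth (u ≾₂ v) = 1
  depth (P p u)  = 1
  depth (∼ φ)    = suc (depth φ)
  depth (φ ∧ ψ)  = suc (depth φ ⊔ depth ψ)
  depth (φ ∨ ψ)  = suc (depth φ ⊔ depth ψ)
  depth (∃′ u φ) = suc (depth φ)
  depth (∀′ u φ) = suc (depth φ)

  parse-⌜⌝ : ∀ φ n r → depth φ ≤ n → parse n (⌜ φ ⌝ ++ r) ≡ just (φ , r)
  parse₁-⌜⌝ : ∀ k φ n r → depth φ ≤ n → parse₁ k n (⌜ φ ⌝ ++ r) ≡ just (k φ , r)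
  parse₂-⌜⌝ : ∀ k φ ψ n r → depth φ ⊔ depth ψ ≤ n →
              parse₂ k n ((⌜ φ ⌝ ++ ⌜ ψ ⌝) ++ r) ≡ just (k φ ψ , r)

  parse-⌜⌝ (u ≐ v)  (suc n) r (s≤s h) = parseVars-⌜⌝ _≐_ u v r
  parse-⌜⌝ (u ≤₁ v) (suc n) r (s≤s h) = parseVars-⌜⌝ _≤₁_ u v r
  parse-⌜⌝ (u ≾₂ v) (suc n) r (s≤s h) = parseVars-⌜⌝ _≾₂_ u v r
  parse-⌜⌝ (P p u)  (suc n) r (s≤s h)
    rewrite ++-assoc ⌜ p ⌝ⁿ ⌜ u ⌝ᵛ r | parseName-⌜⌝ p (⌜ u ⌝ᵛ ++ r) | parseVar-⌜⌝ u r = refl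
  parse-⌜⌝ (∼ φ)    (suc n) r (s≤s h) = parse₁-⌜⌝ ∼_ φ n r h
  parse-⌜⌝ (φ ∧ ψ)  (suc n) r (s≤s h) = parse₂-⌜⌝ _∧_ φ ψ n r h
  parse-⌜⌝ (φ ∨ ψ)  (suc n) r (s≤s h) = parse₂-⌜⌝ _∨_ φ ψ n r h
  parse-⌜⌝ (∃′ u φ) (suc n) r (s≤s h)
    rewrite ++-assoc ⌜ u ⌝ᵛ ⌜ φ ⌝ r | parseVar-⌜⌝ u (⌜ φ ⌝ ++ r) = parse₁-⌜⌝ (∃′ u) φ n r h
  parse-⌜⌝ (∀′ u φ) (suc n) r (s≤s h)
    rewrite ++-assoc ⌜ u ⌝ᵛ ⌜ φ ⌝ r | parseVar-⌜⌝ u (⌜ φ ⌝ ++ r) = parse₁-⌜⌝ (∀′ u) φ n r h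

  parse₁-⌜⌝ k φ n r h rewrite parse-⌜⌝ φ n r h = refl
  parse₂-⌜⌝ k φ ψ n r h
    rewrite ++-assoc ⌜ φ ⌝ ⌜ ψ ⌝ r
          | parse-⌜⌝ φ n (⌜ ψ ⌝ ++ r) (≤-trans (m≤m⊔n (depth φ) (depth ψ)) h)
          | parse-⌜⌝ ψ n r (≤-trans (m≤n⊔m (depth φ) (depth ψ)) h) = refl

  -- Membership in the target language only provides some formula with the given code; soundness of
  -- the reduction has to know that it is the constructed one. Both formulas are read back with
  -- common fuel.
  ⌜⌝-injective : ∀ φ ψ → ⌜ φ ⌝ ≡ ⌜ ψ ⌝ → φ ≡ ψ
  ⌜⌝-injective φ ψ e = cong proj₁ (just-injective
    (trans (sym (parse-⌜⌝ φ n [] (m≤m⊔n (depth φ) (depth ψ))))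
    (trans (cong (λ w → parse n (w ++ [])) e)
           (parse-⌜⌝ ψ n [] (m≤n⊔m (depth φ) (depth ψ))))))
    where n = depth φ ⊔ depth ψ

-- Stack programs and their simulation by Turing machines

module StackPrograms where

  open import Data.Bool.Base using (Bool; false)
  open import Data.Fin.Base using (Fin; zero; suc; fromℕ; splitAt; _↑ˡ_; _↑ʳ_)
  open import Data.Fin.Properties using (splitAt-↑ˡ; splitAt-↑ʳ; _≟_)
  open import Data.List.Base using (List; []; _∷_; _++_; length; map; replicate; reverse)
  open import Data.List.Properties using (++-assoc; ++-identityʳ; reverse-++; reverse-map; unfold-reverse)
  open import Data.Maybe.Base as Maybe using (Maybe; just; nothing)
  open import Data.Nat.Base using (ℕ; zero; suc; _+_; _≤_; s≤s)
  open import Data.Nat.Properties as ℕₚ using (≤-refl; ≤-trans; +-mono-≤)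
  open import Data.Product.Base using (∃-syntax; _×_; _,_; proj₁; proj₂)
  open import Data.Sum.Base using ([_,_]′)
  open import Data.Vec.Base as Vec using (Vec; []; _∷_; lookup; _[_]≔_; zipWith)
  open import Data.Vec.Properties using (lookup-zipWith; lookup-map; lookup∘update; lookup∘update′;
    lookup-replicate)
  open import Relation.Binary.PropositionalEquality
  open import Relation.Nullary using (yes; no)

  infixr 4 _⨾_

  -- The only loop is `drain i p`, which pops stack `i` until it is empty and runs `p b` for every
  -- popped `b`. Loops of this kind suffice for writing a formula, and their running times are
  -- easily bounded by polynomials.
  data Prog (K : ℕ) : Set where
    skip  : Prog K
    push  : Fin K → Bool → Prog K
    _⨾_   : Prog K → Prog K → Prog K
    drain : Fin K → (Bool → Prog K) → Prog K

  Stacks : ℕ → Set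
  Stacks K = Vec Word K

  -- By `weaken` the last index is an upper bound on the time, so that iterations of different cost
  -- can share one bound.
  data Run {K : ℕ} : Prog K → Stacks K → Stacks K → ℕ → Set where
    skip : ∀ {σ} → Run skip σ σ 1
    push : ∀ {i b σ} → Run (push i b) σ (σ [ i ]≔ (b ∷ lookup σ i)) 1
    _⨾_  : ∀ {p q σ σ′ σ″ t t′} →
           Run p σ σ′ t → Run q σ′ σ″ t′ → Run (p ⨾ q) σ σ″ (t + t′)
    done : ∀ {i p σ} → lookup σ i ≡ [] → Run (drain i p) σ σ 2
    pop  : ∀ {i p σ σ′ σ″ t t′ b l} → lookup σ i ≡ b ∷ l →
           Run (p b) (σ [ i ]≔ l) σ′ t → Run (drain i p) σ′ σ″ t′ →
           Run (drain i p) σ σ″ (2 + (t + t′))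
    weaken : ∀ {p σ σ′ t t′} → t ≤ t′ → Run p σ σ′ t → Run p σ σ′ t′

  -- A stack lies to the left of the head with its top next to the head.
  Holds : Tape 0 → Word → Set
  Holds t l = ∃[ a ] ∃[ b ] t ≡ tape (map bit l ++ replicate a blank) blank (replicate b blank)

  act-keep : ∀ (t : Tape 0) → act t (Tape.current t , stay) ≡ t
  act-keep (tape [] _ _) = refl
  act-keep (tape (_ ∷ _) _ _) = refl

  holds-push : ∀ {t l} b → Holds t l → Holds (act t (bit b , right)) (b ∷ l)
  holds-push {l = []} b (zero , zero , refl) = 0 , 0 , refl
  holds-push {l = []} b (suc a , zero , refl) = suc a , 0 , refl
  holds-push {l = _ ∷ _} b (a , zero , refl) = a , 0 , refl
  holds-push {l = []} b (zero , suc e , refl) = 0 , e , refl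
  holds-push {l = []} b (suc a , suc e , refl) = suc a , e , refl
  holds-push {l = _ ∷ _} b (a , suc e , refl) = a , e , refl

  holds-pop : ∀ {t b l} → Holds t (b ∷ l) →
              Tape.current (act t (blank , left)) ≡ bit b ×
              Holds (act (act t (blank , left)) (blank , stay)) l
  holds-pop {l = []}    (zero , e , refl) = refl , 0 , suc e , refl
  holds-pop {l = []}    (suc a , e , refl) = refl , suc a , suc e , refl
  holds-pop {l = _ ∷ _} (a , e , refl) = refl , a , suc e , refl

  -- The test for emptiness steps onto the cell below the bottom and back. That cell then counts as
  -- visited, which is why `Holds` admits blanks under the stack.
  holds-empty : ∀ {t} → Holds t [] →
                Tape.current (act t (blank , left)) ≡ blank ×
                Holds (act (act t (blank , left)) (blank , right)) []
  holds-empty (zero , e , refl) = refl , 1 , e , refl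
  holds-empty (suc zero , e , refl) = refl , 1 , e , refl
  holds-empty (suc (suc a) , e , refl) = refl , suc (suc a) , e , refl

  module _ {K : ℕ} where

    Symbols = Vec (Symbol 0) K
    Actions = Vec (Symbol 0 × Move) K
    Tapes   = Vec (Tape 0) K

    -- Besides the states of its two branches a `drain` has two of its own: one steps onto the top
    -- of the stack, the other reads it.
    size : Prog K → ℕ
    size skip        = 1
    size (push _ _)  = 1
    size (p ⨾ q)     = size p + size q
    size (drain i p) = 2 + (size (p 𝟘) + size (p 𝟙))

    entry : ∀ p → Fin (size p)
    entry skip        = zero
    entry (push i b)  = zero
    entry (p ⨾ q)     = entry p ↑ˡ size q
    entry (drain i p) = zero

    inBranch : ∀ i p b → Fin (size (p b)) → Fin (size (drain i p))
    inBranch i p 𝟘 s = suc (suc (s ↑ˡ size (p 𝟙)))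
    inBranch i p 𝟙 s = suc (suc (size (p 𝟘) ↑ʳ s))

    on : Fin K → Symbol 0 × Move → Symbols → Actions
    on i a ss = Vec.map (_, stay) ss [ i ]≔ a

    test : ∀ i p → Symbol 0 → Symbols → Maybe (Fin (size (drain i p))) × Actions
    test i p (bit b) ss = just (inBranch i p b (entry (p b))) , on i (blank , stay) ss
    test i p _       ss = nothing , on i (blank , right) ss

    -- The first component is nothing when the program is left.
    Outcome : Prog K → Set
    Outcome p = Maybe (Fin (size p)) × Actions

    leftOutcome : ∀ p q → Outcome p → Outcome (p ⨾ q)
    leftOutcome p q (just s , as)  = just (s ↑ˡ size q) , as
    leftOutcome p q (nothing , as) = just (size p ↑ʳ entry q) , as

    rightOutcome : ∀ p q → Outcome q → Outcome (p ⨾ q)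
    rightOutcome p q (s , as) = Maybe.map (size p ↑ʳ_) s , as

    bodyOutcome : ∀ i p b → Outcome (p b) → Outcome (drain i p)
    bodyOutcome i p b (just s , as)  = just (inBranch i p b s) , as
    bodyOutcome i p b (nothing , as) = just zero , as

    transition : ∀ p → Fin (size p) → Symbols → Outcome p
    transition skip        s ss = nothing , Vec.map (_, stay) ss
    transition (push i b)  s ss = nothing , on i (bit b , right) ss
    transition (p ⨾ q)     s ss = [ (λ s′ → leftOutcome p q (transition p s′ ss)) ,
        (λ s′ → rightOutcome p q (transition q s′ ss)) ]′
                                (splitAt (size p) s)
    transition (drain i p) zero          ss = just (suc zero) , on i (blank , left) ss
    transition (drain i p) (suc zero)    ss = test i p (lookup ss i) ss
    transition (drain i p) (suc (suc s)) ss =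
      [ (λ s′ → bodyOutcome i p 𝟘 (transition (p 𝟘) s′ ss)) ,
          (λ s′ → bodyOutcome i p 𝟙 (transition (p 𝟙) s′ ss)) ]′
        (splitAt (size (p 𝟘)) s)

    transition-⨾ˡ : ∀ p q s ss → transition (p ⨾ q) (s ↑ˡ size q) ss ≡ leftOutcome p q (transition p s ss)
    transition-⨾ˡ p q s ss rewrite splitAt-↑ˡ (size p) s (size q) = refl

    transition-⨾ʳ : ∀ p q s ss → transition (p ⨾ q) (size p ↑ʳ s) ss ≡ rightOutcome p q (transition q s ss)
    transition-⨾ʳ p q s ss rewrite splitAt-↑ʳ (size p) (size q) s = refl

    transition-drain : ∀ i p b s ss → transition (drain i p) (inBranch i p b s) ss ≡ bodyOutcome i p b
        (transition (p b) s ss)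
    transition-drain i p 𝟘 s ss rewrite splitAt-↑ˡ (size (p 𝟘)) s (size (p 𝟙)) = refl
    transition-drain i p 𝟙 s ss rewrite splitAt-↑ʳ (size (p 𝟘)) (size (p 𝟙)) s = refl

    symbolsOf : Tapes → Symbols
    symbolsOf = Vec.map Tape.current

    apply : Tapes → Actions → Tapes
    apply = zipWith act

    -- A run of the fragment `p` up to the step that leaves it. Since it refers to the states of `p`
    -- only, it can be carried into a sequence or a loop body by relabelling them.
    data Reach (p : Prog K) : Fin (size p) → Tapes → Tapes → ℕ → Set where
      leave : ∀ {s ts as} → transition p s (symbolsOf ts) ≡ (nothing , as) →
              Reach p s ts (apply ts as) 1
      go    : ∀ {s s′ ts ts′ as t} → transition p s (symbolsOf ts) ≡ (just s′ , as) →
              Reach p s′ (apply ts as) ts′ t → Reach p s ts ts′ (suc t)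

    reach-⨾ʳ : ∀ p q {s ts ts′ t} → Reach q s ts ts′ t → Reach (p ⨾ q) (size p ↑ʳ s) ts ts′ t
    reach-⨾ʳ p q (leave e) = leave (trans (transition-⨾ʳ p q _ _) (cong (rightOutcome p q) e))
    reach-⨾ʳ p q (go e r)  = go (trans (transition-⨾ʳ p q _ _) (cong (rightOutcome p q) e)) (reach-⨾ʳ p q r)

    reach-⨾ : ∀ p q {s ts ts′ ts″ t t′} → Reach p s ts ts′ t → Reach q (entry q) ts′ ts″ t′ →
              Reach (p ⨾ q) (s ↑ˡ size q) ts ts″ (t + t′)
    reach-⨾ p q (leave e) r′ = go (trans (transition-⨾ˡ p q _ _) (cong (leftOutcome p q) e)) (reach-⨾ʳ p q r′)
    reach-⨾ p q (go e r) r′  = go (trans (transition-⨾ˡ p q _ _) (cong (leftOutcome p q) e)) (reach-⨾ p q r r′)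

    reach-drain : ∀ i p b {s ts ts′ ts″ t t′} → Reach (p b) s ts ts′ t → Reach (drain i p) zero ts′ ts″ t′ →
                  Reach (drain i p) (inBranch i p b s) ts ts″ (t + t′)
    reach-drain i p b (leave e) r′ = go (trans (transition-drain i p b _ _) (cong (bodyOutcome i p b) e)) r′
    reach-drain i p b (go e r) r′  = go (trans (transition-drain i p b _ _) (cong (bodyOutcome i p b) e))
        (reach-drain i p b r r′)

    Represents : Tapes → Stacks K → Set
    Represents ts σ = ∀ i → Holds (lookup ts i) (lookup σ i)

    lookup-on : ∀ i a ts → lookup (apply ts (on i a (symbolsOf ts))) i ≡ act (lookup ts i) a
    lookup-on i a ts = trans (lookup-zipWith act i ts _)
      (cong (act (lookup ts i)) (lookup∘update i (Vec.map (_, stay) (symbolsOf ts)) a))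

    lookup-idle : ∀ j ts → act (lookup ts j) (lookup (Vec.map (_, stay) (symbolsOf ts)) j) ≡ lookup ts j
    lookup-idle j ts = trans (cong (act (lookup ts j))
      (trans (lookup-map j (_, stay) (symbolsOf ts)) (cong (_, stay) (lookup-map j Tape.current ts))))
      (act-keep (lookup ts j))

    lookup-off : ∀ {i j} a ts → j ≢ i → lookup (apply ts (on i a (symbolsOf ts))) j ≡ lookup ts j
    lookup-off {i} {j} a ts j≢i = trans (lookup-zipWith act j ts _)
      (trans (cong (act (lookup ts j)) (lookup∘update′ j≢i (Vec.map (_, stay) (symbolsOf ts)) a))
             (lookup-idle j ts))

    represents-≔ : ∀ i ts ts′ σ l → Represents ts σ → Holds (lookup ts′ i) l →
                   (∀ {j} → j ≢ i → lookup ts′ j ≡ lookup ts j) → Represents ts′ (σ [ i ]≔ l)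
    represents-≔ i ts ts′ σ l h hi ho j with j ≟ i
    ... | yes refl = subst (Holds (lookup ts′ i)) (sym (lookup∘update i σ l)) hi
    ... | no j≢i   = subst₂ Holds (sym (ho j≢i)) (sym (lookup∘update′ j≢i σ l)) (h j)

    simulate : ∀ {p σ σ′ t ts} → Run p σ σ′ t → Represents ts σ →
               ∃[ t′ ] t′ ≤ t × ∃[ ts′ ] Reach p (entry p) ts ts′ t′ × Represents ts′ σ′
    simulate {ts = ts} skip h = 1 , ≤-refl , _ , leave refl , λ i →
      subst (λ t → Holds t _) (sym (trans (lookup-zipWith act i ts _) (lookup-idle i ts))) (h i)
    simulate {ts = ts} (push {i} {b} {σ}) h = 1 , ≤-refl , _ , leave refl ,
      represents-≔ i ts (apply ts (on i (bit b , right) (symbolsOf ts))) σ (b ∷ lookup σ i) h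
        (subst (λ t → Holds t (b ∷ lookup σ i)) (sym (lookup-on i _ ts)) (holds-push {l = lookup σ i} b (h i)))
                   (lookup-off _ ts)
    simulate (_⨾_ {p} {q} r r′) h with simulate r h
    ... | t , t≤ , ts , c , h′ with simulate r′ h′
    ... | t′ , t′≤ , ts′ , c′ , h″ = t + t′ , +-mono-≤ t≤ t′≤ , ts′ , reach-⨾ p q c c′ , h″
    simulate {ts = ts} (done {i} {p} {σ} e) h =
      2 , ≤-refl , ts₂ , go refl (leave eq) , rep
      where
      ts₁ ts₂ : Tapes
      ts₁ = apply ts (on i (blank , left) (symbolsOf ts))
      ts₂ = apply ts₁ (on i (blank , right) (symbolsOf ts₁))
      hi = holds-empty (subst (Holds (lookup ts i)) e (h i))
      cur : lookup (symbolsOf ts₁) i ≡ blank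
      cur = trans (lookup-map i Tape.current ts₁) (trans (cong Tape.current (lookup-on i _ ts)) (proj₁ hi))
      eq : transition (drain i p) (suc zero) (symbolsOf ts₁) ≡ (nothing , on i (blank , right) (symbolsOf ts₁))
      eq rewrite cur = refl
      rep : Represents ts₂ σ
      rep j with j ≟ i
      ... | yes refl = subst₂ Holds (sym
          (trans (lookup-on i _ ts₁) (cong (λ t → act t _) (lookup-on i _ ts)))) (sym e) (proj₂ hi)
      ... | no j≢i   = subst (λ t → Holds t _) (sym (trans (lookup-off _ ts₁ j≢i) (lookup-off _ ts j≢i))) (h j)
    simulate {ts = ts} (pop {i} {p} {σ} {b = b} {l = l} e r r′) h with
      simulate {ts = ts₂} r rep
      where
      ts₁ ts₂ : Tapes
      ts₁ = apply ts (on i (blank , left) (symbolsOf ts))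
      ts₂ = apply ts₁ (on i (blank , stay) (symbolsOf ts₁))
      hi = holds-pop (subst (Holds (lookup ts i)) e (h i))
      rep : Represents ts₂ (σ [ i ]≔ l)
      rep = represents-≔ i ts ts₂ σ l h
        (subst (λ t → Holds t _) (sym (trans (lookup-on i _ ts₁) (cong (λ t → act t _) (lookup-on i _ ts))))
            (proj₂ hi))
        (λ j≢i → trans (lookup-off _ ts₁ j≢i) (lookup-off _ ts j≢i))
    ... | t , t≤ , ts₃ , c , h′ with simulate r′ h′
    ... | t′ , t′≤ , ts′ , c′ , h″ =
      2 + (t + t′) , s≤s (s≤s (+-mono-≤ t≤ t′≤)) , ts′ , go refl (go eq (reach-drain i p b c c′)) , h″
      where
      ts₁ : Tapes
      ts₁ = apply ts (on i (blank , left) (symbolsOf ts))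
      hi = holds-pop (subst (Holds (lookup ts i)) e (h i))
      cur : lookup (symbolsOf ts₁) i ≡ bit b
      cur = trans (lookup-map i Tape.current ts₁) (trans (cong Tape.current (lookup-on i _ ts)) (proj₁ hi))
      eq : transition (drain i p) (suc zero) (symbolsOf ts₁) ≡
           (just (inBranch i p b (entry (p b))) , on i (blank , stay) (symbolsOf ts₁))
      eq rewrite cur = refl
    simulate (weaken t≤t′ r) h with simulate r h
    ... | t , t≤ , rest = t , ≤-trans t≤ t≤t′ , rest

  module _ {k : ℕ} (p : Prog (suc k)) where

    embed : Maybe (Fin (size p)) × Actions {suc k} → Maybe (Fin (2 + size p) × Actions {suc k})
    embed (just s , as)  = just (suc (suc s) , as)
    embed (nothing , as) = just (suc zero , as)

    scan : Symbol 0 → Symbols {suc k} → Maybe (Fin (2 + size p) × Actions {suc k})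
    scan (bit b) ss = just (zero , on zero (bit b , right) ss)
    scan _       ss = just (suc (suc (entry p)) , Vec.map (_, stay) ss)

    -- The first state walks over the input, which thereby becomes a stack with the last letter on
    -- top; the second one halts; the others execute `p`.
    delta : Fin (2 + size p) → Symbols {suc k} → Maybe (Fin (2 + size p) × Actions {suc k})
    delta zero          ss = scan (Vec.head ss) ss
    delta (suc zero)    ss = nothing
    delta (suc (suc s)) ss = embed (transition p s ss)

    machine : TM k
    machine = record
      { states  = 2 + size p
      ; symbols = 0
      ; start   = zero
      ; accept  = λ _ → false
      ; δ       = delta
      }

    step-just : ∀ s ts {s′ as} → delta s (symbolsOf ts) ≡ just (s′ , as) →
                step machine (config s ts) ≡ config s′ (apply ts as)
    step-just s ts e with delta s (symbolsOf ts) | e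
    ... | _ | refl = refl

    steps : ℕ → Config machine → Config machine
    steps zero    c = c
    steps (suc t) c = steps t (step machine c)

    steps-suc : ∀ t c → steps t (step machine c) ≡ step machine (steps t c)
    steps-suc zero    c = refl
    steps-suc (suc t) c = steps-suc t (step machine c)

    run-steps : ∀ t w → run machine t w ≡ steps t (initial machine w)
    run-steps zero    w = refl
    run-steps (suc t) w = trans (cong (step machine) (run-steps t w)) (sym (steps-suc t _))

    steps-+ : ∀ t t′ c → steps (t + t′) c ≡ steps t′ (steps t c)
    steps-+ zero    t′ c = refl
    steps-+ (suc t) t′ c = steps-+ t t′ (step machine c)

    reach-steps : ∀ {s ts ts′ t} → Reach p s ts ts′ t →
                  steps t (config (suc (suc s)) ts) ≡ config (suc zero) ts′
    reach-steps {s} {ts} (leave e) = step-just (suc (suc s)) ts (cong embed e)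
    reach-steps {s} {ts} {t = suc t} (go e r) = trans
        (cong (steps t) (step-just (suc (suc s)) ts (cong embed e))) (reach-steps r)

    scanned : Word → Word → Tape 0
    scanned l []      = tape (map bit l) blank []
    scanned l (b ∷ w) = tape (map bit l) (bit b) (map bit w)

    act-scanned : ∀ l b w → act (scanned l (b ∷ w)) (bit b , right) ≡ scanned (b ∷ l) w
    act-scanned []      b []      = refl
    act-scanned []      b (_ ∷ _) = refl
    act-scanned (_ ∷ _) b []      = refl
    act-scanned (_ ∷ _) b (_ ∷ _) = refl

    idle-tapes : ∀ {n} (ts : Vec (Tape 0) n) →
                 zipWith act ts (Vec.map (_, stay) (Vec.map Tape.current ts)) ≡ ts
    idle-tapes []       = refl
    idle-tapes (t ∷ ts) = cong₂ _∷_ (act-keep t) (idle-tapes ts)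

    scan-steps : ∀ l w ts → steps (suc (length w)) (config zero (scanned l w ∷ ts)) ≡
                 config (suc (suc (entry p))) (tape (map bit (reverse w ++ l)) blank [] ∷ ts)
    scan-steps l []      ts = trans (step-just zero (scanned l [] ∷ ts) refl)
        (cong (config _) (idle-tapes (scanned l [] ∷ ts)))
    scan-steps l (b ∷ w) ts = trans (cong (steps (suc (length w))) e)
      (trans (scan-steps (b ∷ l) w ts)
        (cong (λ v → config _ (tape (map bit v) blank [] ∷ ts))
          (trans (sym (++-assoc (reverse w) (b ∷ []) l)) (cong (_++ l) (sym (unfold-reverse b w))))))
      where
      e : step machine (config zero (scanned l (b ∷ w) ∷ ts)) ≡ config zero (scanned (b ∷ l) w ∷ ts)
      e = trans (step-just zero (scanned l (b ∷ w) ∷ ts) refl)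
          (cong (config zero) (cong₂ _∷_ (act-scanned l b w) (idle-tapes ts)))

    initialStacks : Word → Stacks (suc k)
    initialStacks w = reverse w ∷ Vec.replicate k []

    -- The cells left of the head are listed from the head outwards, so the word on the tape is the
    -- stack read from its bottom.
    holds-contains : ∀ {l} {t : Tape 0} → Holds t l → t contains reverse l
    holds-contains {l} (a , b , refl) = a , suc b , (begin
      reverse (map bit l ++ replicate a blank) ++ blank ∷ replicate b blank
        ≡⟨ cong (_++ blank ∷ replicate b blank) (reverse-++ (map bit l) (replicate a blank)) ⟩
      (reverse (replicate a blank) ++ reverse (map bit l)) ++ blank ∷ replicate b blank
        ≡⟨ ++-assoc (reverse (replicate a blank)) _ _ ⟩
      reverse (replicate a blank) ++ reverse (map bit l) ++ blank ∷ replicate b blank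
        ≡⟨ cong₂ _++_ (reverse-replicate a blank) (cong (_++ blank ∷ replicate b blank)
            (sym (reverse-map bit l))) ⟩
      replicate a blank ++ map bit (reverse l) ++ blank ∷ replicate b blank ∎)
      where
      open ≡-Reasoning
      reverse-replicate : ∀ {A : Set} n (z : A) → reverse (replicate n z) ≡ replicate n z
      reverse-replicate zero    z = refl
      reverse-replicate (suc n) z = trans (unfold-reverse z (replicate n z))
        (trans (cong (_++ z ∷ []) (reverse-replicate n z)) (snoc n))
        where
        snoc : ∀ n → replicate n z ++ z ∷ [] ≡ z ∷ replicate n z
        snoc zero    = refl
        snoc (suc n) = cong (z ∷_) (snoc n)

    lookup-last : ∀ {A : Set} {n} (v : Vec A (suc n)) → Vec.last v ≡ lookup v (fromℕ n)
    lookup-last {n = zero}  (_ ∷ []) = refl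
    lookup-last {n = suc n} (a ∷ v)  = trans (last-∷ {a = a} v) (lookup-last v)
      where
      last-∷ : ∀ {A : Set} {n} {a : A} (v : Vec A (suc n)) → Vec.last (a ∷ v) ≡ Vec.last v
      last-∷ v with Vec.initLast v
      ... | _ , _ , refl = refl

    machine-computes : ∀ w {σ t} → Run p (initialStacks w) σ t →
      ∃[ t′ ] t′ ≤ suc (length w) + t
            × Halted machine (run machine t′ w)
            × Vec.last (Config.tapes (run machine t′ w)) contains reverse (Vec.last σ)
    machine-computes w {σ} r with simulate r init
      where
      init : Represents (tape (map bit (reverse w)) blank [] ∷ Vec.replicate k blankTape) (initialStacks w)
      init zero    = 0 , 0 , cong (λ l → tape l blank []) (sym (++-identityʳ _))
      init (suc i) = subst₂ (Holds) (sym (lookup-replicate i blankTape)) (sym (lookup-replicate i []))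
                            (0 , 0 , refl)
    ... | t′ , t′≤ , ts′ , c , h = suc (length w) + t′ , ℕₚ.+-monoʳ-≤ (suc (length w)) t′≤ ,
          cong (next machine) final ,
          subst (_contains reverse (Vec.last σ)) (cong (λ c → Vec.last (Config.tapes c)) (sym final))
            (holds-contains {Vec.last σ} (subst₂ (Holds) (sym (lookup-last ts′)) (sym (lookup-last σ))
                (h (fromℕ k))))
      where
      input-scanned : ∀ w → inputTape w ≡ scanned [] w
      input-scanned []      = refl
      input-scanned (_ ∷ _) = refl
      final : run machine (suc (length w) + t′) w ≡ config (suc zero) ts′
      final = trans (run-steps (suc (length w) + t′) w) (trans (steps-+ (suc (length w)) t′ _)
        (trans (cong (steps t′) (trans
            (cong (λ u → steps (suc (length w)) (config zero (u ∷ Vec.replicate k blankTape)))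
                (input-scanned w))
                                       (trans (scan-steps [] w _) (cong
                                           (λ v → config _ (tape (map bit v) blank [] ∷ _)) (++-identityʳ _)))))
               (reach-steps c)))

-- Closure of polynomial bounds under sums and products

module PolynomialBounds where

  open import Data.Nat.Base
  open import Data.Nat.Properties as ℕₚ
  open import Data.Nat.Solver using (module +-*-Solver)
  open import Data.Product.Base using (∃-syntax; _,_)
  open import Relation.Binary.PropositionalEquality

  PolyBounded : (ℕ → ℕ) → Set
  PolyBounded g = ∃[ c ] ∃[ d ] ∀ n → g n ≤ poly c d n

  -- The `+ 1` is there for `n` and `d` both zero: `0 ^ 0` is 1, while `0 ^ e` may be 0.
  ^-split : ∀ n d e → n ^ d ≤ n ^ (d + e) + 1
  ^-split zero    zero    e = m≤n+m 1 (0 ^ e)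
  ^-split zero    (suc d) e = z≤n
  ^-split (suc n) d       e = ≤-trans (^-monoʳ-≤ (suc n) (m≤m+n d e)) (m≤m+n _ 1)

  ^-splitʳ : ∀ n d e → n ^ e ≤ n ^ (d + e) + 1
  ^-splitʳ n d e = subst (λ k → n ^ e ≤ n ^ k + 1) (+-comm e d) (^-split n e d)

  poly-const : ∀ k → PolyBounded (λ _ → k)
  poly-const k = k , 0 , λ n → m≤n+m k (k * 1)

  poly-id : PolyBounded (λ n → n)
  poly-id = 1 , 1 , λ n → ≤-trans (≤-reflexive (sym (trans (*-identityˡ _) (*-identityʳ n)))) (m≤m+n _ 1)

  poly-+ : ∀ {g h} → PolyBounded g → PolyBounded h → PolyBounded (λ n → g n + h n)
  poly-+ {g} {h} (c , d , p) (c′ , d′ , p′) = 2 * (c + c′) , d + d′ , λ n → begin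
    g n + h n                                                       ≤⟨ +-mono-≤ (p n) (p′ n) ⟩
    (c * n ^ d + c) + (c′ * n ^ d′ + c′)
      ≤⟨ +-mono-≤ (+-monoˡ-≤ c (*-monoʳ-≤ c (^-split n d d′))) (+-monoˡ-≤ c′ (*-monoʳ-≤ c′ (^-splitʳ n d d′))) ⟩
    (c * (n ^ (d + d′) + 1) + c) + (c′ * (n ^ (d + d′) + 1) + c′)   ≤⟨ lem c c′ (n ^ (d + d′)) ⟩
    2 * (c + c′) * n ^ (d + d′) + 2 * (c + c′)                      ∎
    where
    open ≤-Reasoning
    lem : ∀ c c′ z → (c * (z + 1) + c) + (c′ * (z + 1) + c′) ≤ 2 * (c + c′) * z + 2 * (c + c′)
    lem c c′ z = ≤-trans (m≤m+n _ ((c + c′) * z)) (≤-reflexive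
      (solve 3 (λ c c′ z → ((c :* (z :+ con 1) :+ c) :+ (c′ :* (z :+ con 1) :+ c′)) :+ (c :+ c′) :* z
                         := con 2 :* (c :+ c′) :* z :+ con 2 :* (c :+ c′)) refl c c′ z))
      where open +-*-Solver

  poly-* : ∀ {g h} → PolyBounded g → PolyBounded h → PolyBounded (λ n → g n * h n)
  poly-* {g} {h} (c , d , p) (c′ , d′ , p′) = 3 * (c * c′) , d + d′ , λ n → begin
    g n * h n                                      ≤⟨ *-mono-≤ (p n) (p′ n) ⟩
    (c * n ^ d + c) * (c′ * n ^ d′ + c′)           ≡⟨ lem₁ c c′ (n ^ d) (n ^ d′) ⟩
    c * c′ * (n ^ d * n ^ d′ + n ^ d + n ^ d′ + 1)
      ≡⟨ cong (λ z → c * c′ * (z + n ^ d + n ^ d′ + 1)) (sym (^-distribˡ-+-* n d d′)) ⟩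
    c * c′ * (n ^ (d + d′) + n ^ d + n ^ d′ + 1)
      ≤⟨ *-monoʳ-≤ (c * c′) (+-monoˡ-≤ 1
          (+-mono-≤ (+-monoʳ-≤ (n ^ (d + d′)) (^-split n d d′)) (^-splitʳ n d d′))) ⟩
    c * c′ * (n ^ (d + d′) + (n ^ (d + d′) + 1) + (n ^ (d + d′) + 1) + 1) ≡⟨ lem₂ (c * c′) (n ^ (d + d′)) ⟩
    3 * (c * c′) * n ^ (d + d′) + 3 * (c * c′)      ∎
    where
    open ≤-Reasoning
    open +-*-Solver
    lem₁ : ∀ c c′ z z′ → (c * z + c) * (c′ * z′ + c′) ≡ c * c′ * (z * z′ + z + z′ + 1)
    lem₁ = solve 4 (λ c c′ z z′ → (c :* z :+ c) :* (c′ :* z′ :+ c′) := c :* c′ :*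
        (z :* z′ :+ z :+ z′ :+ con 1)) refl
    lem₂ : ∀ k z → k * (z + (z + 1) + (z + 1) + 1) ≡ 3 * k * z + 3 * k
    lem₂ = solve 2 (λ k z → k :* (z :+ (z :+ con 1) :+ (z :+ con 1) :+ con 1) := con 3 :* k :* z :+ con 3 :*
        k) refl

-- Formulas parametrised by the number of address bits

module Schemas where

  open import Data.Bool.Base using (Bool)
  open import Data.List.Base using (_∷_; replicate)
  open import Data.Nat.Base

  -- Indices are in unary: the number of address bits is polynomial, so this is affordable, and a
  -- name is written by copying marks. The leading `𝟘` keeps these names apart from the attribute
  -- names, which begin with `𝟙`.
  bitName : Bool → ℕ → Name
  bitName b j = 𝟘 ∷ b ∷ replicate j 𝟙

  -- Schemas are instantiated at every index j < m of an address bit, templates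
  -- at the number m of these bits; both are written out by a fixed program.
  data Schema : Set where
    const : FO² → Schema
    bitP  : Bool → ℕ → Var → Schema
    not   : Schema → Schema
    and or : Schema → Schema → Schema

  inst : Schema → ℕ → FO²
  inst (const φ)    j = φ
  inst (bitP b e v) j = P (bitName b (e + j)) v
  inst (not s)      j = ∼ inst s j
  inst (and s t)    j = inst s j ∧ inst t j
  inst (or s t)     j = inst s j ∨ inst t j

  -- `φ` stands where a truth constant would end the conjunction. `conj` puts a condition about
  -- index `m` there, such as one on the borrow out of the top digit.
  ⋀ : (ℕ → FO²) → FO² → ℕ → ℕ → FO²
  ⋀ f φ j zero    = φ
  ⋀ f φ j (suc r) = f j ∧ ⋀ f φ (suc j) r

  data Template : Set where
    const  : FO² → Template
    conj   : Schema → Schema → Template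
    not    : Template → Template
    and or : Template → Template → Template
    ex all : Var → Template → Template

  instᵀ : Template → ℕ → FO²
  instᵀ (const φ)  m = φ
  instᵀ (conj s t) m = ⋀ (inst s) (inst t m) 0 m
  instᵀ (not s)    m = ∼ instᵀ s m
  instᵀ (and s t)  m = instᵀ s m ∧ instᵀ t m
  instᵀ (or s t)   m = instᵀ s m ∨ instᵀ t m
  instᵀ (ex v s)   m = ∃′ v (instᵀ s m)
  instᵀ (all v s)  m = ∀′ v (instᵀ s m)

-- A polynomial-time program that writes the formula

module Writing where

  open Parsing
  open StackPrograms
  open PolynomialBounds
  open Schemas
  open import Data.Bool.Base using (Bool)
  open import Data.Fin.Base using (Fin; zero; suc)
  open import Data.Fin.Patterns
  open import Data.List.Base using (List; []; _∷_; _++_; replicate; reverse; length; concatMap; _ʳ++_)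
  open import Data.List.Properties as Lₚ using (++-assoc; length-reverse; length-replicate; length-ʳ++;
    ++-ʳ++; reverse-involutive)
  open import Data.Nat.Base
  open import Data.Nat.Properties as ℕₚ
  open import Data.Product.Base using (∃-syntax; _×_; _,_; proj₂)
  open import Data.Vec.Base as Vec using (Vec; []; _∷_; lookup; _[_]≔_)
  open import Relation.Binary.PropositionalEquality

  ones : ℕ → Word
  ones n = replicate n 𝟙

  ones-ʳ++ : ∀ a b → ones a ʳ++ ones b ≡ ones (a + b)
  ones-ʳ++ zero    b = refl
  ones-ʳ++ (suc a) b = trans (ones-ʳ++ a (suc b)) (cong ones (+-suc a b))

  module _ {K : ℕ} where

    pushes : Fin K → Word → Prog K
    pushes i []      = skip
    pushes i (b ∷ v) = push i b ⨾ pushes i v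

    run-≡ : ∀ {p : Prog K} {σ σ′ τ τ′ t} → σ ≡ τ → σ′ ≡ τ′ → Run p σ σ′ t → Run p τ τ′ t
    run-≡ refl refl r = r

    -- σ d l is the state in which l is still to be drained, d having been
    -- drained so far.
    run-drain : ∀ {i p T} (σ : Word → Word → Stacks K) (total : Word) →
                (∀ d l → lookup (σ d l) i ≡ l) →
                (∀ b d l → (b ∷ l) ʳ++ d ≡ total → Run (p b) (σ d (b ∷ l) [ i ]≔ l) (σ (b ∷ d) l) T) →
                ∀ d l → l ʳ++ d ≡ total → Run (drain i p) (σ d l) (σ total []) (length l * (2 + T) + 2)
    run-drain σ total top body d []      refl = done (top d [])
    run-drain {i} {p} {T} σ total top body d (b ∷ l) e = weaken
      (≤-reflexive (cong (2 +_) (sym (+-assoc T (length l * (2 + T)) 2))))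
      (pop (top d (b ∷ l)) (body b d l e) (run-drain σ total top body (b ∷ d) l e))

  -- X holds the input, U as many marks as there are address bits, V as many as
  -- the index of the current one, O the output; X′, U′ and V′ take what is
  -- drained from X, U and V.
  pattern X′ = 0F
  pattern X  = 1F
  pattern U  = 2F
  pattern U′ = 3F
  pattern V  = 4F
  pattern V′ = 5F
  pattern O  = 6F

  Program : Set
  Program = Prog 7

  S : (x′ x u u′ v v′ o : Word) → Stacks 7
  S a b c d e f g = a ∷ b ∷ c ∷ d ∷ e ∷ f ∷ g ∷ []

  emit : Word → Program
  emit = pushes O

  run-emit : ∀ {a b c d e f} w o → Run (emit w) (S a b c d e f o) (S a b c d e f (w ʳ++ o)) (suc (length w))
  run-emit []      o = skip
  run-emit (z ∷ w) o = push ⨾ run-emit w (z ∷ o)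

  run-pushesU : ∀ {a b d e f o} w c → Run (pushes U w) (S a b c d e f o) (S a b (w ʳ++ c) d e f o)
      (suc (length w))
  run-pushesU []      o = skip
  run-pushesU (z ∷ w) o = push ⨾ run-pushesU w (z ∷ o)

  -- ⌜ ones j ⌝ⁿ without its end marker, for the number j of marks on V
  tally : Program
  tally = drain V (λ b → push V′ b ⨾ push O 𝟙 ⨾ push O 𝟙) ⨾ drain V′ (push V)

  ones² : ℕ → Word
  ones² zero    = []
  ones² (suc j) = 𝟙 ∷ 𝟙 ∷ ones² j

  ⌜bitName⌝ : ∀ b e j → ⌜ bitName b (e + j) ⌝ⁿ ≡ (𝟙 ∷ 𝟘 ∷ 𝟙 ∷ b ∷ ones² e) ++ ones² j ++ 𝟘 ∷ []
  ⌜bitName⌝ b e j = cong (λ v → 𝟙 ∷ 𝟘 ∷ 𝟙 ∷ b ∷ v) (lem e)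
    where
    lem₀ : ∀ j → ⌜ ones j ⌝ⁿ ≡ ones² j ++ 𝟘 ∷ []
    lem₀ zero    = refl
    lem₀ (suc j) = cong (λ v → 𝟙 ∷ 𝟙 ∷ v) (lem₀ j)
    lem : ∀ e → ⌜ ones (e + j) ⌝ⁿ ≡ ones² e ++ ones² j ++ 𝟘 ∷ []
    lem zero    = lem₀ j
    lem (suc e) = cong (λ v → 𝟙 ∷ 𝟙 ∷ v) (lem e)

  tallyTime : ℕ → ℕ
  tallyTime m = (m * 5 + 2) + (m * 3 + 2)

  tallyTime-mono : ∀ {j m} → j ≤ m → tallyTime j ≤ tallyTime m
  tallyTime-mono j≤m = +-mono-≤ (+-monoˡ-≤ 2 (*-monoˡ-≤ 5 j≤m)) (+-monoˡ-≤ 2 (*-monoˡ-≤ 3 j≤m))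

  run-tally : ∀ {a b c d} j o → Run tally (S a b c d (ones j) [] o) (S a b c d (ones j) [] (ones² j ʳ++ o))
      (tallyTime j)
  run-tally {a} {b} {c} {d} j o =
    run-≡ refl (cong (λ v → S a b c d [] v (ones² j ʳ++ o)) (trans (ones-ʳ++ j 0) (cong ones (+-identityʳ j))))
      (count j [] o)
    ⨾ run-≡ refl (cong (λ v → S a b c d v [] (ones² j ʳ++ o))
        (trans (ones-ʳ++ j 0) (cong ones (+-identityʳ j))))
      (weaken (≤-reflexive (cong (λ k → k * 3 + 2) (length-replicate j)))
        (run-drain (λ d′ l → S a b c d d′ l (ones² j ʳ++ o)) (ones j ʳ++ []) (λ _ _ → refl)
            (λ _ _ _ _ → push) [] (ones j) refl))
    where
    count : ∀ j d′ o → Run (drain V (λ b → push V′ b ⨾ push O 𝟙 ⨾ push O 𝟙))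
              (S a b c d (ones j) d′ o) (S a b c d [] (ones j ʳ++ d′) (ones² j ʳ++ o)) (j * 5 + 2)
    count zero    d′ o = done refl
    count (suc j) d′ o = pop refl (push ⨾ push ⨾ push) (count j (𝟙 ∷ d′) (𝟙 ∷ 𝟙 ∷ o))

  progˢ : Schema → Program
  progˢ (const φ)    = emit ⌜ φ ⌝
  progˢ (bitP b e v) = emit (𝟘 ∷ 𝟙 ∷ 𝟙 ∷ 𝟙 ∷ 𝟘 ∷ 𝟙 ∷ b ∷ ones² e) ⨾ tally ⨾ emit (𝟘 ∷ ⌜ v ⌝ᵛ)
  progˢ (not s)      = emit (𝟙 ∷ 𝟘 ∷ 𝟘 ∷ []) ⨾ progˢ s
  progˢ (and s t)    = emit (𝟙 ∷ 𝟘 ∷ 𝟙 ∷ []) ⨾ progˢ s ⨾ progˢ t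
  progˢ (or s t)     = emit (𝟙 ∷ 𝟙 ∷ 𝟘 ∷ []) ⨾ progˢ s ⨾ progˢ t

  timeˢ : Schema → ℕ → ℕ
  timeˢ (const φ)    m = suc (length ⌜ φ ⌝)
  timeˢ (bitP b e v) m = suc (7 + length (ones² e)) + (tallyTime m + suc (suc (length ⌜ v ⌝ᵛ)))
  timeˢ (not s)      m = 4 + timeˢ s m
  timeˢ (and s t)    m = 4 + (timeˢ s m + timeˢ t m)
  timeˢ (or s t)     m = 4 + (timeˢ s m + timeˢ t m)

  run-progˢ : ∀ s {a b c d j m} o → j ≤ m →
              Run (progˢ s) (S a b c d (ones j) [] o) (S a b c d (ones j) [] (⌜ inst s j ⌝ ʳ++ o)) (timeˢ s m)
  run-progˢ (const φ) o j≤m = run-emit ⌜ φ ⌝ o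
  run-progˢ (bitP z e v) {a} {b} {c} {d} {j} o j≤m = run-≡ refl (cong (S a b c d (ones j) []) eq)
    (run-emit w₁ o ⨾ weaken (tallyTime-mono j≤m) (run-tally j (w₁ ʳ++ o)) ⨾ run-emit (𝟘 ∷ ⌜ v ⌝ᵛ) _)
    where
    w₁ = 𝟘 ∷ 𝟙 ∷ 𝟙 ∷ 𝟙 ∷ 𝟘 ∷ 𝟙 ∷ z ∷ ones² e
    open ≡-Reasoning
    eq : (𝟘 ∷ ⌜ v ⌝ᵛ) ʳ++ (ones² j ʳ++ (w₁ ʳ++ o)) ≡ ⌜ inst (bitP z e v) j ⌝ ʳ++ o
    eq = begin
      (𝟘 ∷ ⌜ v ⌝ᵛ) ʳ++ (ones² j ʳ++ (w₁ ʳ++ o)) ≡⟨ sym (++-ʳ++ (ones² j)) ⟩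
      (ones² j ++ 𝟘 ∷ ⌜ v ⌝ᵛ) ʳ++ (w₁ ʳ++ o)    ≡⟨ sym (++-ʳ++ w₁) ⟩
      (w₁ ++ ones² j ++ 𝟘 ∷ ⌜ v ⌝ᵛ) ʳ++ o        ≡⟨ cong (_ʳ++ o) (cong (λ u → 𝟘 ∷ 𝟙 ∷ 𝟙 ∷ u)
         (trans (cong ((𝟙 ∷ 𝟘 ∷ 𝟙 ∷ z ∷ ones² e) ++_) (sym (++-assoc (ones² j) (𝟘 ∷ []) ⌜ v ⌝ᵛ)))
           (trans (sym (++-assoc (𝟙 ∷ 𝟘 ∷ 𝟙 ∷ z ∷ ones² e) _ ⌜ v ⌝ᵛ))
               (cong (_++ ⌜ v ⌝ᵛ) (sym (⌜bitName⌝ z e j)))))) ⟩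
      ⌜ inst (bitP z e v) j ⌝ ʳ++ o ∎
  run-progˢ (not s) o j≤m = run-emit (𝟙 ∷ 𝟘 ∷ 𝟘 ∷ []) o ⨾ run-progˢ s _ j≤m
  run-progˢ (and s t) {a} {b} {c} {d} {j} o j≤m =
    run-≡ refl (cong (S a b c d (ones j) []) (sym (++-ʳ++ ⌜ inst s j ⌝)))
      (run-emit (𝟙 ∷ 𝟘 ∷ 𝟙 ∷ []) o ⨾ run-progˢ s _ j≤m ⨾ run-progˢ t _ j≤m)
  run-progˢ (or s t) {a} {b} {c} {d} {j} o j≤m =
    run-≡ refl (cong (S a b c d (ones j) []) (sym (++-ʳ++ ⌜ inst s j ⌝)))
      (run-emit (𝟙 ∷ 𝟙 ∷ 𝟘 ∷ []) o ⨾ run-progˢ s _ j≤m ⨾ run-progˢ t _ j≤m)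

  -- V grows by one mark after each conjunct, so during the loop it holds the current index and
  -- afterwards `m`, the index at which the closing schema is written.
  conjBody : Schema → Bool → Program
  conjBody s b = push U′ b ⨾ emit (𝟙 ∷ 𝟘 ∷ 𝟙 ∷ []) ⨾ progˢ s ⨾ push V 𝟙

  progᵀ : Template → Program
  progᵀ (const φ)  = emit ⌜ φ ⌝
  progᵀ (conj s t) = drain U (conjBody s) ⨾ drain U′ (push U) ⨾ progˢ t ⨾ drain V (λ _ → skip)
  progᵀ (not s)    = emit (𝟙 ∷ 𝟘 ∷ 𝟘 ∷ []) ⨾ progᵀ s
  progᵀ (and s t)  = emit (𝟙 ∷ 𝟘 ∷ 𝟙 ∷ []) ⨾ progᵀ s ⨾ progᵀ t
  progᵀ (or s t)   = emit (𝟙 ∷ 𝟙 ∷ 𝟘 ∷ []) ⨾ progᵀ s ⨾ progᵀ t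
  progᵀ (ex v s)   = emit (𝟙 ∷ 𝟙 ∷ 𝟙 ∷ 𝟘 ∷ ⌜ v ⌝ᵛ) ⨾ progᵀ s
  progᵀ (all v s)  = emit (𝟙 ∷ 𝟙 ∷ 𝟙 ∷ 𝟙 ∷ ⌜ v ⌝ᵛ) ⨾ progᵀ s

  timeᵀ : Template → ℕ → ℕ
  timeᵀ (const φ)  m = suc (length ⌜ φ ⌝)
  timeᵀ (conj s t) m = (m * (2 + (1 + (4 + (timeˢ s m + 1)))) + 2) + ((m * 3 + 2) + (timeˢ t m + (m * 3 + 2)))
  timeᵀ (not s)    m = 4 + timeᵀ s m
  timeᵀ (and s t)  m = 4 + (timeᵀ s m + timeᵀ t m)
  timeᵀ (or s t)   m = 4 + (timeᵀ s m + timeᵀ t m)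
  timeᵀ (ex v s)   m = (5 + length ⌜ v ⌝ᵛ) + timeᵀ s m
  timeᵀ (all v s)  m = (5 + length ⌜ v ⌝ᵛ) + timeᵀ s m

  -- The reversed output after the first conjuncts. In Polish notation a right-nested conjunction
  -- has nothing to be closed, so a loop can write it from left to right.
  ⋀-prefix : (ℕ → FO²) → ℕ → Word → Word
  ⋀-prefix f zero    o = o
  ⋀-prefix f (suc j) o = ⌜ f j ⌝ ʳ++ (𝟙 ∷ 𝟘 ∷ 𝟙 ∷ ⋀-prefix f j o)

  ⌜⋀⌝ : ∀ f φ j r o → ⌜ ⋀ f φ j r ⌝ ʳ++ ⋀-prefix f j o ≡ ⌜ φ ⌝ ʳ++ ⋀-prefix f (r + j) o
  ⌜⋀⌝ f φ j zero    o = refl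
  ⌜⋀⌝ f φ j (suc r) o = trans (++-ʳ++ ⌜ f j ⌝)
    (trans (⌜⋀⌝ f φ (suc j) r o) (cong (λ k → ⌜ φ ⌝ ʳ++ ⋀-prefix f k o) (+-suc r j)))

  clear : ∀ {a b c d e f} l → Run (drain V (λ _ → skip)) (S a b c d l e f) (S a b c d [] e f) (length l * 3 + 2)
  clear {a} {b} {c} {d} {e} {f} l = run-drain (λ _ l → S a b c d l e f) (l ʳ++ []) (λ _ _ → refl)
      (λ _ _ _ _ → skip) [] l refl

  run-progᵀ : ∀ s {a b} m o → Run (progᵀ s) (S a b (ones m) [] [] [] o)
      (S a b (ones m) [] [] [] (⌜ instᵀ s m ⌝ ʳ++ o)) (timeᵀ s m)
  run-progᵀ (const φ) m o = run-emit ⌜ φ ⌝ o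
  run-progᵀ (conj s t) {a} {b} m o =
    weaken (≤-reflexive (cong (λ k → k * (2 + (1 + (4 + (timeˢ s m + 1)))) + 2) (length-replicate m)))
      (run-≡ refl e₁ (run-drain family total (λ _ _ → refl) body [] (ones m) refl))
    ⨾ weaken (≤-reflexive (cong (λ k → k * 3 + 2) (length-replicate m)))
        (run-≡ refl (cong (λ u → S a b u [] (ones m) [] o′) total≡)
            (run-drain (λ d l → S a b d l (ones m) [] o′) total (λ _ _ → refl) (λ _ _ _ _ → push) []
                (ones m) refl))
    ⨾ run-progˢ t o′ ≤-refl
    ⨾ weaken (≤-reflexive (cong (λ k → k * 3 + 2) (length-replicate m)))
        (run-≡ refl (cong (S a b (ones m) [] [] []) e₂) (clear (ones m)))
    where
    o′ = ⋀-prefix (inst s) m o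
    total = ones m ʳ++ []
    total≡ : total ≡ ones m
    total≡ = trans (ones-ʳ++ m 0) (cong ones (+-identityʳ m))
    family : Word → Word → Stacks 7
    family d l = S a b l d (ones (length d)) [] (⋀-prefix (inst s) (length d) o)
    e₁ : family total [] ≡ S a b [] (ones m) (ones m) [] o′
    e₁ rewrite total≡ | length-replicate m {x = 𝟙} = refl
    e₂ : ⌜ inst t m ⌝ ʳ++ o′ ≡ ⌜ ⋀ (inst s) (inst t m) 0 m ⌝ ʳ++ o
    e₂ = sym (trans (⌜⋀⌝ (inst s) (inst t m) 0 m o)
        (cong (λ k → ⌜ inst t m ⌝ ʳ++ ⋀-prefix (inst s) k o) (+-identityʳ m)))
    body : ∀ z d l → (z ∷ l) ʳ++ d ≡ total → Run (conjBody s z) (family d (z ∷ l) [ U ]≔ l)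
        (family (z ∷ d) l) (1 + (4 + (timeˢ s m + 1)))
    body z d l e = push ⨾ run-emit (𝟙 ∷ 𝟘 ∷ 𝟙 ∷ []) _ ⨾ run-progˢ s _ d≤m ⨾ push
      where
      -- The index is the number of marks already drained from U, and the invariant of the loop says
      -- that drained and remaining marks together are the `m` initial ones.
      d≤m : length d ≤ m
      d≤m = ≤-trans (m≤n+m (length d) (suc (length l)))
        (≤-reflexive (trans (sym (length-ʳ++ (z ∷ l)))
            (trans (cong length (trans e total≡)) (length-replicate m))))
  run-progᵀ (not s) m o = run-emit (𝟙 ∷ 𝟘 ∷ 𝟘 ∷ []) o ⨾ run-progᵀ s m _
  run-progᵀ (and s t) {a} {b} m o =
    run-≡ refl (cong (S a b (ones m) [] [] []) (sym (++-ʳ++ ⌜ instᵀ s m ⌝)))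
      (run-emit (𝟙 ∷ 𝟘 ∷ 𝟙 ∷ []) o ⨾ run-progᵀ s m _ ⨾ run-progᵀ t m _)
  run-progᵀ (or s t) {a} {b} m o =
    run-≡ refl (cong (S a b (ones m) [] [] []) (sym (++-ʳ++ ⌜ instᵀ s m ⌝)))
      (run-emit (𝟙 ∷ 𝟙 ∷ 𝟘 ∷ []) o ⨾ run-progᵀ s m _ ⨾ run-progᵀ t m _)
  run-progᵀ (ex v s) {a} {b} m o =
    run-≡ refl (cong (λ w → S a b (ones m) [] [] [] w) (sym (++-ʳ++ ⌜ v ⌝ᵛ)))
      (run-emit (𝟙 ∷ 𝟙 ∷ 𝟙 ∷ 𝟘 ∷ ⌜ v ⌝ᵛ) o ⨾ run-progᵀ s m _)
  run-progᵀ (all v s) {a} {b} m o =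
    run-≡ refl (cong (λ w → S a b (ones m) [] [] [] w) (sym (++-ʳ++ ⌜ v ⌝ᵛ)))
      (run-emit (𝟙 ∷ 𝟙 ∷ 𝟙 ∷ 𝟙 ∷ ⌜ v ⌝ᵛ) o ⨾ run-progᵀ s m _)

  -- For each mark on U the whole of X is drained, leaving one mark per letter on U′, and then
  -- restored from X′. Repetition yields powers of the input length without any arithmetic.
  timesInput : Program
  timesInput =
    drain U (λ _ → drain X (λ b → push X′ b ⨾ push U′ 𝟙) ⨾ drain X′ (push X)) ⨾ drain U′ (push U)

  timesInputTime : ℕ → ℕ → ℕ
  timesInputTime u n = (u * (2 + ((n * 4 + 2) + (n * 3 + 2))) + 2) + ((u * n) * 3 + 2)

  run-timesInput : ∀ {o} w u → Run timesInput (S [] w (ones u) [] [] [] o)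
      (S [] w (ones (u * length w)) [] [] [] o)
                     (timesInputTime u (length w))
  run-timesInput {o} w u =
    weaken (≤-reflexive (cong (λ k → k * _ + 2) (length-replicate u)))
      (run-≡ refl e₁ (run-drain outer (ones u ʳ++ []) (λ _ _ → refl) body [] (ones u) refl))
    ⨾ weaken (≤-reflexive (cong (λ k → k * 3 + 2) (length-replicate (u * n))))
      (run-≡ refl (cong (λ v → S [] w v [] [] [] o)
          (trans (ones-ʳ++ (u * n) 0) (cong ones (+-identityʳ (u * n)))))
      (run-drain (λ d l → S [] w d l [] [] o) (ones (u * n) ʳ++ []) (λ _ _ → refl) (λ _ _ _ _ → push) []
          (ones (u * n)) refl))
    where
    n = length w
    outer : Word → Word → Stacks 7
    outer d l = S [] w l (ones (length d * n)) [] [] o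
    e₁ : outer (ones u ʳ++ []) [] ≡ S [] w [] (ones (u * n)) [] [] o
    e₁ = cong (λ k → S [] w [] (ones (k * n)) [] [] o)
           (trans (length-ʳ++ (ones u)) (trans (+-identityʳ _) (length-replicate u)))
    body : ∀ b d l → (b ∷ l) ʳ++ d ≡ ones u ʳ++ [] → Run
        (drain X (λ b → push X′ b ⨾ push U′ 𝟙) ⨾ drain X′ (push X))
             (outer d (b ∷ l) [ U ]≔ l) (outer (b ∷ d) l) ((n * 4 + 2) + (n * 3 + 2))
    body _ d l _ =
      run-≡ refl (cong (λ k → S (w ʳ++ []) [] l (ones (k + length d * n)) [] [] o)
          (trans (length-ʳ++ w) (+-identityʳ n)))
        (run-drain (λ d′ l′ → S d′ l′ l (ones (length d′ + length d * n)) [] [] o) (w ʳ++ []) (λ _ _ → refl)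
            (λ _ _ _ _ → push ⨾ push) [] w refl)
      ⨾ weaken (≤-reflexive (cong (λ k → k * 3 + 2) (trans (length-ʳ++ w) (+-identityʳ n))))
        (run-≡ refl (cong (λ v → S [] v l (ones (length (b′ ∷ d) * n)) [] [] o) (reverse-involutive w))
        (run-drain (λ d′ l′ → S l′ d′ l (ones (length (b′ ∷ d) * n)) [] [] o) ((w ʳ++ []) ʳ++ [])
            (λ _ _ → refl) (λ _ _ _ _ → push) [] (w ʳ++ []) refl))
      where b′ = 𝟙

  timesPower : ℕ → Program
  timesPower zero    = skip
  timesPower (suc d) = timesInput ⨾ timesPower d

  timesPowerTime : ℕ → ℕ → ℕ → ℕ
  timesPowerTime zero    u n = 1
  timesPowerTime (suc d) u n = timesInputTime u n + timesPowerTime d (u * n) n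

  run-timesPower : ∀ {o} w d u → Run (timesPower d) (S [] w (ones u) [] [] [] o)
      (S [] w (ones (u * length w ^ d)) [] [] [] o)
                     (timesPowerTime d u (length w))
  run-timesPower {o} w zero    u = run-≡ refl (cong (λ k → S [] w (ones k) [] [] [] o)
      (sym (*-identityʳ u))) skip
  run-timesPower {o} w (suc d) u = run-≡ refl (cong (λ k → S [] w (ones k) [] [] [] o)
      (*-assoc u (length w) (length w ^ d)))
    (run-timesInput w u ⨾ run-timesPower w d (u * length w))

  -- This is `2 + poly c d n`, arranged in the way in which `prepare` produces the marks.
  addressBits : ℕ → ℕ → ℕ → ℕ
  addressBits c d n = (c + 2) + c * n ^ d

  -- The scan of the input leaves its last letter on top; draining X′ into X brings up the first
  -- letter, so that the links come in the order of the input.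
  prepare : ℕ → ℕ → Program
  prepare c d = drain X′ (push X) ⨾ pushes U (ones c) ⨾ timesPower d ⨾ pushes U (ones (c + 2))

  prepareTime : ℕ → ℕ → ℕ → ℕ
  prepareTime c d n = (n * 3 + 2) + (suc c + (timesPowerTime d c n + suc (c + 2)))

  run-prepare : ∀ c d w → Run (prepare c d) (S (reverse w) [] [] [] [] [] [])
                  (S [] w (ones (addressBits c d (length w))) [] [] [] []) (prepareTime c d (length w))
  run-prepare c d w =
    weaken (≤-reflexive (cong (λ k → k * 3 + 2) (length-reverse w)))
      (run-≡ refl (cong (λ v → S [] v [] [] [] [] []) (reverse-involutive w))
        (run-drain (λ d l → S l d [] [] [] [] []) (reverse w ʳ++ []) (λ _ _ → refl) (λ _ _ _ _ → push) []
            (reverse w) refl))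
    ⨾ weaken (≤-reflexive (cong suc (length-replicate c)))
      (run-≡ refl (cong (λ v → S [] w v [] [] [] []) (trans (ones-ʳ++ c 0) (cong ones (+-identityʳ c))))
          (run-pushesU (ones c) []))
    ⨾ run-timesPower w d c
    ⨾ weaken (≤-reflexive (cong suc (length-replicate (c + 2))))
      (run-≡ refl (cong (λ v → S [] w v [] [] [] []) (ones-ʳ++ (c + 2) _)) (run-pushesU (ones (c + 2)) _))

  poly-tally : ∀ {m} → PolyBounded m → PolyBounded (λ n → tallyTime (m n))
  poly-tally p = poly-+ (poly-+ (poly-* p (poly-const 5)) (poly-const 2))
      (poly-+ (poly-* p (poly-const 3)) (poly-const 2))

  poly-timeˢ : ∀ s {m} → PolyBounded m → PolyBounded (λ n → timeˢ s (m n))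
  poly-timeˢ (const φ)    p = poly-const _
  poly-timeˢ (bitP b e v) p = poly-+ (poly-const (suc (7 + length (ones² e))))
      (poly-+ (poly-tally p) (poly-const (suc (suc (length ⌜ v ⌝ᵛ)))))
  poly-timeˢ (not s)      p = poly-+ (poly-const 4) (poly-timeˢ s p)
  poly-timeˢ (and s t)    p = poly-+ (poly-const 4) (poly-+ (poly-timeˢ s p) (poly-timeˢ t p))
  poly-timeˢ (or s t)     p = poly-+ (poly-const 4) (poly-+ (poly-timeˢ s p) (poly-timeˢ t p))

  poly-timeᵀ : ∀ s {m} → PolyBounded m → PolyBounded (λ n → timeᵀ s (m n))
  poly-timeᵀ (const φ)  p = poly-const _
  poly-timeᵀ (conj s t) p =
    poly-+ (poly-+ (poly-* p (poly-+ (poly-const 7) (poly-+ (poly-timeˢ s p) (poly-const 1)))) (poly-const 2))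
      (poly-+ (poly-+ (poly-* p (poly-const 3)) (poly-const 2))
        (poly-+ (poly-timeˢ t p) (poly-+ (poly-* p (poly-const 3)) (poly-const 2))))
  poly-timeᵀ (not s)    p = poly-+ (poly-const 4) (poly-timeᵀ s p)
  poly-timeᵀ (and s t)  p = poly-+ (poly-const 4) (poly-+ (poly-timeᵀ s p) (poly-timeᵀ t p))
  poly-timeᵀ (or s t)   p = poly-+ (poly-const 4) (poly-+ (poly-timeᵀ s p) (poly-timeᵀ t p))
  poly-timeᵀ (ex v s)   p = poly-+ (poly-const (5 + length ⌜ v ⌝ᵛ)) (poly-timeᵀ s p)
  poly-timeᵀ (all v s)  p = poly-+ (poly-const (5 + length ⌜ v ⌝ᵛ)) (poly-timeᵀ s p)

  poly-^ : ∀ d → PolyBounded (λ n → n ^ d)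
  poly-^ zero    = poly-const 1
  poly-^ (suc d) = poly-* poly-id (poly-^ d)

  poly-timesInput : ∀ {u} → PolyBounded u → PolyBounded (λ n → timesInputTime (u n) n)
  poly-timesInput p = poly-+
    (poly-+ (poly-* p (poly-+ (poly-const 2) (poly-+ (poly-+ (poly-* poly-id (poly-const 4)) (poly-const 2))
                                                     (poly-+ (poly-* poly-id (poly-const 3)) (poly-const
                                                         2))))) (poly-const 2))
    (poly-+ (poly-* (poly-* p poly-id) (poly-const 3)) (poly-const 2))

  poly-timesPower : ∀ d {u} → PolyBounded u → PolyBounded (λ n → timesPowerTime d (u n) n)
  poly-timesPower zero    p = poly-const 1
  poly-timesPower (suc d) p = poly-+ (poly-timesInput p) (poly-timesPower d (poly-* p poly-id))

  poly-addressBits : ∀ c d → PolyBounded (addressBits c d)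
  poly-addressBits c d = poly-+ (poly-const (c + 2)) (poly-* (poly-const c) (poly-^ d))

  poly-prepare : ∀ c d → PolyBounded (prepareTime c d)
  poly-prepare c d = poly-+ (poly-+ (poly-* poly-id (poly-const 3)) (poly-const 2))
    (poly-+ (poly-const (suc c)) (poly-+ (poly-timesPower d (poly-const c)) (poly-const (suc (c + 2)))))

  -- The last stack holds the output reversed since its top is the symbol pushed last; the linear
  -- summand of the bound pays for the scan of the input.
  program-polyTime : ∀ {k} (p : Prog (suc k)) (f : Word → Word) (g : ℕ → ℕ) → PolyBounded (λ n → suc n + g n) →
                     (∀ w → ∃[ σ ] Run p (initialStacks p w) σ (g (length w)) × Vec.last σ ≡ reverse (f w))
                         → PolyTime f
  program-polyTime {k} p f g (c , d , bound) runs = k , machine p , c , d , computed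
    where
    computed : ComputesInTime (machine p) (poly c d) f
    computed w with runs w
    ... | σ , r , e with machine-computes p w r
    ... | t , t≤ , halted , out = t , ≤-trans t≤ (bound (length w)) , halted ,
      subst (Vec.last (Config.tapes (run (machine p) t w)) contains_)
          (trans (cong reverse e) (reverse-involutive (f w))) out

  module _ (c d : ℕ) (start : Word) (H : Template) (mid : Word)
           (before : Bool → Word) (G : Template) (after end : Word) where

    -- The formula describing the input is a right-nested chain. Its Polish code is therefore a
    -- plain concatenation, one link per letter, completed by `end`.
    linkText : ℕ → Bool → Word
    linkText m b = before b ++ ⌜ instᵀ G m ⌝ ++ after

    text : Word → Word
    text w = start ++ ⌜ instᵀ H m ⌝ ++ mid ++ concatMap (linkText m) w ++ end
      where m = addressBits c d (length w)

    linkProg : Bool → Program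
    linkProg b = emit (before b) ⨾ progᵀ G ⨾ emit after

    writer : Program
    writer = prepare c d ⨾ emit start ⨾ progᵀ H ⨾ emit mid ⨾ drain X linkProg ⨾ emit end

    linkTime : ℕ → ℕ
    linkTime m = suc (length (before 𝟘) + length (before 𝟙)) + (timeᵀ G m + suc (length after))

    run-link : ∀ {a q} m b o → Run (linkProg b) (S a q (ones m) [] [] [] o)
                 (S a q (ones m) [] [] [] (linkText m b ʳ++ o)) (linkTime m)
    run-link {a} {q} m b o = run-≡ refl (cong (S a q (ones m) [] [] []) e)
      (weaken (s≤s (len b)) (run-emit (before b) o) ⨾ run-progᵀ G m _ ⨾ run-emit after _)
      where
      len : ∀ b → length (before b) ≤ length (before 𝟘) + length (before 𝟙)
      len 𝟘 = m≤m+n _ _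
      len 𝟙 = m≤n+m _ _
      e : after ʳ++ (⌜ instᵀ G m ⌝ ʳ++ (before b ʳ++ o)) ≡ linkText m b ʳ++ o
      e = sym (trans (++-ʳ++ (before b)) (++-ʳ++ ⌜ instᵀ G m ⌝))

    links : ℕ → Word → Word → Word
    links m o []      = o
    links m o (b ∷ d) = linkText m b ʳ++ links m o d

    links-ʳ++ : ∀ m o w d → links m o (w ʳ++ d) ≡ concatMap (linkText m) w ʳ++ links m o d
    links-ʳ++ m o []      d = refl
    links-ʳ++ m o (b ∷ w) d = trans (links-ʳ++ m o w (b ∷ d)) (sym (++-ʳ++ (linkText m b)))

    writerTime : ℕ → ℕ
    writerTime n = prepareTime c d n + (suc (length start) + (timeᵀ H m + (suc (length mid)
      + ((n * (2 + linkTime m) + 2) + suc (length end)))))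
      where m = addressBits c d n

    run-writer : ∀ w → ∃[ u ] Run writer (initialStacks writer w) (S [] [] u [] [] [] (text w ʳ++ []))
        (writerTime (length w))
    run-writer w = _ , run-prepare c d w ⨾ run-emit start [] ⨾ run-progᵀ H m _ ⨾ run-emit mid _
      ⨾ run-drain (λ d l → S [] l (ones m) [] [] [] (links m o d)) (w ʳ++ []) (λ _ _ → refl)
          (λ b d l _ → run-link m b (links m o d)) [] w refl
      ⨾ run-≡ refl (cong (S [] [] (ones m) [] [] []) e) (run-emit end _)
      where
      m = addressBits c d (length w)
      o = mid ʳ++ (⌜ instᵀ H m ⌝ ʳ++ (start ʳ++ []))
      e : end ʳ++ links m o (w ʳ++ []) ≡ text w ʳ++ []
      e = trans (cong (end ʳ++_) (links-ʳ++ m o w []))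
        (sym (trans (++-ʳ++ start) (trans (++-ʳ++ ⌜ instᵀ H m ⌝)
            (trans (++-ʳ++ mid) (++-ʳ++ (concatMap (linkText m) w))))))

    poly-writer : PolyBounded (λ n → suc n + writerTime n)
    poly-writer = poly-+ (poly-+ (poly-const 1) poly-id)
        (poly-+ (poly-prepare c d) (poly-+ (poly-const (suc (length start)))
      (poly-+ (poly-timeᵀ H pm) (poly-+ (poly-const (suc (length mid))) (poly-+
        (poly-+ (poly-* poly-id (poly-+ (poly-const 2)
            (poly-+ (poly-const (suc (length (before 𝟘) + length (before 𝟙))))
          (poly-+ (poly-timeᵀ G pm) (poly-const (suc (length after))))))) (poly-const 2))
              (poly-const (suc (length end))))))))
      where pm = poly-addressBits c d

    text-polyTime : PolyTime text
    text-polyTime = program-polyTime writer text writerTime poly-writer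
      (λ w → _ , proj₂ (run-writer w) , refl)

-- Binary numbers and subtraction of 1 modulo a power of two

module Addresses where

  open import Data.Bool.Base as Bool using (Bool; true; false; _xor_; not)
  open import Data.Empty using (⊥-elim)
  open import Data.Nat.Base
  open import Data.Nat.Properties as ℕₚ
  open import Data.Nat.Solver using (module +-*-Solver)
  open import Data.Product.Base using (_×_; _,_; proj₁; proj₂)
  open import Function.Base using (_∘_)
  open import Relation.Binary.PropositionalEquality

  ⟦_⟧ : Bool → ℕ
  ⟦ false ⟧ = 0
  ⟦ true  ⟧ = 1

  value : (ℕ → Bool) → ℕ → ℕ
  value f zero    = 0
  value f (suc r) = ⟦ f 0 ⟧ + 2 * value (f ∘ suc) r

  value-< : ∀ f r → value f r < 2 ^ r
  value-< f zero    = s≤s z≤n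
  value-< f (suc r) = begin-strict
    ⟦ f 0 ⟧ + 2 * value (f ∘ suc) r  <⟨ +-monoˡ-< _ (lem (f 0)) ⟩
    2 + 2 * value (f ∘ suc) r        ≡⟨ sym (*-suc 2 (value (f ∘ suc) r)) ⟩
    2 * suc (value (f ∘ suc) r)      ≤⟨ *-monoʳ-≤ 2 (value-< (f ∘ suc) r) ⟩
    2 * 2 ^ r                        ∎
    where
    open ≤-Reasoning
    lem : ∀ b → ⟦ b ⟧ < 2
    lem false = s≤s z≤n
    lem true  = s≤s (s≤s z≤n)

  digit-injective : ∀ b b′ k k′ → ⟦ b ⟧ + 2 * k ≡ ⟦ b′ ⟧ + 2 * k′ → b ≡ b′ × k ≡ k′
  digit-injective false false k k′ e = refl , *-cancelˡ-≡ k k′ 2 e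
  digit-injective true  true  k k′ e = refl , *-cancelˡ-≡ k k′ 2 (suc-injective e)
  digit-injective false true  k k′ e = ⊥-elim (even≢odd k k′ e)
  digit-injective true  false k k′ e = ⊥-elim (even≢odd k′ k (sym e))

  value-injective : ∀ f g r → value f r ≡ value g r → ∀ j → j < r → f j ≡ g j
  value-injective f g (suc r) e zero    _         = proj₁
      (digit-injective (f 0) (g 0) (value (f ∘ suc) r) (value (g ∘ suc) r) e)
  value-injective f g (suc r) e (suc j) (s≤s j<r) =
    value-injective (f ∘ suc) (g ∘ suc) r (proj₂
        (digit-injective (f 0) (g 0) (value (f ∘ suc) r) (value (g ∘ suc) r) e)) j j<r

  value-cong : ∀ f g r → (∀ j → j < r → f j ≡ g j) → value f r ≡ value g r
  value-cong f g zero    e = refl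
  value-cong f g (suc r) e = cong₂ (λ b k → ⟦ b ⟧ + 2 * k) (e 0 (s≤s z≤n))
    (value-cong (f ∘ suc) (g ∘ suc) r (λ j j<r → e (suc j) (s≤s j<r)))

  odd : ℕ → Bool
  odd zero          = false
  odd (suc zero)    = true
  odd (suc (suc n)) = odd n

  digit : ℕ → ℕ → Bool
  digit a zero    = odd a
  digit a (suc j) = digit ⌊ a /2⌋ j

  odd-half : ∀ a → ⟦ odd a ⟧ + 2 * ⌊ a /2⌋ ≡ a
  odd-half zero          = refl
  odd-half (suc zero)    = refl
  odd-half (suc (suc a)) = trans (cong (⟦ odd a ⟧ +_) (*-suc 2 ⌊ a /2⌋))
    (trans (+-suc ⟦ odd a ⟧ _) (trans (cong suc (+-suc ⟦ odd a ⟧ _)) (cong (suc ∘ suc) (odd-half a))))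

  value-digit : ∀ a r → a < 2 ^ r → value (digit a) r ≡ a
  value-digit zero    zero    _        = refl
  value-digit (suc a) zero    (s≤s ())
  value-digit a       (suc r) a<       = trans (cong (λ k → ⟦ odd a ⟧ + 2 * k)
      (value-digit ⌊ a /2⌋ r half<)) (odd-half a)
    where
    half< : ⌊ a /2⌋ < 2 ^ r
    half< = *-cancelˡ-< 2 ⌊ a /2⌋ (2 ^ r)
      (≤-<-trans (≤-trans (m≤n+m _ ⟦ odd a ⟧) (≤-reflexive (odd-half a))) a<)

  -- c is the chain of borrows when c 0 is subtracted from the number with digits a.
  IsBorrow : (a c : ℕ → Bool) → ℕ → Set
  IsBorrow a c r = ∀ j → j < r → c (suc j) ≡ c j Bool.∧ not (a j)

  difference : (a c : ℕ → Bool) → ℕ → Bool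
  difference a c j = a j xor c j

  borrow-digit : ∀ a c → ⟦ a xor c ⟧ + ⟦ c ⟧ ≡ ⟦ a ⟧ + 2 * ⟦ c Bool.∧ not a ⟧
  borrow-digit false false = refl
  borrow-digit false true  = refl
  borrow-digit true  false = refl
  borrow-digit true  true  = refl

  -- Each digit satisfies `borrow-digit`; weighted by powers of two, the intermediate borrows cancel
  -- and only the incoming and the outgoing one remain.
  value-difference : ∀ a c r → IsBorrow a c r →
    value (difference a c) r + ⟦ c 0 ⟧ ≡ value a r + 2 ^ r * ⟦ c r ⟧
  value-difference a c zero    h = sym (+-identityʳ ⟦ c 0 ⟧)
  value-difference a c (suc r) h = begin
    (⟦ a 0 xor c 0 ⟧ + 2 * d) + ⟦ c 0 ⟧        ≡⟨ solve 3 (λ u v w → (u :+ v) :+ w := (u :+ w) :+ v) refl ⟦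
        a 0 xor c 0 ⟧ (2 * d) ⟦ c 0 ⟧ ⟩
    (⟦ a 0 xor c 0 ⟧ + ⟦ c 0 ⟧) + 2 * d        ≡⟨ cong (_+ 2 * d) (borrow-digit (a 0) (c 0)) ⟩
    (⟦ a 0 ⟧ + 2 * ⟦ c 0 Bool.∧ not (a 0) ⟧) + 2 * d ≡⟨ cong (λ b → (⟦ a 0 ⟧ + 2 * ⟦ b ⟧) + 2 * d)
        (sym (h 0 (s≤s z≤n))) ⟩
    (⟦ a 0 ⟧ + 2 * ⟦ c 1 ⟧) + 2 * d            ≡⟨ solve 3
        (λ u v w → (u :+ con 2 :* v) :+ con 2 :* w := u :+ con 2 :* (w :+ v)) refl ⟦ a 0 ⟧ ⟦ c 1 ⟧ d ⟩
    ⟦ a 0 ⟧ + 2 * (d + ⟦ c 1 ⟧)                ≡⟨ cong (λ k → ⟦ a 0 ⟧ + 2 * k)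
        (value-difference (a ∘ suc) (c ∘ suc) r (λ j j<r → h (suc j) (s≤s j<r))) ⟩
    ⟦ a 0 ⟧ + 2 * (value (a ∘ suc) r + 2 ^ r * ⟦ c (suc r) ⟧)
      ≡⟨ solve 4 (λ u v w z → u :+ con 2 :* (v :+ w :* z) := (u :+ con 2 :* v) :+ (con 2 :* w) :* z) refl ⟦
          a 0 ⟧ (value (a ∘ suc) r) (2 ^ r) ⟦ c (suc r) ⟧ ⟩
    value a (suc r) + 2 ^ suc r * ⟦ c (suc r) ⟧ ∎
    where
    open ≡-Reasoning
    open +-*-Solver hiding (⟦_⟧)
    d = value (difference (a ∘ suc) (c ∘ suc)) r

  pred[mod1+_] : ℕ → ℕ → ℕ
  pred[mod1+ n ] zero    = n
  pred[mod1+ n ] (suc a) = a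

  module _ (a c : ℕ → Bool) (r n : ℕ) (N≡ : suc n ≡ 2 ^ r) (h : IsBorrow a c r) (c₀ : c 0 ≡ true) where

    private
      d = value (difference a c) r
      d< : d < suc n
      d< = subst (d <_) (sym N≡) (value-< (difference a c) r)
      eq : ∀ b → c r ≡ b → suc d ≡ value a r + suc n * ⟦ b ⟧
      eq b refl = trans (trans (+-comm 1 d) (cong (λ b → d + ⟦ b ⟧) (sym c₀)))
        (trans (value-difference a c r h) (cong (λ k → value a r + k * ⟦ c r ⟧) (sym N≡)))

    -- With incoming borrow 1, `d + 1` is the value of `a` plus `2 ^ r` times the outgoing borrow.
    -- As `d` lies below `2 ^ r`, a borrow goes out exactly if `a` is 0, which is the case of
    -- wrapping around.
    value-pred : d ≡ pred[mod1+ n ] (value a r)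
    value-pred with c r in e | value a r in v
    ... | false | suc k = suc-injective (trans (eq false e)
        (trans (cong₂ _+_ v (*-zeroʳ (suc n))) (+-identityʳ (suc k))))
    ... | false | zero  = ⊥-elim (1+n≢0 (trans (eq false e) (cong₂ _+_ v (*-zeroʳ (suc n)))))
    ... | true  | zero  = suc-injective (trans (eq true e) (cong₂ _+_ v (*-identityʳ (suc n))))
    ... | true  | suc k = ⊥-elim (<⇒≱ d< (≤-trans (m≤n+m (suc n) k)
      (≤-reflexive (suc-injective (sym (trans (eq true e) (cong₂ _+_ v (*-identityʳ (suc n)))))))))

    -- Together with its converse this makes address 0, the place of the head, definable by the
    -- single atom for the outgoing borrow.
    borrow⇒zero : c r ≡ true → value a r ≡ 0
    borrow⇒zero e with value a r in v
    ... | zero  = refl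
    ... | suc k = ⊥-elim (<⇒≱ d< (≤-trans (m≤n+m (suc n) k)
      (≤-reflexive (suc-injective (sym (trans (eq true e) (cong₂ _+_ v (*-identityʳ (suc n)))))))))

    zero⇒borrow : value a r ≡ 0 → c r ≡ true
    zero⇒borrow v with c r in e
    ... | true  = refl
    ... | false = ⊥-elim (1+n≢0 (trans (eq false e) (cong₂ _+_ v (*-zeroʳ (suc n)))))

-- Meanings of formulas, coding of attributes, comparison of addresses

module Satisfaction where

  open Schemas
  open Addresses
  open import Data.Bool.Base as Bool using (Bool; true; false; T; _xor_; if_then_else_)
  open import Data.Bool.Properties using (T?)
  open import Data.Empty using (⊥-elim)
  open import Data.Fin.Base as Fin using (Fin; zero; suc)
  import Data.Fin.Properties as Finₚ
  open import Data.List.Base as List using ([]; _∷_; _++_; replicate)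
  open import Data.Nat.Base
  open import Data.Nat.Properties as ℕₚ using (≤-refl; +-suc; +-identityʳ)
  open import Data.Product.Base using (∃-syntax; _×_; _,_; proj₁; proj₂)
  open import Data.Sum.Base using (_⊎_; inj₁; inj₂)
  open import Data.Unit.Base using (⊤; tt)
  open import Data.Vec.Base as Vec using (Vec; []; _∷_)
  open import Function.Base using (_∘_; id)
  open import Function.Bundles using (_⇔_; mk⇔; Equivalence)
  open import Relation.Binary.PropositionalEquality
  open import Relation.Nullary using (Dec; yes; no; does; ¬_; ¬?; _×-dec_; _⊎-dec_)

  open Structure using (Universe; Assignment)
  open Equivalence using (to; from)

  infixr 4 _⇒_
  _⇒_ : FO² → FO² → FO²
  φ ⇒ ψ = ∼ φ ∨ ψ

  ⊤′ : FO²
  ⊤′ = x ≐ x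

  impᵀ : Template → Template → Template
  impᵀ s t = or (not s) t

  iff : Schema → Schema → Schema
  iff s t = or (and s t) (and (not s) (not t))

  _≡ᵇ′_ : Bool → Bool → Bool
  true  ≡ᵇ′ b = b
  false ≡ᵇ′ b = Bool.not b

  T-≡ᵇ′ : ∀ b c → T (b ≡ᵇ′ c) ⇔ b ≡ c
  T-≡ᵇ′ true  true  = mk⇔ (λ _ → refl) (λ _ → tt)
  T-≡ᵇ′ false false = mk⇔ (λ _ → refl) (λ _ → tt)
  T-≡ᵇ′ true  false = mk⇔ (λ ()) (λ ())
  T-≡ᵇ′ false true  = mk⇔ (λ ()) (λ ())

  -- Exclusive or is not among the schemas, but it is equivalence with one side negated. This is the
  -- form in which `Pred` states a digit of the difference.
  T-≡ᵇ′-xor : ∀ a b c → T (a ≡ᵇ′ (b ≡ᵇ′ Bool.not c)) ⇔ a ≡ b xor c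
  T-≡ᵇ′-xor a b c = mk⇔
    (λ t → trans (to (T-≡ᵇ′ a _) t) (lem b c)) (λ e → from (T-≡ᵇ′ a _) (trans e (sym (lem b c))))
    where
    lem : ∀ b c → b ≡ᵇ′ Bool.not c ≡ b xor c
    lem true  c     = refl
    lem false true  = refl
    lem false false = refl

  module _ (𝔄 : Structure) where

    sat? : ∀ s φ → Dec (𝔄 ⊨[ s ] φ)
    sat? s (u ≐ v)  = s u Finₚ.≟ s v
    sat? s (u ≤₁ v) = T? _
    sat? s (u ≾₂ v) = T? _
    sat? s (P p u)  = T? _
    sat? s (∼ φ)    = ¬? (sat? s φ)
    sat? s (φ ∧ ψ)  = sat? s φ ×-dec sat? s ψ
    sat? s (φ ∨ ψ)  = sat? s φ ⊎-dec sat? s ψ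
    sat? s (∃′ u φ) = Finₚ.any? (λ a → sat? (s [ u ≔ a ]) φ)
    sat? s (∀′ u φ) = Finₚ.all? (λ a → sat? (s [ u ≔ a ]) φ)

    infix 3 _⊢_says_
    -- A record and not a bare equivalence: satisfaction computes on the formula, and keeping `φ` as
    -- an index lets it be inferred when meanings are composed.
    record _⊢_says_ (s : Assignment 𝔄) (φ : FO²) (A : Set) : Set where
      constructor via
      field
        to   : 𝔄 ⊨[ s ] φ → A
        from : A → 𝔄 ⊨[ s ] φ
    open _⊢_says_

    says-refl : ∀ {s} φ → s ⊢ φ says (𝔄 ⊨[ s ] φ)
    says-refl φ = via id id

    says-⊤ : ∀ {s} → s ⊢ ⊤′ says ⊤
    says-⊤ = via (λ _ → tt) (λ _ → refl)

    says-map : ∀ {s φ A B} → s ⊢ φ says A → A ⇔ B → s ⊢ φ says B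
    says-map p e = via (Equivalence.to e ∘ to p) (from p ∘ Equivalence.from e)

    says-∼ : ∀ {s φ A} → s ⊢ φ says A → s ⊢ ∼ φ says (¬ A)
    says-∼ p = via (λ n a → n (from p a)) (λ n a → n (to p a))

    says-∧ : ∀ {s φ ψ A B} → s ⊢ φ says A → s ⊢ ψ says B → s ⊢ φ ∧ ψ says (A × B)
    says-∧ p q = via (λ (a , b) → to p a , to q b) (λ (a , b) → from p a , from q b)

    says-∨ : ∀ {s φ ψ A B} → s ⊢ φ says A → s ⊢ ψ says B → s ⊢ φ ∨ ψ says (A ⊎ B)
    says-∨ p q = via (λ where (inj₁ a) → inj₁ (to p a)
                              (inj₂ b) → inj₂ (to q b))
                     (λ where (inj₁ a) → inj₁ (from p a)
                              (inj₂ b) → inj₂ (from q b))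

    says-⇒ : ∀ {s φ ψ A B} → s ⊢ φ says A → s ⊢ ψ says B → s ⊢ φ ⇒ ψ says (A → B)
    says-⇒ {s} {φ} {ψ} {A} {B} p q = via elim intro
      where
      elim : 𝔄 ⊨[ s ] (φ ⇒ ψ) → A → B
      elim (inj₁ n) a = ⊥-elim (n (from p a))
      elim (inj₂ b) a = to q b
      intro : (A → B) → 𝔄 ⊨[ s ] (φ ⇒ ψ)
      -- An implication is a disjunction here, so it has to be decided whether `φ` holds; this is
      -- possible because the universe is finite.
      intro f with sat? s φ
      ... | yes a = inj₂ (from q (f (to p a)))
      ... | no n  = inj₁ n

    says-∀ : ∀ {s φ} u {A : Universe 𝔄 → Set} → (∀ a → s [ u ≔ a ] ⊢ φ says A a) → s ⊢ ∀′ u φ says (∀ a → A a)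
    says-∀ u p = via (λ f a → to (p a) (f a)) (λ f a → from (p a) (f a))

    says-∃ : ∀ {s φ} u {A : Universe 𝔄 → Set} → (∀ a → s [ u ≔ a ] ⊢ φ says A a) → s ⊢ ∃′ u φ says (∃[ a ] A a)
    says-∃ u p = via (λ (a , h) → a , to (p a) h) (λ (a , h) → a , from (p a) h)

    says-∼ᵇ : ∀ {s φ} b → s ⊢ φ says T b → s ⊢ ∼ φ says T (Bool.not b)
    says-∼ᵇ true  p = via (λ n → n (from p tt)) (λ ())
    says-∼ᵇ false p = via (λ _ → tt) (λ _ → to p)

    says-∧ᵇ : ∀ {s φ ψ} b c → s ⊢ φ says T b → s ⊢ ψ says T c → s ⊢ φ ∧ ψ says T (b Bool.∧ c)
    says-∧ᵇ true  c p q = via (λ (_ , h) → to q h) (λ h → from p tt , from q h)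
    says-∧ᵇ false c p q = via (λ (h , _) → to p h) (λ ())

    says-iff : ∀ {s j} S S′ b c → s ⊢ inst S j says T b → s ⊢ inst S′ j says T c →
               s ⊢ inst (iff S S′) j says T (b ≡ᵇ′ c)
    says-iff S S′ b c p q = says-map (says-∨ (says-∧ᵇ b c p q) (says-∧ᵇ _ _ (says-∼ᵇ b p) (says-∼ᵇ c q)))
        (lem b c)
      where
      lem : ∀ b c → (T (b Bool.∧ c) ⊎ T (Bool.not b Bool.∧ Bool.not c)) ⇔ T (b ≡ᵇ′ c)
      lem true  true  = mk⇔ (λ _ → tt) (λ _ → inj₁ tt)
      lem true  false = mk⇔ (λ where (inj₁ ()); (inj₂ ())) (λ ())
      lem false true  = mk⇔ (λ where (inj₁ ()); (inj₂ ())) (λ ())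
      lem false false = mk⇔ (λ _ → tt) (λ _ → inj₂ tt)

    says-⋀ : ∀ {s φ B} (f : ℕ → FO²) m {A : ℕ → Set} → (∀ j → s ⊢ f j says A j) → s ⊢ φ says B →
             s ⊢ ⋀ f φ 0 m says ((∀ j → j < m → A j) × B)
    says-⋀ {s} {φ} {B} f m {A} p q = via
      (λ h → (λ j → proj₁ (elim 0 m h) j z≤n) , proj₂ (elim 0 m h))
      (λ (h , b) → intro 0 m (λ j _ → h j) b)
      where
      elim : ∀ j r → 𝔄 ⊨[ s ] ⋀ f φ j r → (∀ i → j ≤ i → i < j + r → A i) × B
      elim j zero    h = (λ i j≤i i< → ⊥-elim (ℕₚ.<⇒≱ i< (ℕₚ.≤-trans (ℕₚ.≤-reflexive (+-identityʳ j)) j≤i)))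
          , to q h
      elim j (suc r) (h , hs) with elim (suc j) r hs
      ... | g , b = (λ i j≤i i< → case i j≤i (subst (i <_) (+-suc j r) i<) (ℕₚ.m≤n⇒m<n∨m≡n j≤i)) , b
        where
        case : ∀ i → j ≤ i → i < suc j + r → j < i ⊎ j ≡ i → A i
        case i _ i< (inj₁ j<i)  = g i j<i i<
        case i _ i< (inj₂ refl) = to (p j) h
      intro : ∀ j r → (∀ i → j ≤ i → i < j + r → A i) → B → 𝔄 ⊨[ s ] ⋀ f φ j r
      intro j zero    h b = from q b
      intro j (suc r) h b = from (p j) (h j ≤-refl (subst (j <_) (sym (+-suc j r)) (s≤s (ℕₚ.m≤m+n j r)))) ,
        intro (suc j) r (λ i j<i i< → h i (ℕₚ.<⇒≤ j<i) (subst (i <_) (sym (+-suc j r)) i<)) b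

  -- `decode` is total: whatever bits a model assigns to an element, they denote some value, and no
  -- axiom has to exclude ill-formed codes.
  record Codec (A : Set) : Set where
    field
      width         : ℕ
      encode        : A → Vec Bool width
      decode        : Vec Bool width → A
      decode-encode : ∀ a → decode (encode a) ≡ a

    _≟_ : (a b : A) → Dec (a ≡ b)
    a ≟ b with Vecₚ.≡-dec Boolₚ._≟_ (encode a) (encode b)
      where
      import Data.Vec.Properties as Vecₚ
      import Data.Bool.Properties as Boolₚ
    ... | yes e = yes (trans (sym (decode-encode a)) (trans (cong decode e) (decode-encode b)))
    ... | no n  = no (n ∘ cong encode)

  codec-Bool : Codec Bool
  codec-Bool = record { width = 1 ; encode = _∷ [] ; decode = Vec.head ; decode-encode = λ _ → refl }

  -- Unary coding: the first true bit decides, and a vector without any denotes `default`.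
  codec-Fin : ∀ {n} → Fin n → Codec (Fin n)
  codec-Fin {n} default = record
    { width = n ; encode = enc n ; decode = dec id ; decode-encode = dec-enc n id }
    where
    enc : ∀ n → Fin n → Vec Bool n
    enc (suc n) zero    = true ∷ Vec.replicate n false
    enc (suc n) (suc a) = false ∷ enc n a
    dec : ∀ {k} → (Fin k → Fin n) → Vec Bool k → Fin n
    dec f []          = default
    dec f (true ∷ v)  = f zero
    dec f (false ∷ v) = dec (f ∘ suc) v
    dec-enc : ∀ k (f : Fin k → Fin n) a → dec f (enc k a) ≡ f a
    dec-enc (suc k) f zero    = refl
    dec-enc (suc k) f (suc a) = dec-enc k (f ∘ suc) a

  infixr 4 _×-codec_
  _×-codec_ : ∀ {A B} → Codec A → Codec B → Codec (A × B)
  C ×-codec D = record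
    { width  = C.width + D.width
    ; encode = λ (a , b) → C.encode a Vec.++ D.encode b
    ; decode = λ v → C.decode (Vec.take C.width v) , D.decode (Vec.drop C.width v)
    ; decode-encode = λ (a , b) → cong₂ _,_
        (trans (cong C.decode (take-++ (C.encode a))) (C.decode-encode a))
        (trans (cong D.decode (drop-++ (C.encode a))) (D.decode-encode b))
    }
    where
    module C = Codec C
    module D = Codec D
    take-++ : ∀ {k l} (u : Vec Bool k) {v : Vec Bool l} → Vec.take k (u Vec.++ v) ≡ u
    take-++ []      = refl
    take-++ (b ∷ u) = cong (b ∷_) (take-++ u)
    drop-++ : ∀ {k l} (u : Vec Bool k) {v : Vec Bool l} → Vec.drop k (u Vec.++ v) ≡ v
    drop-++ []      = refl
    drop-++ (b ∷ u) = drop-++ u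

  codec-retract : ∀ {A B : Set} (f : A → B) (g : B → A) → (∀ a → g (f a) ≡ a) → Codec B → Codec A
  codec-retract f g gf C = record
    { width = width ; encode = encode ∘ f ; decode = g ∘ decode
    ; decode-encode = λ a → trans (cong g (decode-encode (f a))) (gf a) }
    where open Codec C

  attributeName : ℕ → Name
  attributeName i = 𝟙 ∷ replicate i 𝟙

  truth : ∀ {A : Set} → Dec A → FO²
  truth a? = if does a? then ⊤′ else ∼ ⊤′

  -- The Shannon expansion of k by the first n bits of u expresses any property of
  -- these bits.
  shannon : Var → ∀ n → (ℕ → Name) → (Vec Bool n → FO²) → FO²
  shannon u zero    p k = k []
  shannon u (suc n) p k = (P (p 0) u ∧ shannon u n (p ∘ suc) (k ∘ (true ∷_)))
                        ∨ (∼ P (p 0) u ∧ shannon u n (p ∘ suc) (k ∘ (false ∷_)))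

  read : ∀ n → (ℕ → Bool) → Vec Bool n
  read zero    f = []
  read (suc n) f = f 0 ∷ read n (f ∘ suc)

  at : ∀ {n} → Vec Bool n → ℕ → Bool
  at []      _       = false
  at (b ∷ v) zero    = b
  at (b ∷ v) (suc i) = at v i

  read-at : ∀ {n} (v : Vec Bool n) → read n (at v) ≡ v
  read-at []      = refl
  read-at (b ∷ v) = cong (b ∷_) (read-at v)

  read-cong : ∀ n {f g : ℕ → Bool} → (∀ i → f i ≡ g i) → read n f ≡ read n g
  read-cong zero    e = refl
  read-cong (suc n) e = cong₂ _∷_ (e 0) (read-cong n (e ∘ suc))

  module _ (𝔄 : Structure) where
    open _⊢_says_

    open Structure 𝔄 using (unary)

    says-truth : ∀ {s A} (a? : Dec A) → _⊢_says_ 𝔄 s (truth a?) A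
    says-truth (yes a) = via (λ _ → a) (λ _ → refl)
    says-truth (no n)  = via (λ h → ⊥-elim (h refl)) (λ a → ⊥-elim (n a))

    says-shannon : ∀ {s} u n p k {A : Vec Bool n → Set} → (∀ v → _⊢_says_ 𝔄 s (k v) (A v)) →
                   _⊢_says_ 𝔄 s (shannon u n p k) (A (read n (λ i → unary (p i) (s u))))
    says-shannon u zero    p k h = h []
    says-shannon {s} u (suc n) p k {A} h = lem (unary (p 0) (s u)) refl
      where
      lem : ∀ b → unary (p 0) (s u) ≡ b → _⊢_says_ 𝔄 s (shannon u (suc n) p k)
          (A (b ∷ read n (λ i → unary (p (suc i)) (s u))))
      lem true  e = via (λ where (inj₁ (_ , h′)) → to ih h′
                                 (inj₂ (n , _)) → ⊥-elim (n (subst T (sym e) tt)))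
                        (λ a → inj₁ (subst T (sym e) tt , from ih a))
        where ih = says-shannon u n (p ∘ suc) (k ∘ (true ∷_)) (λ v → h (true ∷ v))
      lem false e = via (λ where (inj₂ (_ , h′)) → to ih h′
                                 (inj₁ (t , _)) → ⊥-elim (subst T e t))
                        (λ a → inj₂ ((λ t → subst T e t) , from ih a))
        where ih = says-shannon u n (p ∘ suc) (k ∘ (false ∷_)) (λ v → h (false ∷ v))

  module Attributes {A : Set} (C : Codec A) where
    open Codec C

    opaque
      -- The expansion is exponential in `width`. For the attributes of cells the width depends on
      -- the machine alone, so these formulas are constants of the reduction.
      sat : Var → {F : A → Set} → (∀ a → Dec (F a)) → FO²
      sat u F? = shannon u width attributeName (λ v → truth (F? (decode v)))

      rel : {F : A → A → Set} → (∀ a b → Dec (F a b)) → FO²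
      rel F? = shannon x width attributeName (λ v → shannon y width attributeName
          (λ v′ → truth (F? (decode v) (decode v′))))

    module _ (𝔄 : Structure) where
      open Structure 𝔄 using (unary)

      attribute : Universe 𝔄 → A
      attribute a = decode (read width (λ i → unary (attributeName i) a))

      opaque
        unfolding sat rel

        says-sat : ∀ {s} u {F : A → Set} (F? : ∀ a → Dec (F a)) → _⊢_says_ 𝔄 s (sat u F?) (F (attribute (s u)))
        says-sat u {F} F? = says-shannon 𝔄 u width attributeName _ {A = F ∘ decode}
            (λ v → says-truth 𝔄 (F? (decode v)))

        says-rel : ∀ {s} {F : A → A → Set} (F? : ∀ a b → Dec (F a b)) →
                   _⊢_says_ 𝔄 s (rel F?) (F (attribute (s x)) (attribute (s y)))
        says-rel {s} {F} F? = says-shannon 𝔄 x width attributeName _ {A = λ v → F (decode v) (attribute (s y))}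
          (λ v → says-shannon 𝔄 y width attributeName _ {A = λ v′ → F (decode v) (decode v′)}
            (λ v′ → says-truth 𝔄 (F? (decode v) (decode v′))))

  digitˢ borrowˢ nextBorrowˢ : Var → Schema
  digitˢ      = bitP 𝟘 0
  borrowˢ     = bitP 𝟙 0
  nextBorrowˢ = bitP 𝟙 1

  -- The address of v is that of u minus 1, modulo 2 ^ m.
  Pred : Var → Var → Template
  Pred u v = conj (iff (digitˢ v) (iff (digitˢ u) (not (borrowˢ u)))) (const ⊤′)

  Same : Var → Var → Template
  Same u v = conj (iff (digitˢ v) (digitˢ u)) (const ⊤′)

  module _ (𝔄 : Structure) where
    open Structure 𝔄 using (unary)

    digits borrows : Universe 𝔄 → ℕ → Bool
    digits  a j = unary (bitName 𝟘 j) a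
    borrows a j = unary (bitName 𝟙 j) a

    address : ℕ → Universe 𝔄 → ℕ
    address m a = value (digits a) m

    record BorrowsAt (m : ℕ) (a : Universe 𝔄) : Set where
      field
        base     : borrows a 0 ≡ true
        isBorrow : IsBorrow (digits a) (borrows a) m

    says-Pred : ∀ {s m n} u v → suc n ≡ 2 ^ m → (∀ a → BorrowsAt m a) →
      _⊢_says_ 𝔄 s (instᵀ (Pred u v) m) (address m (s v) ≡ pred[mod1+ n ] (address m (s u)))
    says-Pred {s} {m} {n} u v N≡ h = says-map 𝔄
      (says-⋀ 𝔄 _ m {A = λ j → digits (s v) j ≡ difference (digits (s u)) (borrows (s u)) j}
        (λ j → says-map 𝔄 (says-iff 𝔄 {j = j} (digitˢ v) (iff (digitˢ u) (not (borrowˢ u))) (digits (s v) j)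
            _ (via id id)
          (says-iff 𝔄 {j = j} (digitˢ u) (not (borrowˢ u)) (digits (s u) j) (Bool.not (borrows (s u) j))
              (via id id)
            (says-∼ᵇ 𝔄 (borrows (s u) j) (via id id))))
          (T-≡ᵇ′-xor (digits (s v) j) (digits (s u) j) (borrows (s u) j)))
        (says-⊤ 𝔄 {s}))
      (mk⇔ (λ (e , _) → trans (value-cong _ _ m e) vp)
           (λ e → value-injective (digits (s v)) (difference (digits (s u)) (borrows (s u))) m
               (trans e (sym vp)) , tt))
      where
      open BorrowsAt (h (s u))
      vp : value (difference (digits (s u)) (borrows (s u))) m ≡ pred[mod1+ n ] (address m (s u))
      vp = value-pred (digits (s u)) (borrows (s u)) m n N≡ isBorrow base

    says-Same : ∀ {s m} u v → _⊢_says_ 𝔄 s (instᵀ (Same u v) m) (address m (s v) ≡ address m (s u))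
    says-Same {s} {m} u v = says-map 𝔄
      (says-⋀ 𝔄 _ m {A = λ j → digits (s v) j ≡ digits (s u) j}
        (λ j → says-map 𝔄 (says-iff 𝔄 {j = j} (digitˢ v) (digitˢ u) (digits (s v) j) (digits (s u) j)
            (via id id) (via id id)) (T-≡ᵇ′ _ _))
        (says-⊤ 𝔄 {s}))
      (mk⇔ (λ (e , _) → value-cong _ _ m e)
           (λ e → value-injective (digits (s v)) (digits (s u)) m e , tt))

-- The formula for a machine and an input word

module Encoding where

  open Schemas
  open Addresses
  open Satisfaction
  open Writing using (text; text-polyTime; addressBits)
  open import Data.Bool.Base as Bool using (Bool; false; T; _xor_)
  open import Data.Bool.Properties as Boolₚ using (T?)
  open import Data.Fin.Base as Fin using (Fin; zero; suc)
  import Data.Fin.Properties as Finₚ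
  open import Data.List.Base as List using (List; []; _∷_; _++_; concatMap; length)
  open import Data.List.Properties using (++-assoc)
  open import Data.Maybe.Base using (Maybe; just; nothing)
  open import Data.Nat.Base using (ℕ; zero; suc)
  open import Data.Product.Base using (∃-syntax; _×_; _,_; proj₁)
  open import Data.Product.Properties using (≡-dec)
  open import Data.Sum.Base using (_⊎_; inj₁; inj₂)
  open import Data.Unit.Base using (⊤; tt)
  open import Data.Vec.Base as Vec using (Vec; []; _∷_)
  open import Function.Base using (_∘_)
  open import Relation.Binary.PropositionalEquality
  open import Relation.Nullary using (Dec; yes; no; ¬_; ¬?; _×-dec_; _→-dec_)

  open Structure using (Universe; Assignment)

  module Assembly (H G : Template) (origin end : FO²) (letter : Bool → FO²) where

    -- A walk along the cells with two variables: `y` becomes the neighbouring cell, then `x` is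
    -- quantified again and moved there by the equation, so that every link starts from `x`.
    inputs : ℕ → Word → FO²
    inputs m []      = end
    inputs m (z ∷ w) = letter z ∧ ∀′ y (instᵀ G m ⇒ ∀′ x (x ≐ y ⇒ inputs m w))

    formula : ℕ → Word → FO²
    formula m w = instᵀ H m ∧ ∀′ x (∀′ y (origin ⇒ inputs m w))

    -- Pieces of code cut off in the middle of a formula. An implication is a disjunction whose left
    -- side is negated, hence `𝟙 ∷ 𝟙 ∷ 𝟘` followed by the code of a negation.
    middle after : Word
    middle = 𝟙 ∷ 𝟙 ∷ 𝟙 ∷ 𝟙 ∷ 𝟘 ∷ 𝟙 ∷ 𝟙 ∷ 𝟙 ∷ 𝟙 ∷ 𝟙 ∷ 𝟙 ∷ 𝟙 ∷ 𝟘 ∷ ⌜ ∼ origin ⌝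
    after  = 𝟙 ∷ 𝟙 ∷ 𝟙 ∷ 𝟙 ∷ 𝟘 ∷ 𝟙 ∷ 𝟙 ∷ 𝟘 ∷ ⌜ ∼ (x ≐ y) ⌝

    before : Bool → Word
    before z = 𝟙 ∷ 𝟘 ∷ 𝟙 ∷ ⌜ letter z ⌝ ++ 𝟙 ∷ 𝟙 ∷ 𝟙 ∷ 𝟙 ∷ 𝟙 ∷ 𝟙 ∷ 𝟙 ∷ 𝟘 ∷ 𝟙 ∷ 𝟘 ∷ 𝟘 ∷ []

    module _ (c d : ℕ) where

      write : Word → Word
      write = text c d (𝟙 ∷ 𝟘 ∷ 𝟙 ∷ []) H middle before G after ⌜ end ⌝

      write-polyTime : PolyTime write
      write-polyTime = text-polyTime c d (𝟙 ∷ 𝟘 ∷ 𝟙 ∷ []) H middle before G after ⌜ end ⌝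

      write-formula : ∀ w → write w ≡ ⌜ formula (addressBits c d (length w)) w ⌝
      write-formula w = cong (λ v → 𝟙 ∷ 𝟘 ∷ 𝟙 ∷ ⌜ instᵀ H m ⌝ ++ middle ++ v) (lem w)
        where
        m = addressBits c d (length w)
        link : Bool → Word
        link z = before z ++ ⌜ instᵀ G m ⌝ ++ after
        lem : ∀ w → concatMap link w ++ ⌜ end ⌝ ≡ ⌜ inputs m w ⌝
        lem []      = refl
        lem (z ∷ w) = begin
          (link z ++ concatMap link w) ++ ⌜ end ⌝       ≡⟨ ++-assoc (link z) _ _ ⟩
          link z ++ concatMap link w ++ ⌜ end ⌝         ≡⟨ cong (link z ++_) (lem w) ⟩
          link z ++ ⌜ inputs m w ⌝                      ≡⟨ ++-assoc (before z) _ _ ⟩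
          before z ++ (⌜ instᵀ G m ⌝ ++ after) ++ ⌜ inputs m w ⌝
            ≡⟨ cong (before z ++_) (++-assoc ⌜ instᵀ G m ⌝ after ⌜ inputs m w ⌝) ⟩
          before z ++ ⌜ instᵀ G m ⌝ ++ after ++ ⌜ inputs m w ⌝
            ≡⟨ cong (λ v → 𝟙 ∷ 𝟘 ∷ 𝟙 ∷ v) (++-assoc ⌜ letter z ⌝ _ _) ⟩
          ⌜ inputs m (z ∷ w) ⌝ ∎
          where open ≡-Reasoning

  codec-Symbol : ∀ {a} → Codec (Symbol a)
  codec-Symbol {a} = codec-retract f g gf (codec-Fin zero)
    where
    f : Symbol a → Fin (3 Data.Nat.Base.+ a)
    f blank   = zero
    f (bit 𝟘) = suc zero
    f (bit 𝟙) = suc (suc zero)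
    f (aux i) = suc (suc (suc i))
    g : Fin (3 Data.Nat.Base.+ a) → Symbol a
    g zero                = blank
    g (suc zero)          = bit 𝟘
    g (suc (suc zero))    = bit 𝟙
    g (suc (suc (suc i))) = aux i
    gf : ∀ s → g (f s) ≡ s
    gf blank   = refl
    gf (bit 𝟘) = refl
    gf (bit 𝟙) = refl
    gf (aux i) = refl

  codec-Move : Codec Move
  codec-Move = codec-retract f g gf (codec-Fin zero)
    where
    f : Move → Fin 3
    f left  = zero
    f stay  = suc zero
    f right = suc (suc zero)
    g : Fin 3 → Move
    g zero             = left
    g (suc zero)       = stay
    g (suc (suc zero)) = right
    gf : ∀ d → g (f d) ≡ d
    gf left  = refl
    gf stay  = refl
    gf right = refl

  -- A number modulo 4; the first component is its parity.
  Label : Set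
  Label = Bool × Bool

  next-label : Label → Label
  next-label (p , h) = Bool.not p , (h xor p)

  module Attr (M : TM 0) where
    open TM M

    -- The attributes of a cell in a configuration; isMin and isMax mark the extreme
    -- cells of a configuration in ≤₁, isRest the blanks of the initial one, and the
    -- scanned symbol headSymbol is known to all cells.
    record Cell : Set where
      constructor cell
      field
        label        : Label
        isHead       : Bool
        isInitial    : Bool
        isMin isMax  : Bool
        isRest       : Bool
        state        : Fin states
        symbol       : Symbol symbols
        headSymbol   : Symbol symbols

    open Cell public

    codec-Cell : Codec Cell
    codec-Cell = codec-retract
      (λ (cell l h i a b r q s t) → l , h , i , a , b , r , q , s , t)
      (λ (l , h , i , a , b , r , q , s , t) → cell l h i a b r q s t) (λ _ → refl)
      ((codec-Bool ×-codec codec-Bool) ×-codec codec-Bool ×-codec codec-Bool ×-codec codec-Bool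
        ×-codec codec-Bool ×-codec codec-Bool ×-codec codec-Fin start ×-codec codec-Symbol ×-codec codec-Symbol)

    _≟ˡ_ : (l l′ : Label) → Dec (l ≡ l′)
    _≟ˡ_ = ≡-dec Boolₚ._≟_ Boolₚ._≟_
    _≟ˢ_ : (s s′ : Symbol symbols) → Dec (s ≡ s′)
    _≟ˢ_ = Codec._≟_ codec-Symbol

    -- Owing to `headSymbol` the transition is a property of any one cell, so a rule about a step
    -- involves just that cell and its counterpart in the next configuration.
    move : Cell → Maybe (Fin states × Vec (Symbol symbols × Move) 1)
    move a = δ (state a) (headSymbol a ∷ [])

    Dead : Cell → Set
    Dead a = move a ≡ nothing

    dead? : ∀ a → Dec (Dead a)
    dead? a with move a
    ... | nothing = yes refl
    ... | just _  = no (λ ())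

    Odd Even : Cell → Set
    Odd  a = T (proj₁ (label a))
    Even a = ¬ Odd a

    odd? : ∀ a → Dec (Odd a)
    odd? a = T? _

    SameClass : Cell → Cell → Set
    SameClass a b = label a ≡ label b × isInitial a ≡ isInitial b × (T (isHead a) → headSymbol b ≡ symbol a)

    sameClass? : ∀ a b → Dec (SameClass a b)
    sameClass? a b = (label a ≟ˡ label b) ×-dec (isInitial a Boolₚ.≟ isInitial b)
      ×-dec (T? (isHead a) →-dec (headSymbol b ≟ˢ symbol a))

    NextLabel : Cell → Cell → Set
    NextLabel a b = label b ≡ next-label (label a)

    nextLabel? : ∀ a b → Dec (NextLabel a b)
    nextLabel? a b = label b ≟ˡ next-label (label a)

    StateStep : Cell → Cell → Set
    StateStep a b with move a
    ... | nothing       = ⊤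
    ... | just (q , _)  = state b ≡ q × isInitial b ≡ false

    stateStep? : ∀ a b → Dec (StateStep a b)
    stateStep? a b with move a
    ... | nothing       = yes tt
    ... | just (q , _)  = (state b Finₚ.≟ q) ×-dec (isInitial b Boolₚ.≟ false)

    overwritten : Cell → Symbol symbols → Symbol symbols
    overwritten a s = Bool.if isHead a then s else symbol a

    -- The direction is a parameter because it determines how the address of the inheriting cell
    -- differs from that of the old one. Each direction has its own rule, vacuous for transitions
    -- that move otherwise.
    SymbolStep : Move → Cell → Cell → Set
    SymbolStep d a b with move a
    ... | nothing                 = ⊤
    ... | just (_ , (s , d′) ∷ []) = d′ ≡ d → symbol b ≡ overwritten a s

    symbolStep? : ∀ d a b → Dec (SymbolStep d a b)
    symbolStep? d a b with move a
    ... | nothing                 = yes tt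
    ... | just (_ , (s , d′) ∷ []) = (Codec._≟_ codec-Move d′ d) →-dec (symbol b ≟ˢ overwritten a s)

    Local : Cell → Set
    Local a = (Dead a → T (accept (state a))) × (T (isInitial a) → state a ≡ start × label a ≡ (false , false))
            × (T (isRest a) → symbol a ≡ blank)

    local? : ∀ a → Dec (Local a)
    local? a = (dead? a →-dec T? _) ×-dec (T? _ →-dec ((state a Finₚ.≟ start) ×-dec (label a ≟ˡ _)))
            ×-dec (T? _ →-dec (symbol a ≟ˢ blank))

    -- The mark travels around the circle to increasing addresses and has to stop at the head,
    -- behind which the input begins again.
    RestStep : Cell → Cell → Set
    RestStep a b = T (isRest a) → ¬ T (isHead b) → T (isRest b)

    restStep? : ∀ a b → Dec (RestStep a b)
    restStep? a b = T? _ →-dec (¬? (T? _) →-dec T? _)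

    module Meaning {E : Set} (_≤¹_ _≤²_ : E → E → Set) (n : ℕ) (addr : E → ℕ) (attr : E → Cell) where

      infix 4 _~_ _<¹_ _<²_ _⇀_
      _~_ _<¹_ _<²_ Above : E → E → Set
      a ~ b     = a ≤² b × b ≤² a
      a <¹ b    = ¬ (b ≤¹ a)
      a <² b    = ¬ (b ≤² a)
      Above a b = (Even (attr a) × (a <¹ b × b <² a)) ⊎ (Odd (attr a) × (b <¹ a × a <² b))

      _⇀_ : E → E → Set
      a ⇀ b = NextLabel (attr a) (attr b) × Above a b

      Input : Word → E → Set
      Input []      a = T (isRest (attr a))
      Input (z ∷ w) a = symbol (attr a) ≡ bit z × (∀ b → a ~ b × addr a ≡ pred[mod1+ n ] (addr b) → Input w b)

      record Good (w : Word) : Set where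
        field
          predecessor  : ∀ a → ∃[ b ] (a ~ b × addr b ≡ pred[mod1+ n ] (addr a))
          sameClass    : ∀ a b → a ~ b → SameClass (attr a) (attr b)
          max          : ∀ a b → a ~ b → T (isMax (attr a)) → b ≤¹ a
          min          : ∀ a b → a ~ b → T (isMin (attr a)) → a ≤¹ b
          hasMax       : ∀ a → ∃[ b ] (a ~ b × T (isMax (attr b)))
          hasMin       : ∀ a → ∃[ b ] (a ~ b × T (isMin (attr b)))
          -- Asked of a last cell and answered by a first cell, so that every cell of the one class
          -- precedes every cell of the other in ≤₁. The quantifier stands before the implication to
          -- keep the shape ∀∃; in a non-empty universe this is equivalent.
          evenNext     : ∀ a → ∃[ b ] (¬ Dead (attr a) × Even (attr a) × T (isMax (attr a)) →
                                       (a <¹ b × b <² a) × NextLabel (attr a) (attr b) × T (isMin (attr b)))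
          oddNext      : ∀ a → ∃[ b ] (¬ Dead (attr a) × Odd (attr a) × T (isMin (attr a)) →
                                       (b <¹ a × a <² b) × NextLabel (attr a) (attr b) × T (isMax (attr b)))
          stateStep    : ∀ a b → a ⇀ b → StateStep (attr a) (attr b)
          rightStep    : ∀ a b → a ⇀ b × addr b ≡ pred[mod1+ n ] (addr a) → SymbolStep right (attr a) (attr b)
          leftStep     : ∀ a b → a ⇀ b × addr a ≡ pred[mod1+ n ] (addr b) → SymbolStep left (attr a) (attr b)
          stayStep     : ∀ a b → a ⇀ b × addr b ≡ addr a → SymbolStep stay (attr a) (attr b)
          locally      : ∀ a → Local (attr a)
          hasInitial   : ∃[ a ] T (isInitial (attr a))
          restStep     : ∀ a b → a ~ b × addr a ≡ pred[mod1+ n ] (addr b) → RestStep (attr a) (attr b)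
          input        : ∀ a → T (isInitial (attr a)) × T (isHead (attr a)) → Input w a

    open Attributes codec-Cell

    equivalent : Var → Var → FO²
    equivalent u v = u ≾₂ v ∧ v ≾₂ u

    even→odd odd→even step→ : FO²
    even→odd = ∼ (y ≤₁ x) ∧ ∼ (x ≾₂ y)
    odd→even = ∼ (x ≤₁ y) ∧ ∼ (y ≾₂ x)
    step→    = rel nextLabel? ∧ ((sat x (¬? ∘ odd?) ∧ even→odd) ∨ (sat x odd? ∧ odd→even))

    ∀∀ ∀∃ : Template → Template
    ∀∀ s = all x (all y s)
    ∀∃ s = all x (ex y s)

    -- The closing schema of `conj` is taken at index `m`: the borrow out of the top digit is
    -- identified with `isHead`, which places the head at address 0.
    borrowing : Template
    borrowing = and (const (P (bitName 𝟙 0) x))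
      (conj (iff (nextBorrowˢ x) (and (borrowˢ x) (not (digitˢ x))))
            (iff (borrowˢ x) (const (sat x (λ a → T? (isHead a))))))

    continuation : FO² → {F G : Cell → Set} → (∀ a → Dec (F a)) → (∀ a → Dec (G a)) → Template
    continuation φ F? G? = ∀∃ (const (sat x (λ a → ¬? (dead? a) ×-dec F? a)
                                      ⇒ φ ∧ (rel nextLabel? ∧ sat y G?)))

    rules : Template
    rules =
      and (∀∃ (and (const (equivalent x y)) (Pred x y)))
     (and (∀∀ (const (equivalent x y ⇒ rel sameClass?)))
     (and (∀∀ (const (equivalent x y ⇒ (sat x (λ a → T? (isMax a)) ⇒ y ≤₁ x))))
     (and (∀∀ (const (equivalent x y ⇒ (sat x (λ a → T? (isMin a)) ⇒ x ≤₁ y))))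
     (and (∀∃ (const (equivalent x y ∧ sat y (λ a → T? (isMax a)))))
     (and (∀∃ (const (equivalent x y ∧ sat y (λ a → T? (isMin a)))))
     (and (continuation even→odd (λ a → ¬? (odd? a) ×-dec T? (isMax a)) (λ b → T? (isMin b)))
     (and (continuation odd→even (λ a → odd? a ×-dec T? (isMin a)) (λ b → T? (isMax b)))
     (and (∀∀ (const (step→ ⇒ rel stateStep?)))
     (and (∀∀ (impᵀ (and (const step→) (Pred x y)) (const (rel (symbolStep? right)))))
     (and (∀∀ (impᵀ (and (const step→) (Pred y x)) (const (rel (symbolStep? left)))))
     (and (∀∀ (impᵀ (and (const step→) (Same x y)) (const (rel (symbolStep? stay)))))
     (and (∀∀ (const (sat x local?)))
     -- Quantifying `y` as well gives every rule two leading quantifiers over both variables, so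
     -- that one argument, `two`, shows all of them to be closed.
     (and (ex x (all y (const (sat x (λ a → T? (isInitial a))))))
          (∀∀ (impᵀ (and (const (equivalent x y)) (Pred y x)) (const (rel restStep?)))))))))))))))))

    background : Template
    background = and (∀∀ borrowing) rules

    successor : Template
    successor = and (const (equivalent x y)) (Pred y x)

    holdsBit : Bool → FO²
    holdsBit z = sat x (λ a → symbol a ≟ˢ bit z)

    isRest′ isOrigin : FO²
    isRest′  = sat x (λ a → T? (isRest a))
    isOrigin = sat x (λ a → T? (isInitial a) ×-dec T? (isHead a))

    open Assembly background successor isOrigin isRest′ holdsBit public

    formula-sentence : ∀ m w → Sentence (formula m w)
    formula-sentence m w x (inj₂ (n , _)) = n refl
    formula-sentence m w y (inj₂ (_ , n , _)) = n refl
    formula-sentence m w v (inj₁ h) = closed v h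
      where
      closed : Sentence (instᵀ background m)
      closed x (inj₁ (n , _)) = n refl
      closed y (inj₁ (_ , n , _)) = n refl
      closed v (inj₂ h) = closed′ v h
        where
        case : ∀ {A B : Set} → ¬ A → ¬ B → ¬ (A ⊎ B)
        case f g (inj₁ a) = f a
        case f g (inj₂ b) = g b
        two : ∀ v {A : Set} → ¬ (v ≢ x × (v ≢ y × A))
        two x (n , _) = n refl
        two y (_ , n , _) = n refl
        closed′ : Sentence (instᵀ rules m)
        closed′ v = case (two v) (case (two v)
            (case (two v) (case (two v) (case (two v) (case (two v) (case (two v)
          (case (two v) (case (two v) (case (two v)
              (case (two v) (case (two v) (case (two v) (case (two v) (two v))))))))))))))

-- What the formula says in a structure

module Interpretation where

  open Schemas
  open Addresses
  open Satisfaction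
  open Encoding
  open import Data.Bool.Base as Bool using (Bool; true; T)
  open import Data.Bool.Properties as Boolₚ using (T?; T-≡)
  open import Data.List.Base as List using ([]; _∷_)
  open import Data.Nat.Base using (ℕ; zero; suc; _^_)
  open import Data.Product.Base using (∃-syntax; _×_; _,_; proj₁; proj₂)
  open import Function.Base using (_∘_; id)
  open import Function.Bundles using (_⇔_; mk⇔; Equivalence)
  open import Relation.Binary.PropositionalEquality
  open import Relation.Nullary using (¬_; ¬?; _×-dec_)

  open Structure using (Universe; Assignment)

  module Semantics (M : TM 0) (𝔄 : Structure) (m n : ℕ) (N≡ : suc n ≡ 2 ^ m) where
    open Attr M
    open Attributes codec-Cell
    open Structure 𝔄 using (le₁; le₂)

    attr : Universe 𝔄 → Cell
    attr = attribute 𝔄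

    addr : Universe 𝔄 → ℕ
    addr = address 𝔄 m

    open Meaning (λ a b → T (le₁ a b)) (λ a b → T (le₂ a b)) n addr attr public

    infix 3 _⊢_says′_
    _⊢_says′_ : Assignment 𝔄 → FO² → Set → Set
    _⊢_says′_ = _⊢_says_ 𝔄
    open _⊢_says_

    says-∀∀ : ∀ {s φ} (A : Universe 𝔄 → Universe 𝔄 → Set) →
              (∀ s → s ⊢ φ says′ A (s x) (s y)) → s ⊢ ∀′ x (∀′ y φ) says′ (∀ a b → A a b)
    says-∀∀ A p = says-∀ 𝔄 x (λ a → says-∀ 𝔄 y (λ b → p _))

    says-∀∃ : ∀ {s φ} (A : Universe 𝔄 → Universe 𝔄 → Set) →
              (∀ s → s ⊢ φ says′ A (s x) (s y)) → s ⊢ ∀′ x (∃′ y φ) says′ (∀ a → ∃[ b ] A a b)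
    says-∀∃ A p = says-∀ 𝔄 x (λ a → says-∃ 𝔄 y (λ b → p _))

    says-∀₁ : ∀ {s φ} (A : Universe 𝔄 → Set) →
              (∀ s → s ⊢ φ says′ A (s x)) → s ⊢ ∀′ x (∀′ y φ) says′ (∀ a → A a)
    says-∀₁ A p = says-map 𝔄 (says-∀∀ (λ a _ → A a) p) (mk⇔ (λ f a → f a a) (λ f a _ → f a))

    says-∃₁ : ∀ {s φ} (A : Universe 𝔄 → Set) →
              (∀ s → s ⊢ φ says′ A (s x)) → s ⊢ ∃′ x (∀′ y φ) says′ (∃[ a ] A a)
    says-∃₁ A p = says-map 𝔄 (says-∃ 𝔄 x (λ a → says-∀ 𝔄 y (λ b → p _)))
      (mk⇔ (λ (a , h) → a , h a) (λ (a , h) → a , λ _ → h))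

    Borrowing : Universe 𝔄 → Set
    Borrowing a = T (borrows 𝔄 a 0) × IsBorrow (digits 𝔄 a) (borrows 𝔄 a) m × borrows 𝔄 a m ≡ isHead (attr a)

    says-borrowing : ∀ s → s ⊢ instᵀ borrowing m says′ Borrowing (s x)
    says-borrowing s = says-∧ 𝔄 (says-refl 𝔄 _) (says-⋀ 𝔄 _ m
        {A = λ j → borrows 𝔄 (s x) (suc j) ≡ (borrows 𝔄 (s x) j Bool.∧ Bool.not (digits 𝔄 (s x) j))}
      (λ j → says-map 𝔄
        (says-iff 𝔄 {j = j} (nextBorrowˢ x) (and (borrowˢ x) (not (digitˢ x))) (borrows 𝔄 (s x) (suc j))
            (borrows 𝔄 (s x) j Bool.∧ Bool.not (digits 𝔄 (s x) j))
          (via id id) (says-∧ᵇ 𝔄 (borrows 𝔄 (s x) j) (Bool.not (digits 𝔄 (s x) j)) (via id id)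
              (says-∼ᵇ 𝔄 (digits 𝔄 (s x) j) (via id id))))
        (T-≡ᵇ′ _ _))
      (says-map 𝔄
        (says-iff 𝔄 {j = m} (borrowˢ x) (const (sat x (λ a → T? (isHead a)))) (borrows 𝔄 (s x) m)
            (isHead (attr (s x)))
          (via id id) (says-sat 𝔄 x _))
        (T-≡ᵇ′ _ _)))

    says-~ : ∀ s u v → s ⊢ equivalent u v says′ s u ~ s v
    says-~ s u v = says-∧ 𝔄 (says-refl 𝔄 _) (says-refl 𝔄 _)

    says-even→odd : ∀ s → s ⊢ even→odd says′ (s x <¹ s y × s y <² s x)
    says-even→odd s = says-∧ 𝔄 (says-∼ 𝔄 (says-refl 𝔄 _)) (says-∼ 𝔄 (says-refl 𝔄 _))

    says-odd→even : ∀ s → s ⊢ odd→even says′ (s y <¹ s x × s x <² s y)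
    says-odd→even s = says-∧ 𝔄 (says-∼ 𝔄 (says-refl 𝔄 _)) (says-∼ 𝔄 (says-refl 𝔄 _))

    says-step→ : ∀ s → s ⊢ step→ says′ s x ⇀ s y
    says-step→ s = says-∧ 𝔄 (says-rel 𝔄 nextLabel?)
      (says-∨ 𝔄 (says-∧ 𝔄 (says-sat 𝔄 x _) (says-even→odd s)) (says-∧ 𝔄 (says-sat 𝔄 x _) (says-odd→even s)))

    module _ (w : Word) (h : ∀ a → BorrowsAt 𝔄 m a) where

      says-Pred′ : ∀ {s} u v → s ⊢ instᵀ (Pred u v) m says′ (addr (s v) ≡ pred[mod1+ n ] (addr (s u)))
      says-Pred′ u v = says-Pred 𝔄 u v N≡ h

      -- `Pred` means the predecessor only once the borrows are known to be correct. Hence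
      -- `borrowing` is interpreted separately and without assumptions, and the rules relative to
      -- `h`.
      says-rules : ∀ s → s ⊢ instᵀ rules m says′ _
      says-rules s =
        says-∧ 𝔄 (says-∀∃ (λ a b → a ~ b × addr b ≡ pred[mod1+ n ] (addr a)) λ s → says-∧ 𝔄 (says-~ s x y)
            (says-Pred′ x y))
       (says-∧ 𝔄 (says-∀∀ (λ a b → a ~ b → SameClass (attr a) (attr b)) λ s → says-⇒ 𝔄 (says-~ s x y)
           (says-rel 𝔄 sameClass?))
       (says-∧ 𝔄 (says-∀∀ (λ a b → a ~ b → T (isMax (attr a)) → T (le₁ b a)) λ s → says-⇒ 𝔄 (says-~ s x y)
           (says-⇒ 𝔄 (says-sat 𝔄 x (λ a → T? (isMax a))) (says-refl 𝔄 (y ≤₁ x))))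
       (says-∧ 𝔄 (says-∀∀ (λ a b → a ~ b → T (isMin (attr a)) → T (le₁ a b)) λ s → says-⇒ 𝔄 (says-~ s x y)
           (says-⇒ 𝔄 (says-sat 𝔄 x (λ a → T? (isMin a))) (says-refl 𝔄 (x ≤₁ y))))
       (says-∧ 𝔄 (says-∀∃ (λ a b → a ~ b × T (isMax (attr b))) λ s → says-∧ 𝔄 (says-~ s x y)
           (says-sat 𝔄 y (λ a → T? (isMax a))))
       (says-∧ 𝔄 (says-∀∃ (λ a b → a ~ b × T (isMin (attr b))) λ s → says-∧ 𝔄 (says-~ s x y)
           (says-sat 𝔄 y (λ a → T? (isMin a))))
       (says-∧ 𝔄 (says-∀∃ (λ a b → ¬ Dead (attr a) × Even (attr a) × T (isMax (attr a)) → (a <¹ b × b <² a)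
           × NextLabel (attr a) (attr b) × T (isMin (attr b))) λ s → says-⇒ 𝔄
               (says-sat 𝔄 x (λ a → ¬? (dead? a) ×-dec (¬? (odd? a) ×-dec T? (isMax a))))
                                 (says-∧ 𝔄 (says-even→odd s) (says-∧ 𝔄 (says-rel 𝔄 nextLabel?)
                                     (says-sat 𝔄 y (λ a → T? (isMin a))))))
       (says-∧ 𝔄 (says-∀∃ (λ a b → ¬ Dead (attr a) × Odd (attr a) × T (isMin (attr a)) → (b <¹ a × a <² b) ×
           NextLabel (attr a) (attr b) × T (isMax (attr b))) λ s → says-⇒ 𝔄
               (says-sat 𝔄 x (λ a → ¬? (dead? a) ×-dec (odd? a ×-dec T? (isMin a))))
                                 (says-∧ 𝔄 (says-odd→even s) (says-∧ 𝔄 (says-rel 𝔄 nextLabel?)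
                                     (says-sat 𝔄 y (λ a → T? (isMax a))))))
       (says-∧ 𝔄 (says-∀∀ (λ a b → a ⇀ b → StateStep (attr a) (attr b)) λ s → says-⇒ 𝔄 (says-step→ s)
           (says-rel 𝔄 stateStep?))
       (says-∧ 𝔄 (says-∀∀ (λ a b → a ⇀ b × addr b ≡ pred[mod1+ n ] (addr a) → SymbolStep right (attr a)
           (attr b)) λ s → says-⇒ 𝔄 (says-∧ 𝔄 (says-step→ s) (says-Pred′ x y)) (says-rel 𝔄 (symbolStep? right)))
       (says-∧ 𝔄 (says-∀∀ (λ a b → a ⇀ b × addr a ≡ pred[mod1+ n ] (addr b) → SymbolStep left (attr a)
           (attr b)) λ s → says-⇒ 𝔄 (says-∧ 𝔄 (says-step→ s) (says-Pred′ y x)) (says-rel 𝔄 (symbolStep? left)))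
       (says-∧ 𝔄 (says-∀∀ (λ a b → a ⇀ b × addr b ≡ addr a → SymbolStep stay (attr a) (attr b)) λ s → says-⇒
           𝔄 (says-∧ 𝔄 (says-step→ s) (says-Same 𝔄 {m = m} x y)) (says-rel 𝔄 (symbolStep? stay)))
       (says-∧ 𝔄 (says-∀₁ (Local ∘ attr) λ s → says-sat 𝔄 x local?)
       (says-∧ 𝔄 (says-∃₁ (λ a → T (isInitial (attr a))) λ s → says-sat 𝔄 x (λ a → T? (isInitial a)))
         (says-∀∀ (λ a b → a ~ b × addr a ≡ pred[mod1+ n ] (addr b) → RestStep (attr a) (attr b)) λ s →
             says-⇒ 𝔄 (says-∧ 𝔄 (says-~ s x y) (says-Pred′ y x)) (says-rel 𝔄 restStep?)))))))))))))))

      says-inputs : ∀ s w → s ⊢ inputs m w says′ Input w (s x)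
      says-inputs s []      = says-sat 𝔄 x (λ a → T? (isRest a))
      says-inputs s (z ∷ w) = says-∧ 𝔄 (says-sat 𝔄 x (λ a → symbol a ≟ˢ bit z))
        (says-∀ 𝔄 y λ b → says-⇒ 𝔄 (says-∧ 𝔄 (says-~ _ x y) (says-Pred′ y x))
          (says-map 𝔄 (says-∀ 𝔄 x λ a → says-⇒ 𝔄 (says-refl 𝔄 (x ≐ y)) (says-inputs _ w))
            (mk⇔ (λ f → f b refl) (λ i a e → subst (Input w) (sym e) i))))

      says-origin : ∀ s → s ⊢ ∀′ x (∀′ y (isOrigin ⇒ inputs m w)) says′
                    (∀ a → T (isInitial (attr a)) × T (isHead (attr a)) → Input w a)
      says-origin s = says-∀₁ (λ a → T (isInitial (attr a)) × T (isHead (attr a)) → Input w a) λ s → says-⇒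
          𝔄 (says-sat 𝔄 x (λ a → T? (isInitial a) ×-dec T? (isHead a))) (says-inputs s w)

    HeadAtZero : Set
    HeadAtZero = ∀ a → isHead (attr a) ≡ true ⇔ addr a ≡ 0

    formula⇒good : ∀ w → 𝔄 ⊨ formula m w → HeadAtZero × Good w
    formula⇒good w sat′ = heads , good
      where
      s₀ : Assignment 𝔄
      s₀ _ = Fin.zero where open import Data.Fin.Base as Fin
      all₁ : ∀ a → Borrowing a
      all₁ = to (says-∀₁ Borrowing says-borrowing) (proj₁ (proj₁ (sat′ s₀)))
      h : ∀ a → BorrowsAt 𝔄 m a
      h a = record { base = Equivalence.to T-≡ (proj₁ (all₁ a)) ; isBorrow = proj₁ (proj₂ (all₁ a)) }
      heads : HeadAtZero
      heads a = mk⇔ (λ e → borrow⇒zero (digits 𝔄 a) (borrows 𝔄 a) m n N≡ isBorrow base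
          (trans (proj₂ (proj₂ (all₁ a))) e))
                    (λ e → trans (sym (proj₂ (proj₂ (all₁ a)))) (zero⇒borrow (digits 𝔄 a) (borrows 𝔄 a) m n
                        N≡ isBorrow base e))
        where open BorrowsAt (h a)
      good : Good w
      good with to (says-rules w h s₀) (proj₂ (proj₁ (sat′ s₀)))
      ... | r₁ , r₂ , r₃ , r₄ , r₅ , r₆ , r₇ , r₈ , r₉ , r₁₀ , r₁₁ , r₁₂ , r₁₃ , r₁₄ , r₁₅ = record
        { predecessor = r₁ ; sameClass = r₂ ; max = r₃ ; min = r₄ ; hasMax = r₅ ; hasMin = r₆
        ; evenNext = r₇ ; oddNext = r₈ ; stateStep = r₉ ; rightStep = r₁₀ ; leftStep = r₁₁
        ; stayStep = λ a b (p , e) → r₁₂ a b (p , e)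
        ; locally = r₁₃ ; hasInitial = r₁₄ ; restStep = r₁₅
        ; input = to (says-origin w h s₀) (proj₂ (sat′ s₀)) }

    good⇒formula : ∀ w → (∀ a → BorrowsAt 𝔄 m a) → (∀ a → borrows 𝔄 a m ≡ isHead (attr a)) → Good w →
                   𝔄 ⊨ formula m w
    good⇒formula w h e g s =
      (from (says-∀₁ Borrowing says-borrowing) (λ a → Equivalence.from T-≡ (BorrowsAt.base (h a)) ,
          BorrowsAt.isBorrow (h a) , e a) ,
       from (says-rules w h s) (predecessor , sameClass , max , min , hasMax , hasMin , evenNext , oddNext ,
           stateStep ,
         rightStep , leftStep , stayStep , locally , hasInitial , restStep)) ,
      from (says-origin w h s) input
      where open Good g

-- Tapes as circles that turn under a fixed head

module Tapes where

  open Addresses using (pred[mod1+_])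
  open import Data.Empty using (⊥-elim)
  open import Data.List.Base as List using (List; []; _∷_; map; length)
  open import Data.List.Properties using (length-map)
  open import Data.Nat.Base
  open import Data.Nat.Properties as ℕₚ
  open import Data.Product.Base using (_×_; _,_)
  open import Relation.Binary.PropositionalEquality
  open import Relation.Nullary using (yes; no)

  module _ {a : ℕ} where

    nth : List (Symbol a) → ℕ → Symbol a
    nth []      _       = blank
    nth (s ∷ l) zero    = s
    nth (s ∷ l) (suc i) = nth l i

    nth-beyond : ∀ l {i} → length l ≤ i → nth l i ≡ blank
    nth-beyond []      _       = refl
    nth-beyond (s ∷ l) (s≤s h) = nth-beyond l h

    rightOf leftOf : Tape a → List (Symbol a)
    rightOf t = Tape.current t ∷ Tape.after t
    leftOf    = Tape.before

    nth-rightOf-right : ∀ t s k → nth (rightOf (act t (s , right))) k ≡ nth (rightOf t) (suc k)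
    nth-rightOf-right (tape []      _ [])      s zero    = refl
    nth-rightOf-right (tape []      _ [])      s (suc k) = refl
    nth-rightOf-right (tape (_ ∷ _) _ [])      s zero    = refl
    nth-rightOf-right (tape (_ ∷ _) _ [])      s (suc k) = refl
    nth-rightOf-right (tape []      _ (_ ∷ _)) s k       = refl
    nth-rightOf-right (tape (_ ∷ _) _ (_ ∷ _)) s k       = refl

    leftOf-right : ∀ t s → leftOf (act t (s , right)) ≡ s ∷ leftOf t
    leftOf-right (tape []      _ [])      s = refl
    leftOf-right (tape (_ ∷ _) _ [])      s = refl
    leftOf-right (tape []      _ (_ ∷ _)) s = refl
    leftOf-right (tape (_ ∷ _) _ (_ ∷ _)) s = refl

    rightOf-left : ∀ t s → rightOf (act t (s , left)) ≡ nth (leftOf t) 0 ∷ s ∷ Tape.after t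
    rightOf-left (tape []      _ _) s = refl
    rightOf-left (tape (_ ∷ _) _ _) s = refl

    nth-leftOf-left : ∀ t s k → nth (leftOf (act t (s , left))) k ≡ nth (leftOf t) (suc k)
    nth-leftOf-left (tape []      _ _) s k = refl
    nth-leftOf-left (tape (_ ∷ _) _ _) s k = refl

    act-stay : ∀ t s → act t (s , stay) ≡ tape (leftOf t) s (Tape.after t)
    act-stay (tape []      _ _) s = refl
    act-stay (tape (_ ∷ _) _ _) s = refl

  -- A tape as a circle of 1 + n = 2 * r cells, with the head at cell 0.
  module Circle {a : ℕ} (n r : ℕ) (n≡ : suc n ≡ r + r) where

    content : Tape a → ℕ → Symbol a
    content t i with i <? r
    ... | yes _ = nth (rightOf t) i
    ... | no _  = nth (leftOf t) (n ∸ i)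

    -- Keeps the surroundings of cell `r`, where the two halves meet, blank on both sides; the
    -- margin of 2 allows for the shift by a move.
    Fits : Tape a → Set
    Fits t = 2 + length (leftOf t) ≤ r × 2 + length (Tape.after t) ≤ r

    content-right : ∀ t {i} → i < r → content t i ≡ nth (rightOf t) i
    content-right t {i} i<r with i <? r
    ... | yes _ = refl
    ... | no ¬p = ⊥-elim (¬p i<r)

    content-left : ∀ t {i} → r ≤ i → content t i ≡ nth (leftOf t) (n ∸ i)
    content-left t {i} r≤i with i <? r
    ... | yes p = ⊥-elim (<⇒≱ p r≤i)
    ... | no _  = refl

    rewritten : Tape a → Symbol a → ℕ → Symbol a
    rewritten t s zero    = s
    rewritten t s (suc i) = content t (suc i)

    r≤n : 2 ≤ r → r ≤ n
    r≤n 2≤r = s≤s⁻¹ (≤-trans (≤-trans (+-monoˡ-≤ r (≤-trans (s≤s z≤n) 2≤r)) ≤-refl) (≤-reflexive (sym n≡)))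

    private
      r≤1+[n∸i] : ∀ {i} → i ≤ r → r ≤ suc (n ∸ i)
      r≤1+[n∸i] {i} i≤r = ≤-trans (≤-reflexive (sym (trans (cong (_∸ r) n≡) (m+n∸n≡m r r))))
          (≤-trans (∸-monoʳ-≤ (suc n) i≤r) (suc-∸-≤ n i))
        where
        suc-∸-≤ : ∀ n i → suc n ∸ i ≤ suc (n ∸ i)
        suc-∸-≤ n zero    = ≤-refl
        suc-∸-≤ zero (suc i) = ≤-trans (≤-reflexive (0∸n≡0 i)) z≤n
        suc-∸-≤ (suc n) (suc i) = suc-∸-≤ n i

      1+[n∸1+i] : ∀ {i} → suc i ≤ n → suc (n ∸ suc i) ≡ n ∸ i
      1+[n∸1+i] h = sym (+-∸-assoc 1 h)

    content-0 : ∀ t → Fits t → content t 0 ≡ Tape.current t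
    content-0 t (h , _) = content-right t (≤-trans (s≤s z≤n) h)

    -- Moving the head to the right lowers every address by one and sends the cell just written from
    -- 0 to `n`. Apart from that cell, content changes between the two lists only at the seam, where
    -- it is blank.
    content-act-right : ∀ t s → Fits t → ∀ i → i ≤ n →
      content (act t (s , right)) (pred[mod1+ n ] i) ≡ rewritten t s i
    content-act-right t s (fl , fr) zero _ = trans
      (content-left _ (r≤n (≤-trans (m≤m+n 2 _) fl)))
      (trans (cong (nth (leftOf (act t (s , right)))) (n∸n≡0 n)) (cong (λ l → nth l 0) (leftOf-right t s)))
    content-act-right t s (fl , fr) (suc i) i<n with suc i <? r | i <? r
    ... | yes p | yes _ = nth-rightOf-right t s i
    ... | yes p | no ¬q = ⊥-elim (¬q (<-trans (n<1+n i) p))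
    -- Here `suc i` is `r`: the content passes from the left list to the right one, and both are
    -- exhausted at that point.
    ... | no ¬p | yes q = trans (nth-rightOf-right t s i) (trans
      (nth-beyond (Tape.after t) (s≤s⁻¹ (≤-trans (≤-trans (n≤1+n _) fr) (≮⇒≥ ¬p))))
      (sym (nth-beyond (leftOf t) (s≤s⁻¹ (≤-trans (≤-trans (n≤1+n _) fl) (r≤1+[n∸i] q))))))
    ... | no _ | no ¬q = trans (cong₂ nth (leftOf-right t s) (sym (1+[n∸1+i] i<n))) refl

    content-act-left : ∀ t s → Fits t → ∀ i → i ≤ n →
      content (act t (s , left)) i ≡ rewritten t s (pred[mod1+ n ] i)
    content-act-left t s (fl , fr) zero _ = trans (content-right _ (≤-trans (s≤s z≤n) fl))
      (trans (cong (λ l → nth l 0) (rightOf-left t s)) (lem n (r≤n (≤-trans (m≤m+n 2 _) fl)) refl))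
      where
      lem : ∀ k → r ≤ k → k ≡ n → nth (leftOf t) 0 ≡ rewritten t s k
      lem zero    h e = ⊥-elim (n≮0 (≤-trans fl h))
      lem (suc k) h e = sym (trans (content-left t h) (cong (nth (leftOf t)) (trans (cong (n ∸_) e) (n∸n≡0 n))))
    content-act-left t s (fl , fr) (suc zero) _ = trans (content-right _ (≤-trans (m≤m+n 2 _) fl))
      (cong (λ l → nth l 1) (rightOf-left t s))
    content-act-left t s (fl , fr) (suc (suc i)) i<n with suc (suc i) <? r | suc i <? r
    ... | yes p | yes _ = cong (λ l → nth l (suc (suc i))) (rightOf-left t s)
    ... | yes p | no ¬q = ⊥-elim (¬q (<-trans (n<1+n (suc i)) p))
    -- The seam again, with `r` equal to `suc (suc i)`. The index into `Tape.after t` is `i`, so the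
    -- full margin of 2 is used.
    ... | no ¬p | yes q = trans (nth-leftOf-left t s _) (trans
      (nth-beyond (leftOf t) (≤-trans (s≤s⁻¹ (≤-trans (≤-trans (n≤1+n _) fl) (r≤1+[n∸i] q))) (n≤1+n _)))
      (sym (nth-beyond (Tape.after t) (s≤s⁻¹ (s≤s⁻¹ (≤-trans fr (≮⇒≥ ¬p)))))))
    ... | no _ | no ¬q = trans (nth-leftOf-left t s _) (cong (nth (leftOf t)) (1+[n∸1+i] i<n))

    content-act-stay : ∀ t s → Fits t → ∀ i → content (act t (s , stay)) i ≡ rewritten t s i
    content-act-stay t s (fl , fr) i rewrite act-stay t s = lem i
      where
      lem : ∀ i → content (tape (leftOf t) s (Tape.after t)) i ≡ rewritten t s i
      lem zero    = content-right _ (≤-trans (s≤s z≤n) fl)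
      lem (suc i) with suc i <? r
      ... | yes _ = refl
      ... | no _  = refl

    content-input : ∀ w → Fits (inputTape w) → ∀ i → content (inputTape w) i ≡ nth (map bit w) i
    content-input [] h i with i <? r
    content-input [] h zero    | yes _ = refl
    content-input [] h (suc i) | yes _ = refl
    ... | no _  = refl
    content-input (z ∷ w) (_ , h) i with i <? r
    ... | yes _ = refl
    ... | no ¬p = sym (nth-beyond (map bit (z ∷ w)) (≤-trans (≤-trans (n≤1+n _) h) (≮⇒≥ ¬p)))

    length-input : ∀ w → Fits (inputTape w) → length w < r
    length-input []      (h , _) = ≤-trans (s≤s z≤n) h
    length-input (z ∷ w) (_ , h) = subst (λ k → 2 + k ≤ r) (length-map bit w) h

-- From a model to an accepting run

module FromModels where

  open Addresses
  open Satisfaction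
  open Encoding
  open Interpretation
  open Tapes
  open import Data.Bool.Base as Bool using (Bool; true; false; T)
  open import Data.Bool.Properties as Boolₚ using (T-≡)
  open import Data.Empty using (⊥-elim)
  open import Data.Fin.Base using (Fin; zero; suc)
  open import Data.List.Base as List using ([]; _∷_; map; drop)
  open import Data.Maybe.Base using (just; nothing)
  open import Data.Nat.Base
  open import Data.Nat.Properties as ℕₚ
  open import Data.Product.Base using (∃-syntax; _×_; _,_; proj₁; proj₂)
  open import Data.Sum.Base using (inj₁; inj₂)
  open import Data.Unit.Base using (tt)
  open import Data.Vec.Base as Vec using (Vec; []; _∷_)
  open import Function.Base using (_∘_; id)
  open import Function.Bundles using (_⇔_; mk⇔; Equivalence)
  open import Relation.Binary.PropositionalEquality
  open import Relation.Binary.Structures using (IsTotalOrder; IsTotalPreorder)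
  open import Relation.Nullary using (yes; no; ¬_)

  open Structure using (Universe)

  module Single (M : TM 0) where
    open TM M
    open Attr M

    singleTape : Config M → Tape symbols
    singleTape c = Vec.head (Config.tapes c)

    next-single : ∀ c → next M c ≡ δ (Config.state c) (Tape.current (singleTape c) ∷ [])
    next-single (config q (t ∷ [])) = refl

    step-state : ∀ c {q s d} → next M c ≡ just (q , (s , d) ∷ []) → Config.state (step M c) ≡ q
    step-state (config q₀ (t ∷ [])) e with next M (config q₀ (t ∷ [])) | e
    ... | _ | refl = refl

    step-tape : ∀ c {q s d} → next M c ≡ just (q , (s , d) ∷ []) → singleTape (step M c) ≡ act
        (singleTape c) (s , d)
    step-tape (config q₀ (t ∷ [])) e with next M (config q₀ (t ∷ [])) | e
    ... | _ | refl = refl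

    stateStep-just : ∀ a b {q v} → move a ≡ just (q , v) → StateStep a b ⇔ (state b ≡ q × isInitial b ≡ false)
    stateStep-just a b e with move a
    stateStep-just a b refl | just (_ , _) = mk⇔ id id

    symbolStep-just : ∀ d a b {q s d′} → move a ≡ just (q , (s , d′) ∷ []) →
                      SymbolStep d a b ⇔ (d′ ≡ d → symbol b ≡ overwritten a s)
    symbolStep-just d a b e with move a
    symbolStep-just d a b refl | just (_ , (_ , _) ∷ []) = mk⇔ id id

    symbolStep-nothing : ∀ d a b → move a ≡ nothing → SymbolStep d a b
    symbolStep-nothing d a b e with move a
    symbolStep-nothing d a b refl | nothing = tt

    stateStep-nothing : ∀ a b → move a ≡ nothing → StateStep a b
    stateStep-nothing a b e with move a
    stateStep-nothing a b refl | nothing = tt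

    labelAt : ℕ → Label
    labelAt zero    = false , false
    labelAt (suc t) = next-label (labelAt t)

  module Soundness (M : TM 0) (𝔄 : Structure) (m n r : ℕ) (N≡ : suc n ≡ 2 ^ m) (n≡ : suc n ≡ r + r)
                   (w : Word)
                   (fits : ∀ t → Circle.Fits n r n≡ (Single.singleTape M (run M t w))) where
    open TM M
    open Attr M
    open Single M
    open Semantics M 𝔄 m n N≡
    open Circle {symbols} n r n≡
    open Structure 𝔄 using (linearOrder₁; totalPreorder₂)
    private
      module L₁ = IsTotalOrder linearOrder₁
      module L₂ = IsTotalPreorder totalPreorder₂

    ~-refl : ∀ {a} → a ~ a
    ~-refl = L₂.refl , L₂.refl

    ~-sym : ∀ {a b} → a ~ b → b ~ a
    ~-sym (p , q) = q , p

    ~-trans : ∀ {a b c} → a ~ b → b ~ c → a ~ c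
    ~-trans (p , q) (p′ , q′) = L₂.trans p p′ , L₂.trans q′ q

    addr-≤ : ∀ a → addr a ≤ n
    addr-≤ a = s≤s⁻¹ (subst (addr a <_) (sym N≡) (value-< _ m))

    module _ (heads : HeadAtZero) (good : Good w) where
      open Good good

      -- Classes are closed under predecessors: descend from `z` to address 0, wrap around to `n`,
      -- and descend further. Several cells may share an address.
      class-address : ∀ z i → i ≤ n → ∃[ b ] (z ~ b × addr b ≡ i)
      class-address z i i≤n with toZero (addr z) z refl
        where
        toZero : ∀ k z → addr z ≡ k → ∃[ b ] (z ~ b × addr b ≡ 0)
        toZero zero    z e = z , ~-refl , e
        toZero (suc k) z e with predecessor z
        ... | b , z~b , e′ with toZero k b (trans e′ (cong pred[mod1+ n ] e))
        ... | c , b~c , e″ = c , ~-trans z~b b~c , e″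
      ... | o , z~o , eo with down (n ∸ i)
        where
        down : ∀ k → ∃[ b ] (z ~ b × addr b ≡ n ∸ k)
        down zero with predecessor o
        ... | b , o~b , e = b , ~-trans z~o o~b , trans e (cong pred[mod1+ n ] eo)
        down (suc k) with down k
        ... | b , z~b , e with n ∸ k in e′
        -- The subtraction is truncated: from address 0 on, a larger `k` asks for no other cell.
        ... | zero   = b , z~b , trans e (sym (trans (∸-suc-pred n k) (cong Data.Nat.Base.pred e′)))
          where
          ∸-suc-pred : ∀ n k → n ∸ suc k ≡ Data.Nat.Base.pred (n ∸ k)
          ∸-suc-pred n k = sym (pred[m∸n]≡m∸[1+n] n k)
        ... | suc j with predecessor b
        ... | c , b~c , e″ = c , ~-trans z~b b~c ,
          trans e″ (trans (cong pred[mod1+ n ] e) (trans (cong Data.Nat.Base.pred (sym e′))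
              (pred[m∸n]≡m∸[1+n] n k)))
      ... | b , z~b , e = b , z~b , trans e (m∸[m∸n]≡n i≤n)

      stateAt : ℕ → Fin states
      stateAt t = Config.state (run M t w)
      tapeAt : ℕ → Tape symbols
      tapeAt t = singleTape (run M t w)

      -- Stated for all cells of the class, so that it does not matter which of several cells with
      -- the same address is found. The scanned symbol need not be recorded: it is obtained from a
      -- cell at address 0.
      Encodes : ℕ → Universe 𝔄 → Set
      Encodes t z = ∀ b → z ~ b → label (attr b) ≡ labelAt t × state (attr b) ≡ stateAt t
                                × symbol (attr b) ≡ content (tapeAt t) (addr b)

      encodes-head : ∀ {t z} → Encodes t z → ∀ b → z ~ b → headSymbol (attr b) ≡ Tape.current (tapeAt t)
      encodes-head {t} {z} enc b z~b with class-address z 0 z≤n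
      ... | o , z~o , e = trans (proj₂ (proj₂ (sameClass o b (~-trans (~-sym z~o) z~b)))
          (Equivalence.from T-≡ (Equivalence.from (heads o) e)))
        (trans (proj₂ (proj₂ (enc o z~o))) (trans (cong (content (tapeAt t)) e)
            (content-0 (tapeAt t) (fits t))))

      encodes-move : ∀ {t z} → Encodes t z → ∀ b → z ~ b → move (attr b) ≡ next M (run M t w)
      encodes-move {t} enc b z~b = trans
        (cong₂ (λ q s → δ q (s ∷ [])) (proj₁ (proj₂ (enc b z~b))) (encodes-head {t} enc b z~b))
        (sym (next-single (run M t w)))

      -- `drop k v` is the part of the input still to be read at address `k`. Once it is used up,
      -- `Input` amounts to the mark for the blank rest.
      symbol-input : ∀ b k v → Input (drop k v) b → symbol (attr b) ≡ nth (map bit v) k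
      symbol-input b zero    []      i = proj₂ (proj₂ (locally b)) i
      symbol-input b (suc k) []      i = proj₂ (proj₂ (locally b)) i
      symbol-input b zero    (z ∷ v) i = proj₁ i
      symbol-input b (suc k) (z ∷ v) i = symbol-input b k v i

      initially : ∃[ z ] Encodes 0 z
      initially with hasInitial
      ... | z , iz = z , λ b z~b → proj₂ (start-label b z~b) , proj₁ (start-label b z~b) ,
          trans (symbol-input b (addr b) w (inputAt (addr b) b z~b refl))
              (sym (content-input w (fits 0) (addr b)))
        where
        initial-class : ∀ b → z ~ b → T (isInitial (attr b))
        initial-class b z~b = subst T (proj₁ (proj₂ (sameClass z b z~b))) iz
        start-label : ∀ b → z ~ b → state (attr b) ≡ start × label (attr b) ≡ (false , false)
        start-label b z~b = proj₁ (proj₂ (locally b)) (initial-class b z~b)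
        inputAt : ∀ k b → z ~ b → addr b ≡ k → Input (drop k w) b
        inputAt zero    b z~b e = input b (initial-class b z~b , Equivalence.from T-≡
            (Equivalence.from (heads b) e))
        inputAt (suc k) b z~b e with predecessor b
        ... | a , b~a , e′ = further k w (inputAt k a (~-trans z~b b~a) (trans e′ (cong pred[mod1+ n ] e)))
          where
          further : ∀ k v → Input (drop k v) a → Input (drop (suc k) v) b
          further zero    (z ∷ v) (_ , i) = i b (~-sym b~a , e′)
          further (suc k) (z ∷ v) i       = further k v i
          -- Beyond the input the mark is inherited from the predecessor; `b` is not at the head
          -- because its address is a successor.
          further zero    []      i = restStep a b (~-sym b~a , e′) i
              (λ h → 1+n≢0 (trans (sym e) (Equivalence.to (heads b) (Equivalence.to T-≡ h))))
          further (suc k) []      i = restStep a b (~-sym b~a , e′) i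
              (λ h → 1+n≢0 (trans (sym e) (Equivalence.to (heads b) (Equivalence.to T-≡ h))))

      label-class : ∀ {a b} → a ~ b → label (attr a) ≡ label (attr b)
      label-class a~b = proj₁ (sameClass _ _ a~b)

      -- The rule gives a single cell. Extremality of the two cells in ≤₁ and the invariance of ≾₂
      -- within classes extend both comparisons to all pairs of cells.
      nextClass : ∀ z → ¬ Dead (attr z) → (∀ b → z ~ b → move (attr b) ≡ move (attr z)) →
                  ∃[ z′ ] (∀ u v → z ~ u → z′ ~ v → u ⇀ v)
      nextClass z live moves with odd? (attr z)
      ... | no even with hasMax z
      ...   | a , z~a , a-max with evenNext a
      ...     | b , f with f ((λ d → live (trans (sym (moves a z~a)) d)) , subst (λ l → ¬ T (proj₁ l))
          (label-class z~a) even , a-max)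
      ...       | (a<b , b<a) , nl , b-min = b , λ u v z~u b~v →
                  let a~u = ~-trans (~-sym z~a) z~u in
                  trans (sym (label-class b~v)) (trans nl (cong next-label (label-class a~u))) ,
                  inj₁ (subst (λ l → ¬ T (proj₁ l)) (label-class z~u) even ,
                    (λ v≤u → a<b (L₁.trans (min b v b~v b-min) (L₁.trans v≤u (max a u a~u a-max)))) ,
                    (λ u≤v → b<a (L₂.trans (proj₁ a~u) (L₂.trans u≤v (proj₂ b~v)))))
      nextClass z live moves | yes odd with hasMin z
      ...   | a , z~a , a-min with oddNext a
      ...     | b , f with f ((λ d → live (trans (sym (moves a z~a)) d)) , subst (T ∘ proj₁)
          (label-class z~a) odd , a-min)
      ...       | (b<a , a<b) , nl , b-max = b , λ u v z~u b~v →
                  let a~u = ~-trans (~-sym z~a) z~u in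
                  trans (sym (label-class b~v)) (trans nl (cong next-label (label-class a~u))) ,
                  inj₂ (subst (T ∘ proj₁) (label-class z~u) odd ,
                    (λ u≤v → b<a (L₁.trans (min a u a~u a-min) (L₁.trans u≤v (max b v b~v b-max)))) ,
                    (λ v≤u → a<b (L₂.trans (proj₁ b~v) (L₂.trans v≤u (proj₂ a~u)))))

      overwritten-rewritten : ∀ {t z} → Encodes t z → ∀ s u → z ~ u →
                              overwritten (attr u) s ≡ rewritten (tapeAt t) s (addr u)
      overwritten-rewritten {t} enc s u z~u with isHead (attr u) in h | addr u in e
      ... | true  | zero  = refl
      ... | true  | suc k = ⊥-elim (1+n≢0 (trans (sym e) (Equivalence.to (heads u) h)))
      ... | false | zero  with trans (sym (Equivalence.from (heads u) e)) h
      ...   | ()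
      overwritten-rewritten {t} enc s u z~u | false | suc k = trans (proj₂ (proj₂ (enc u z~u)))
          (cong (content (tapeAt t)) e)

      successor-address : ∀ i → i ≤ n → ∃[ j ] (j ≤ n × i ≡ pred[mod1+ n ] j)
      successor-address i i≤n with i ≟ n
      ... | yes refl = 0 , z≤n , refl
      ... | no i≢n   = suc i , ≤∧≢⇒< i≤n i≢n , refl

      pred-≤ : ∀ i → i ≤ n → pred[mod1+ n ] i ≤ n
      pred-≤ zero    _ = ≤-refl
      pred-≤ (suc i) h = ≤-trans (n≤1+n i) h

      -- Every cell of the new class is accounted for: the direction of the move determines the
      -- address from which it inherits, and `class-address` provides a cell of the old class there.
      encodes-step : ∀ {t z q s d} → Encodes t z → next M (run M t w) ≡ just (q , (s , d) ∷ []) →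
                     ∃[ z′ ] Encodes (suc t) z′
      encodes-step {t} {z} {q} {s} {d} enc e with
        nextClass z (λ dead → nothing≢just (trans (sym dead) (trans (encodes-move {t} enc z ~-refl) e)))
                    (λ b z~b → trans (encodes-move {t} enc b z~b) (sym (encodes-move {t} enc z ~-refl)))
        where
        nothing≢just : ∀ {A : Set} {a : A} → nothing ≢ just a
        nothing≢just ()
      ... | z′ , above = z′ , λ v z′~v →
        trans (proj₁ (above z v ~-refl z′~v)) (cong next-label (proj₁ (enc z ~-refl))) ,
        trans (proj₁ (Equivalence.to (stateStep-just (attr z) (attr v) (movez z ~-refl))
            (stateStep z v (above z v ~-refl z′~v))))
              (sym (step-state (run M t w) e)) ,
        trans (symbols′ d refl v z′~v) (cong (λ T → content T (addr v)) (sym (step-tape (run M t w) e)))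
        where
        movez : ∀ b → z ~ b → move (attr b) ≡ just (q , (s , d) ∷ [])
        movez b z~b = trans (encodes-move {t} enc b z~b) e
        symbols′ : ∀ d′ → d ≡ d′ → ∀ v → z′ ~ v → symbol (attr v) ≡ content (act (tapeAt t) (s , d′)) (addr v)
        symbols′ right d≡ v z′~v with successor-address (addr v) (addr-≤ v)
        ... | j , j≤n , v≡ with class-address z j j≤n
        ... | u , z~u , refl = trans
          (Equivalence.to (symbolStep-just right (attr u) (attr v) (movez u z~u))
              (rightStep u v (above u v z~u z′~v , v≡)) d≡)
          (trans (overwritten-rewritten {t} enc s u z~u)
            (trans (sym (content-act-right (tapeAt t) s (fits t) (addr u) j≤n)) (cong (content _) (sym v≡))))
        symbols′ left d≡ v z′~v with class-address z (pred[mod1+ n ] (addr v)) (pred-≤ _ (addr-≤ v))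
        ... | u , z~u , u≡ = trans
          (Equivalence.to (symbolStep-just left (attr u) (attr v) (movez u z~u))
              (leftStep u v (above u v z~u z′~v , u≡)) d≡)
          (trans (overwritten-rewritten {t} enc s u z~u)
            (trans (cong (rewritten (tapeAt t) s) u≡) (sym
                (content-act-left (tapeAt t) s (fits t) (addr v) (addr-≤ v)))))
        symbols′ stay d≡ v z′~v with class-address z (addr v) (addr-≤ v)
        ... | u , z~u , u≡ = trans
          (Equivalence.to (symbolStep-just stay (attr u) (attr v) (movez u z~u))
              (stayStep u v (above u v z~u z′~v , sym u≡)) d≡)
          (trans (overwritten-rewritten {t} enc s u z~u)
            (trans (cong (rewritten (tapeAt t) s) u≡) (sym (content-act-stay (tapeAt t) s (fits t) (addr v)))))

      -- The model may contain further configurations and need not be a run. One chain of classes is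
      -- followed, no longer than the known halting time; where it ends, the local rule for dead
      -- cells gives acceptance.
      good⇒accepts : Halts M w → Accepts M w
      good⇒accepts (T₀ , halted) = follow T₀ 0 (+-identityʳ T₀) (proj₂ initially)
        where
        follow : ∀ k t {z} → k + t ≡ T₀ → Encodes t z → Accepts M w
        follow k t {z} k+t enc with next M (run M t w) in e
        ... | nothing = t , e , subst (T ∘ accept) (proj₁ (proj₂ (enc z ~-refl)))
                                 (proj₁ (locally z) (trans (encodes-move {t} enc z ~-refl) e))
        follow zero t refl enc | just (q , (s , d) ∷ []) with trans (sym halted) e
        ... | ()
        follow (suc k) t k+t enc | just (q , (s , d) ∷ []) =
          follow k (suc t) (trans (+-suc k t) k+t) (proj₂ (encodes-step {t} enc e))

-- From an accepting run to a model

module ToModels where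

  open Schemas
  open Addresses
  open Satisfaction
  open Encoding
  open Interpretation
  open Tapes
  open FromModels
  open import Data.Bool.Base as Bool using (Bool; true; false; T; if_then_else_)
  open import Data.Bool.Properties as Boolₚ using (T-≡; T-∧)
  open import Data.Empty using (⊥-elim)
  open import Data.Fin.Base using (Fin; zero; suc; toℕ; fromℕ<; combine; remQuot)
  open import Data.Fin.Properties using (toℕ-fromℕ<; toℕ<n; toℕ-injective; remQuot-combine; combine-remQuot)
  open import Data.List.Base as List using (List; []; _∷_; map; length)
  open import Data.List.Properties using (length-replicate)
  open import Data.Maybe.Base using (just; nothing)
  open import Data.Nat.Base hiding (parity)
  open import Data.Nat.Properties as ℕₚ
  open import Data.Product.Base using (∃-syntax; _×_; _,_; proj₁; proj₂)
  open import Data.Sum.Base using (inj₁; inj₂)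
  import Data.Sum.Base as Sum
  open import Data.Unit.Base using (tt)
  open import Data.Vec.Base as Vec using ([]; _∷_)
  open import Function.Base using (_∘_)
  open import Function.Bundles using (Equivalence)
  open import Relation.Binary.PropositionalEquality
  open import Relation.Binary.Structures using (IsTotalOrder; IsTotalPreorder)
  open import Relation.Nullary using (yes; no; ¬_)

  open Equivalence using (to; from)

  -- The orders on the classes: their inversions are exactly the pairs of
  -- neighbouring times.
  parity : ℕ → Bool
  parity zero    = false
  parity (suc t) = Bool.not (parity t)

  -- Adding 2 to the numbers of one parity moves each of them past its successor and past nothing
  -- else. The parities differ in the two ranks, so each pair of neighbours is swapped in exactly
  -- one of them.
  rank₁ rank₂ : ℕ → ℕ
  rank₁ t = if parity t then 2 + t else t
  rank₂ t = if parity t then t else 2 + t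

  rank₁-even : ∀ {t} → parity t ≡ false → rank₁ t ≡ t
  rank₁-even e rewrite e = refl
  rank₁-odd : ∀ {t} → parity t ≡ true → rank₁ t ≡ 2 + t
  rank₁-odd e rewrite e = refl
  rank₂-even : ∀ {t} → parity t ≡ false → rank₂ t ≡ 2 + t
  rank₂-even e rewrite e = refl
  rank₂-odd : ∀ {t} → parity t ≡ true → rank₂ t ≡ t
  rank₂-odd e rewrite e = refl

  parity-2+ : ∀ t → parity (2 + t) ≡ parity t
  parity-2+ t = Boolₚ.not-involutive (parity t)

  2+-parity : ∀ t u b → parity t ≡ b → parity u ≡ Bool.not b → 2 + t ≢ u
  2+-parity t _ b e e′ refl = Boolₚ.not-¬ {b} refl (trans (sym e) (trans (sym (parity-2+ t)) e′))

  rank₁-injective : ∀ t u → rank₁ t ≡ rank₁ u → t ≡ u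
  rank₁-injective t u e with parity t in p | parity u in q
  ... | false | false = e
  ... | true  | true  = suc-injective (suc-injective e)
  ... | true  | false = ⊥-elim (2+-parity t u true p q e)
  ... | false | true  = ⊥-elim (2+-parity u t true q p (sym e))

  rank₂-injective : ∀ t u → rank₂ t ≡ rank₂ u → t ≡ u
  rank₂-injective t u e with parity t in p | parity u in q
  ... | true  | true  = e
  ... | false | false = suc-injective (suc-injective e)
  ... | false | true  = ⊥-elim (2+-parity t u false p q e)
  ... | true  | false = ⊥-elim (2+-parity u t false q p (sym e))

  borrow : ℕ → ℕ → Bool
  borrow a zero    = true
  borrow a (suc j) = borrow a j Bool.∧ Bool.not (digit a j)

  lexicographic : ∀ {k q q′ i i′} → i < k → i′ < k → q * k + i ≤ q′ * k + i′ → q ≤ q′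
  lexicographic {k} {q} {q′} {i} {i′} i<k i′<k h with q ≤? q′
  ... | yes p = p
  ... | no ¬p = ⊥-elim (<⇒≱ (begin-strict
      q′ * k + i′   <⟨ +-monoʳ-< (q′ * k) i′<k ⟩
      q′ * k + k    ≡⟨ +-comm (q′ * k) k ⟩
      suc q′ * k    ≤⟨ *-monoˡ-≤ k (≰⇒> ¬p) ⟩
      q * k         ≤⟨ m≤m+n (q * k) i ⟩
      q * k + i     ∎) h)
    where open ≤-Reasoning

  totalPreorder-≤ᵇ : ∀ {A : Set} (f : A → ℕ) → IsTotalPreorder _≡_ (λ a b → T (f a ≤ᵇ f b))
  totalPreorder-≤ᵇ f = record
    { isPreorder = record
      { isEquivalence = isEquivalence
      ; reflexive = λ e → ≤⇒≤ᵇ (≤-reflexive (cong f e))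
      ; trans = λ {a} {b} {c} p q → ≤⇒≤ᵇ (≤-trans (≤ᵇ⇒≤ (f a) (f b) p) (≤ᵇ⇒≤ (f b) (f c) q)) }
    ; total = λ a b → Sum.map ≤⇒≤ᵇ ≤⇒≤ᵇ (≤-total (f a) (f b)) }

  totalOrder-≤ᵇ : ∀ {A : Set} (f : A → ℕ) → (∀ {a b} → f a ≡ f b → a ≡ b) →
                  IsTotalOrder _≡_ (λ a b → T (f a ≤ᵇ f b))
  totalOrder-≤ᵇ f inj = record
    { isPartialOrder = record
      { isPreorder = IsTotalPreorder.isPreorder (totalPreorder-≤ᵇ f)
      ; antisym = λ {a} {b} p q → inj (≤-antisym (≤ᵇ⇒≤ (f a) (f b) p) (≤ᵇ⇒≤ (f b) (f a) q)) }
    ; total = IsTotalPreorder.total (totalPreorder-≤ᵇ f) }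

  module Model (M : TM 0) (m n r : ℕ) (N≡ : suc n ≡ 2 ^ m) (n≡ : suc n ≡ r + r) (w : Word)
               (fits : ∀ t → Circle.Fits n r n≡ (Single.singleTape M (run M t w)))
               (T₀ : ℕ) (halted : Halted M (run M T₀ w)) (accepting : T
                   (TM.accept M (Config.state (run M T₀ w)))) where
    open TM M
    open Attr M
    open Single M
    open Circle {symbols} n r n≡

    stateAt : ℕ → Fin states
    stateAt t = Config.state (run M t w)
    tapeAt : ℕ → Tape symbols
    tapeAt t = singleTape (run M t w)

    cellAt : ℕ → ℕ → Cell
    cellAt t i = cell (labelAt t) (i ≡ᵇ 0) (t ≡ᵇ 0) (i ≡ᵇ 0) (i ≡ᵇ n) ((t ≡ᵇ 0) Bool.∧ (length w ≤ᵇ i))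
                      (stateAt t) (content (tapeAt t) i) (Tape.current (tapeAt t))

    Element : Set
    Element = Fin (suc T₀ * suc n)

    opaque

      time pos : Element → ℕ
      time e = toℕ (proj₁ (remQuot {suc T₀} (suc n) e))
      pos  e = toℕ (proj₂ (remQuot {suc T₀} (suc n) e))

      time≤ : ∀ e → time e ≤ T₀
      time≤ e = s≤s⁻¹ (toℕ<n _)

      pos≤ : ∀ e → pos e ≤ n
      pos≤ e = s≤s⁻¹ (toℕ<n _)

      element : ∀ {t i} → t ≤ T₀ → i ≤ n → Element
      element t≤ i≤ = combine (fromℕ< (s≤s t≤)) (fromℕ< (s≤s i≤))

      time-element : ∀ {t i} (t≤ : t ≤ T₀) (i≤ : i ≤ n) → time (element t≤ i≤) ≡ t
      time-element t≤ i≤ = trans (cong (toℕ ∘ proj₁) (remQuot-combine (fromℕ< (s≤s t≤)) (fromℕ< (s≤s i≤))))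
          (toℕ-fromℕ< (s≤s t≤))

      pos-element : ∀ {t i} (t≤ : t ≤ T₀) (i≤ : i ≤ n) → pos (element t≤ i≤) ≡ i
      pos-element t≤ i≤ = trans (cong (toℕ ∘ proj₂) (remQuot-combine (fromℕ< (s≤s t≤)) (fromℕ< (s≤s i≤))))
          (toℕ-fromℕ< (s≤s i≤))

      element-ext : ∀ a b → time a ≡ time b → pos a ≡ pos b → a ≡ b
      element-ext a b e e′ = trans (sym (combine-remQuot {suc T₀} (suc n) a))
        (trans (cong₂ combine (toℕ-injective e) (toℕ-injective e′)) (combine-remQuot {suc T₀} (suc n) b))

    -- Lexicographic: the classes are blocks of ≤₁, and inside a block the order is by address, with
    -- cells 0 and `n` at the ends.
    key : Element → ℕ
    key e = rank₁ (time e) * suc n + pos e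

    key-rank : ∀ a b → key a ≤ key b → rank₁ (time a) ≤ rank₁ (time b)
    key-rank a b = lexicographic (s≤s (pos≤ a)) (s≤s (pos≤ b))

    key-injective : ∀ a b → key a ≡ key b → a ≡ b
    key-injective a b e = element-ext a b t≡ (+-cancelˡ-≡ (rank₁ (time b) * suc n) _ _
        (trans (cong (λ t → rank₁ t * suc n + pos a) (sym t≡)) e))
      where
      t≡ = rank₁-injective _ _ (≤-antisym (key-rank a b (≤-reflexive e)) (key-rank b a (≤-reflexive (sym e))))

    unary : Name → Element → Bool
    unary (𝟘 ∷ 𝟘 ∷ p) e = digit (pos e) (length p)
    unary (𝟘 ∷ 𝟙 ∷ p) e = borrow (pos e) (length p)
    unary (𝟙 ∷ p)     e = at (Codec.encode codec-Cell (cellAt (time e) (pos e))) (length p)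
    unary _           e = false

    𝔄 : Structure
    𝔄 = record
      -- The universe has one element more, which is definitionally `suc T₀ * suc n`.
      { n     = n + T₀ * suc n
      ; le₁   = λ a b → key a ≤ᵇ key b
      ; le₂   = λ a b → rank₂ (time a) ≤ᵇ rank₂ (time b)
      ; unary = unary
      ; linearOrder₁   = totalOrder-≤ᵇ key (key-injective _ _)
      ; totalPreorder₂ = totalPreorder-≤ᵇ (rank₂ ∘ time) }

    open Semantics M 𝔄 m n N≡

    attr≡ : ∀ e → attr e ≡ cellAt (time e) (pos e)
    attr≡ e = trans (cong decode (trans
        (read-cong width (λ i → cong (at (encode (cellAt (time e) (pos e)))) (length-replicate i {x = 𝟙})))
                                        (read-at (encode (cellAt (time e) (pos e))))))
                    (decode-encode _)
      where open Codec codec-Cell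

    addr≡ : ∀ e → addr e ≡ pos e
    addr≡ e = trans (value-cong (digits 𝔄 e) (digit (pos e)) m
        (λ j _ → cong (digit (pos e)) (length-replicate j {x = 𝟙})))
                    (value-digit (pos e) m (subst (pos e <_) N≡ (s≤s (pos≤ e))))

    borrowsAt : ∀ e → BorrowsAt 𝔄 m e
    borrowsAt e = record { base = refl ; isBorrow = λ _ _ → refl }

    borrow-head : ∀ e → borrows 𝔄 e m ≡ isHead (attr e)
    borrow-head e = trans (lem (addr e) refl) (sym
        (trans (cong isHead (attr≡ e)) (cong (_≡ᵇ 0) (sym (addr≡ e)))))
      where
      open BorrowsAt (borrowsAt e)
      lem : ∀ k → addr e ≡ k → borrows 𝔄 e m ≡ (k ≡ᵇ 0)
      lem zero    k≡ = zero⇒borrow (digits 𝔄 e) (borrows 𝔄 e) m n N≡ isBorrow base k≡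
      lem (suc k) k≡ with borrows 𝔄 e m in b≡
      ... | false = refl
      ... | true  = ⊥-elim (1+n≢0 (trans (sym k≡)
          (borrow⇒zero (digits 𝔄 e) (borrows 𝔄 e) m n N≡ isBorrow base b≡)))

    ~⇒time : ∀ a b → a ~ b → time a ≡ time b
    ~⇒time a b (p , q) = rank₂-injective _ _ (≤-antisym (≤ᵇ⇒≤ (rank₂ (time a)) (rank₂ (time b)) p)
        (≤ᵇ⇒≤ (rank₂ (time b)) (rank₂ (time a)) q))

    time⇒~ : ∀ a b → time a ≡ time b → a ~ b
    time⇒~ a b e = ≤⇒≤ᵇ {rank₂ (time a)} (≤-reflexive (cong rank₂ e)) , ≤⇒≤ᵇ {rank₂ (time b)}
        (≤-reflexive (cong rank₂ (sym e)))

    label-parity : ∀ t → proj₁ (labelAt t) ≡ parity t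
    label-parity zero    = refl
    label-parity (suc t) = cong Bool.not (label-parity t)

    -- `next-label` runs through a cycle of length 4, so equal labels at distance at most 3 belong
    -- to the same time.
    label-gap : ∀ d t → d ≤ 3 → labelAt (d + t) ≡ labelAt t → d ≡ 0
    label-gap d t d≤ e = lem d (labelAt t) d≤ (trans (sym (shift d)) e)
      where
      iterate : ℕ → Label → Label
      iterate zero    l = l
      iterate (suc d) l = next-label (iterate d l)
      shift : ∀ d → labelAt (d + t) ≡ iterate d (labelAt t)
      shift zero    = refl
      shift (suc d) = cong next-label (shift d)
      lem : ∀ d l → d ≤ 3 → iterate d l ≡ l → d ≡ 0
      lem 0 l _ _ = refl
      lem 1 (false , _) _ ()
      lem 1 (true , _) _ ()
      lem 2 (false , false) _ ()
      lem 2 (false , true) _ ()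
      lem 2 (true , false) _ ()
      lem 2 (true , true) _ ()
      lem 3 (false , _) _ ()
      lem 3 (true , _) _ ()
      lem (suc (suc (suc (suc _)))) _ (s≤s (s≤s (s≤s ()))) _

    ≰ᵇ⇒> : ∀ {k l} → ¬ T (k ≤ᵇ l) → l < k
    ≰ᵇ⇒> h = ≰⇒> (λ p → h (≤⇒≤ᵇ p))

    <⇒≰ᵇ : ∀ {k l} → l < k → ¬ T (k ≤ᵇ l)
    <⇒≰ᵇ {k} {l} p h = <⇒≱ p (≤ᵇ⇒≤ k l h)

    T⇒true : ∀ {b} → T b → b ≡ true
    T⇒true = to T-≡

    ¬T⇒false : ∀ {b} → ¬ T b → b ≡ false
    ¬T⇒false {false} _ = refl
    ¬T⇒false {true}  h = ⊥-elim (h tt)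

    odd-attr : ∀ a → proj₁ (label (attr a)) ≡ parity (time a)
    odd-attr a = trans (cong (proj₁ ∘ label) (attr≡ a)) (label-parity (time a))

    -- The rules for a step are universal, so no pair besides consecutive times may be related by
    -- `⇀`. The two orders confine the time of `b` to four consecutive values, of which the label
    -- selects one.
    ⇀⇒time : ∀ a b → a ⇀ b → time b ≡ suc (time a)
    ⇀⇒time a b (nl , dir) = lem dir
      where
      ta = time a
      tb = time b
      nl′ : labelAt tb ≡ labelAt (suc ta)
      nl′ = trans (sym (cong label (attr≡ b))) (trans nl (cong (next-label ∘ label) (attr≡ a)))
      parity-b : parity tb ≡ Bool.not (parity ta)
      parity-b = trans (sym (label-parity tb)) (trans (cong proj₁ nl′) (label-parity (suc ta)))
      lem : Above a b → tb ≡ suc ta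
      lem (inj₁ (ev , p , q)) = sym (trans (sym (m∸n+n≡m tb≤)) (cong (_+ tb) d≡0))
        where
        pa : parity ta ≡ false
        pa = trans (sym (odd-attr a)) (¬T⇒false ev)
        pb : parity tb ≡ true
        pb = trans parity-b (cong Bool.not pa)
        tb≤ : tb ≤ suc ta
        tb≤ = s≤s⁻¹ (subst₂ _<_ (rank₂-odd pb) (rank₂-even pa) (≰ᵇ⇒> {rank₂ ta} {rank₂ tb} q))
        ta≤ : ta ≤ 2 + tb
        ta≤ = subst₂ _≤_ (rank₁-even pa) (rank₁-odd pb) (key-rank a b (<⇒≤ (≰ᵇ⇒> {key b} {key a} p)))
        d≡0 : suc ta ∸ tb ≡ 0
        d≡0 = label-gap (suc ta ∸ tb) tb (m≤n+o⇒m∸n≤o (suc ta) tb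
            (≤-trans (s≤s ta≤) (≤-reflexive (+-comm 3 tb))))
                (trans (cong labelAt (m∸n+n≡m tb≤)) (sym nl′))
      lem (inj₂ (od , p , q)) = trans (sym (m∸n+n≡m tb≤′)) (cong (_+ suc ta) label-gap′)
        where
        pa : parity ta ≡ true
        pa = trans (sym (odd-attr a)) (T⇒true od)
        pb : parity tb ≡ false
        pb = trans parity-b (cong Bool.not pa)
        tb≤ : tb ≤ 2 + ta
        tb≤ = subst₂ _≤_ (rank₁-even pb) (rank₁-odd pa) (key-rank b a (<⇒≤ (≰ᵇ⇒> {key a} {key b} p)))
        ta≤ : ta ≤ suc tb
        ta≤ = s≤s⁻¹ (subst₂ _<_ (rank₂-odd pa) (rank₂-even pb) (≰ᵇ⇒> {rank₂ tb} {rank₂ ta} q))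
        -- For odd `ta` the possible values of `tb` lie on both sides of `suc ta`. Those below are
        -- excluded first, so that the truncated subtraction for the others is exact.
        tb≢ : ¬ (tb ≤ ta)
        tb≢ tb≤ta = 1+n≢0 (trans (sym (+-∸-assoc 1 tb≤ta)) (label-gap (suc ta ∸ tb) tb
          (m≤n+o⇒m∸n≤o (suc ta) tb (≤-trans (s≤s ta≤)
              (≤-trans (≤-reflexive (+-comm 2 tb)) (+-monoʳ-≤ tb (n≤1+n 2)))))
          (trans (cong labelAt (m∸n+n≡m (≤-trans tb≤ta (n≤1+n ta)))) (sym nl′))))
        tb≤′ : suc ta ≤ tb
        tb≤′ = ≰⇒> tb≢
        d≤ : tb ∸ suc ta ≤ 1
        d≤ = m≤n+o⇒m∸n≤o tb (suc ta) (≤-trans tb≤ (≤-reflexive (+-comm 1 (suc ta))))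
        label-gap′ : tb ∸ suc ta ≡ 0
        label-gap′ = label-gap (tb ∸ suc ta) (suc ta) (≤-trans d≤ (s≤s z≤n))
            (trans (cong labelAt (m∸n+n≡m tb≤′)) nl′)

    move-cell : ∀ t i → move (cellAt t i) ≡ next M (run M t w)
    move-cell t i = sym (next-single (run M t w))

    step-halted : ∀ c → Halted M c → step M c ≡ c
    step-halted c h with next M c
    step-halted c refl | nothing = refl

    run-halted : ∀ k t → Halted M (run M t w) → run M (k + t) w ≡ run M t w
    run-halted zero    t h = refl
    run-halted (suc k) t h = trans (cong (step M) (run-halted k t h)) (step-halted (run M t w) h)

    -- `T₀` may lie after the first halt, but a halted configuration repeats itself, so every halted
    -- one in the model equals the accepting one at `T₀`.
    halted-accepting : ∀ t → t ≤ T₀ → Halted M (run M t w) → T (accept (stateAt t))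
    halted-accepting t t≤ h = subst (T ∘ accept ∘ Config.state)
      (trans (cong (λ k → run M k w) (sym (m∸n+n≡m t≤))) (run-halted (T₀ ∸ t) t h)) accepting

    overwritten-cell : ∀ t i s → overwritten (cellAt t i) s ≡ rewritten (tapeAt t) s i
    overwritten-cell t zero    s = refl
    overwritten-cell t (suc i) s = refl

    cell-symbolStep : ∀ d t i j →
      (∀ s → content (act (tapeAt t) (s , d)) j ≡ rewritten (tapeAt t) s i) →
      SymbolStep d (cellAt t i) (cellAt (suc t) j)
    cell-symbolStep d t i j h = lem (next M (run M t w)) refl
      where
      lem : ∀ o → next M (run M t w) ≡ o → SymbolStep d (cellAt t i) (cellAt (suc t) j)
      lem nothing e = symbolStep-nothing d (cellAt t i) (cellAt (suc t) j) (trans (move-cell t i) e)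
      lem (just (q , (s , d′) ∷ [])) e = from (symbolStep-just d (cellAt t i) (cellAt (suc t) j)
          (trans (move-cell t i) e)) λ where
        refl → trans (cong (λ T → content T j) (step-tape (run M t w) e))
            (trans (h s) (sym (overwritten-cell t i s)))

    cell-stateStep : ∀ t i j → StateStep (cellAt t i) (cellAt (suc t) j)
    cell-stateStep t i j = lem (next M (run M t w)) refl
      where
      lem : ∀ o → next M (run M t w) ≡ o → StateStep (cellAt t i) (cellAt (suc t) j)
      lem nothing e = stateStep-nothing (cellAt t i) (cellAt (suc t) j) (trans (move-cell t i) e)
      lem (just (q , (s , d) ∷ [])) e = from (stateStep-just (cellAt t i) (cellAt (suc t) j)
          (trans (move-cell t i) e))
        (step-state (run M t w) e , refl)

    onCells : ∀ {R : Cell → Cell → Set} {a b} → R (cellAt (time a) (pos a)) (cellAt (time b) (pos b)) → R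
        (attr a) (attr b)
    onCells {R} {a} {b} = subst₂ R (sym (attr≡ a)) (sym (attr≡ b))

    onCell : ∀ {R : Cell → Set} {a} → R (cellAt (time a) (pos a)) → R (attr a)
    onCell {R} {a} = subst R (sym (attr≡ a))

    fromCell : ∀ {R : Cell → Set} {a} → R (attr a) → R (cellAt (time a) (pos a))
    fromCell {R} {a} = subst R (attr≡ a)

    rank₂-next : ∀ t → parity t ≡ false → rank₂ (suc t) < rank₂ t
    rank₂-next t e rewrite e = ≤-refl

    rank₂-next′ : ∀ t → parity t ≡ true → rank₂ t < rank₂ (suc t)
    rank₂-next′ t e rewrite e = s≤s (≤-trans (n≤1+n t) (n≤1+n (suc t)))

    rank₁-next : ∀ t → parity t ≡ false → rank₁ t < rank₁ (suc t)
    rank₁-next t e rewrite e = s≤s (≤-trans (n≤1+n t) (n≤1+n (suc t)))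

    rank₁-next′ : ∀ t → parity t ≡ true → rank₁ (suc t) < rank₁ t
    rank₁-next′ t e rewrite e = ≤-refl

    good-predecessor : ∀ a → ∃[ b ] (a ~ b × addr b ≡ pred[mod1+ n ] (addr a))
    good-predecessor a = b , time⇒~ a b (sym (time-element (time≤ a) (h (pos a) (pos≤ a)))) ,
        trans (addr≡ b) (trans (pos-element (time≤ a) (h (pos a) (pos≤ a)))
            (cong pred[mod1+ n ] (sym (addr≡ a))))
      where
      h : ∀ i → i ≤ n → pred[mod1+ n ] i ≤ n
      h zero    _ = ≤-refl
      h (suc i) p = ≤-trans (n≤1+n i) p
      b = element (time≤ a) (h (pos a) (pos≤ a))

    good-sameClass : ∀ a b → a ~ b → SameClass (attr a) (attr b)
    good-sameClass a b a~b = onCells {SameClass} {a} {b} (cong labelAt t≡ , cong (_≡ᵇ 0) t≡ ,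
        λ h → trans (cong (Tape.current ∘ tapeAt) (sym t≡))
            (sym (trans (cong (content (tapeAt (time a))) (≡ᵇ⇒≡ (pos a) 0 h))
                 (content-0 (tapeAt (time a)) (fits (time a))))))
      where t≡ = ~⇒time a b a~b

    keys-class : ∀ a b → a ~ b → pos a ≤ pos b → key a ≤ key b
    keys-class a b a~b h = +-mono-≤ (*-monoˡ-≤ (suc n) (≤-reflexive (cong rank₁ (~⇒time a b a~b)))) h

    good-max : ∀ a b → a ~ b → T (isMax (attr a)) → T (key b ≤ᵇ key a)
    good-max a b (p , q) h = ≤⇒≤ᵇ (keys-class b a (q , p)
        (subst (pos b ≤_) (sym (≡ᵇ⇒≡ (pos a) n (fromCell {T ∘ isMax} {a} h))) (pos≤ b)))

    good-min : ∀ a b → a ~ b → T (isMin (attr a)) → T (key a ≤ᵇ key b)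
    good-min a b a~b h = ≤⇒≤ᵇ (keys-class a b a~b
        (subst (_≤ pos b) (sym (≡ᵇ⇒≡ (pos a) 0 (fromCell {T ∘ isMin} {a} h))) z≤n))

    isMax-element : ∀ {t} (t≤ : t ≤ T₀) → T (isMax (attr (element t≤ ≤-refl)))
    isMax-element t≤ = onCell {T ∘ isMax} {element t≤ ≤-refl} (≡⇒≡ᵇ _ n (pos-element t≤ ≤-refl))

    isMin-element : ∀ {t} (t≤ : t ≤ T₀) → T (isMin (attr (element t≤ z≤n)))
    isMin-element t≤ = onCell {T ∘ isMin} {element t≤ z≤n} (≡⇒≡ᵇ _ 0 (pos-element t≤ z≤n))

    live⇒< : ∀ a → ¬ Dead (attr a) → time a < T₀
    live⇒< a live = ≤∧≢⇒< (time≤ a) (λ e → live (onCell {Dead} {a} (trans (move-cell (time a) (pos a))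
      (subst (λ t → Halted M (run M t w)) (sym e) halted))))

    nextLabel-element : ∀ a {i} (t< : time a < T₀) (i≤ : i ≤ n) → NextLabel (attr a) (attr (element t< i≤))
    nextLabel-element a t< i≤ = onCells {NextLabel} {a} {element t< i≤} (cong labelAt (time-element t< i≤))

    good-evenNext : ∀ a → ∃[ b ] (¬ Dead (attr a) × Even (attr a) × T (isMax (attr a)) →
                                  (a <¹ b × b <² a) × NextLabel (attr a) (attr b) × T (isMin (attr b)))
    good-evenNext a with time a <? T₀
    -- The witness is arbitrary: at the last time all cells are dead, so the premise fails.
    ... | no ¬p = a , λ (live , _) → ⊥-elim (¬p (live⇒< a live))
    ... | yes t< = b , λ (_ , ev , _) →
        let pa = trans (sym (odd-attr a)) (¬T⇒false ev) in
        ((λ h → <⇒≱ (subst (λ t → rank₁ (time a) < rank₁ t) (sym tb) (rank₁-next (time a) pa))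
            (key-rank b a (≤ᵇ⇒≤ _ _ h))) ,
         <⇒≰ᵇ (subst (λ t → rank₂ t < rank₂ (time a)) (sym tb) (rank₂-next (time a) pa))) ,
        nextLabel-element a t< z≤n , isMin-element t<
      where
      b = element t< z≤n
      tb = time-element t< z≤n

    good-oddNext : ∀ a → ∃[ b ] (¬ Dead (attr a) × Odd (attr a) × T (isMin (attr a)) →
                                 (b <¹ a × a <² b) × NextLabel (attr a) (attr b) × T (isMax (attr b)))
    good-oddNext a with time a <? T₀
    ... | no ¬p = a , λ (live , _) → ⊥-elim (¬p (live⇒< a live))
    ... | yes t< = b , λ (_ , od , _) →
        let pa = trans (sym (odd-attr a)) (T⇒true od) in
        ((λ h → <⇒≱ (subst (λ t → rank₁ t < rank₁ (time a)) (sym tb) (rank₁-next′ (time a) pa))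
            (key-rank a b (≤ᵇ⇒≤ _ _ h))) ,
         <⇒≰ᵇ (subst (λ t → rank₂ (time a) < rank₂ t) (sym tb) (rank₂-next′ (time a) pa))) ,
        nextLabel-element a t< ≤-refl , isMax-element t<
      where
      b = element t< ≤-refl
      tb = time-element t< ≤-refl

    good-symbolStep : ∀ d a b → a ⇀ b → (∀ s → content (act (tapeAt (time a)) (s , d)) (pos b) ≡ rewritten
        (tapeAt (time a)) s (pos a)) →
                      SymbolStep d (attr a) (attr b)
    good-symbolStep d a b r h = onCells {SymbolStep d} {a} {b}
      (subst (λ t → SymbolStep d (cellAt (time a) (pos a)) (cellAt t (pos b))) (sym (⇀⇒time a b r))
          (cell-symbolStep d (time a) (pos a) (pos b) h))

    pos-pred : ∀ {a b} → addr b ≡ pred[mod1+ n ] (addr a) → pos b ≡ pred[mod1+ n ] (pos a)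
    pos-pred {a} {b} e = trans (sym (addr≡ b)) (trans e (cong pred[mod1+ n ] (addr≡ a)))

    good-local : ∀ a → Local (attr a)
    good-local a = onCell {Local} {a} (
      (λ dead → halted-accepting (time a) (time≤ a) (trans (sym (move-cell (time a) (pos a))) dead)) ,
      (λ h → cong stateAt (≡ᵇ⇒≡ (time a) 0 h) , cong labelAt (≡ᵇ⇒≡ (time a) 0 h)) ,
      λ h → let t0 , l≤ = to (T-∧ {time a ≡ᵇ 0} {length w ≤ᵇ pos a}) h in
        trans (cong (λ t → content (tapeAt t) (pos a)) (≡ᵇ⇒≡ (time a) 0 t0))
          (trans (content-input w (fits 0) (pos a))
            (nth-beyond (map bit w) (≤-trans (≤-reflexive (Data.List.Properties.length-map bit w))
                (≤ᵇ⇒≤ (length w) (pos a) l≤)))))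

    good-restStep : ∀ a b → a ~ b × addr a ≡ pred[mod1+ n ] (addr b) → RestStep (attr a) (attr b)
    good-restStep a b (a~b , e) = onCells {RestStep} {a} {b} λ h ¬head →
      let t0 , l≤ = to (T-∧ {time a ≡ᵇ 0} {length w ≤ᵇ pos a}) h in
      from (T-∧ {time b ≡ᵇ 0} {length w ≤ᵇ pos b}) (subst (λ t → T (t ≡ᵇ 0)) (~⇒time a b a~b) t0 ,
        ≤⇒≤ᵇ (≤-trans (≤ᵇ⇒≤ (length w) (pos a) l≤) (lem (pos b) (pos-pred {b} {a} e) ¬head)))
      where
      lem : ∀ j → pos a ≡ pred[mod1+ n ] j → ¬ T (j ≡ᵇ 0) → pos a ≤ j
      lem zero    _ h = ⊥-elim (h tt)
      lem (suc j) e _ = ≤-trans (≤-reflexive e) (n≤1+n j)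

    good-input : ∀ a → T (isInitial (attr a)) × T (isHead (attr a)) → Input w a
    good-input a (h , h′) = lem w 0 (λ _ → refl) refl a (≡ᵇ⇒≡ (time a) 0 (fromCell {T ∘ isInitial} {a} h))
        (≡ᵇ⇒≡ (pos a) 0 (fromCell {T ∘ isHead} {a} h′))
      where
      length-w≤n : length w ≤ n
      length-w≤n = ≤-trans (<⇒≤ (length-input w (fits 0))) (r≤n (≤-trans (m≤m+n 2 _) (proj₁ (fits 0))))
      lem : ∀ v k → (∀ j → nth {symbols} (map bit w) (k + j) ≡ nth (map bit v) j) → k + length v ≡ length w →
            ∀ a → time a ≡ 0 → pos a ≡ k → Input v a
      lem [] k e l a t≡ p≡ = onCell {T ∘ isRest} {a} (from (T-∧ {time a ≡ᵇ 0} {length w ≤ᵇ pos a})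
        (≡⇒≡ᵇ (time a) 0 t≡ , ≤⇒≤ᵇ (≤-reflexive (trans (sym l) (trans (+-identityʳ k) (sym p≡))))))
      lem (z ∷ v) k e l a t≡ p≡ = onCell {λ c → symbol c ≡ bit z} {a}
          (trans (cong (λ t → content (tapeAt t) (pos a)) t≡) (trans (content-input w (fits 0) (pos a))
            (trans (cong (nth (map bit w)) (trans p≡ (sym (+-identityʳ k)))) (e 0)))) ,
        λ b (a~b , e′) → lem v (suc k) (λ j → trans (cong (nth (map bit w)) (sym (+-suc k j))) (e (suc j)))
          (trans (sym (+-suc k (length v))) l) b (trans (sym (~⇒time a b a~b)) t≡)
          (next-pos (pos b) (trans (sym p≡) (pos-pred {b} {a} e′)))
        where
        -- The input is shorter than the circle, so following it never wraps around to the head.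
        k<n : k < n
        k<n = ≤-trans (≤-trans (s≤s (m≤m+n k (length v)))
            (≤-reflexive (trans (sym (+-suc k (length v))) l))) length-w≤n
        next-pos : ∀ j → k ≡ pred[mod1+ n ] j → j ≡ suc k
        next-pos zero    k≡n = ⊥-elim (<-irrefl k≡n k<n)
        next-pos (suc j) k≡j = cong suc (sym k≡j)

    good : Good w
    good = record
      { predecessor = good-predecessor ; sameClass = good-sameClass
      ; max = good-max ; min = good-min
      ; hasMax = λ a → element (time≤ a) ≤-refl , time⇒~ a _ (sym (time-element (time≤ a) ≤-refl)) ,
          isMax-element (time≤ a)
      ; hasMin = λ a → element (time≤ a) z≤n , time⇒~ a _ (sym (time-element (time≤ a) z≤n)) , isMin-element
          (time≤ a)
      ; evenNext = good-evenNext ; oddNext = good-oddNext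
      ; stateStep = λ a b r → onCells {StateStep} {a} {b}
          (subst (λ t → StateStep (cellAt (time a) (pos a)) (cellAt t (pos b))) (sym (⇀⇒time a b r))
              (cell-stateStep (time a) (pos a) (pos b)))
      ; rightStep = λ a b (r , e) → good-symbolStep right a b r (λ s →
          trans (cong (content (act (tapeAt (time a)) (s , right))) (pos-pred {a} {b} e))
                (content-act-right (tapeAt (time a)) s (fits (time a)) (pos a) (pos≤ a)))
      ; leftStep = λ a b (r , e) → good-symbolStep left a b r (λ s →
          trans (content-act-left (tapeAt (time a)) s (fits (time a)) (pos b) (pos≤ b))
                (cong (rewritten (tapeAt (time a)) s) (sym (pos-pred {b} {a} e))))
      ; stayStep = λ a b (r , e) → good-symbolStep stay a b r (λ s →
          trans (content-act-stay (tapeAt (time a)) s (fits (time a)) (pos b))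
                (cong (rewritten (tapeAt (time a)) s) (trans (sym (addr≡ b)) (trans e (addr≡ a)))))
      ; locally = good-local
      ; hasInitial = element z≤n z≤n , onCell {T ∘ isInitial} {element z≤n z≤n}
          (≡⇒≡ᵇ _ 0 (time-element z≤n z≤n))
      ; restStep = good-restStep
      ; input = good-input }

    model : 𝔄 ⊨ formula m w
    model = good⇒formula w borrowsAt borrow-head good

-- The reduction and its correctness

module Reductions where

  open Parsing
  open Schemas
  open Addresses
  open Writing
  open Satisfaction
  open Encoding
  open Interpretation
  open Tapes
  open FromModels
  open ToModels
  open import Data.List.Base as List using (List; []; _∷_; _++_; length; reverse)
  open import Data.List.Properties using (length-++; length-reverse)
  open import Data.Nat.Base hiding (parity)
  open import Data.Nat.Properties as ℕₚ
  open import Data.Product.Base using (_,_; proj₁; proj₂)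
  open import Data.Vec.Base as Vec using ([]; _∷_)
  open import Function.Bundles using (_⇔_; mk⇔; Equivalence)
  open import Relation.Binary.PropositionalEquality

  module Reduction (M : TM 0) (c d : ℕ) (A : Language)
                   (decides : DecidesInSpace M (λ n → 2 ^ poly c d n) A) where
    open Attr M
    open Single M
    open Equivalence using (to; from)

    reduction : Word → Word
    reduction = write c d

    module _ (w : Word) where

      p m n r : ℕ
      p = poly c d (length w)
      m = addressBits c d (length w)
      n = Data.Nat.Base.pred (2 ^ m)
      r = 2 ^ (1 + p)

      m≡ : m ≡ 2 + p
      m≡ = trans (cong (_+ c * length w ^ d) (+-comm c 2)) (cong (2 +_) (+-comm c _))

      N≡ : suc n ≡ 2 ^ m
      N≡ = suc-pred (2 ^ m) {{m^n≢0 2 m}}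

      n≡ : suc n ≡ r + r
      n≡ = trans N≡ (trans (cong (2 ^_) m≡) (cong (r +_) (+-identityʳ r)))

      fits : ∀ t → Circle.Fits n r n≡ (singleTape (run M t w))
      fits t = bounds (run M t w) (proj₁ (proj₂ (decides w)) t)
        where
        open ≤-Reasoning
        bounds : ∀ c → space M c ≤ 2 ^ p → Circle.Fits n r n≡ (singleTape c)
        bounds (config q (tape ls s rs ∷ [])) h = left≤ , right≤
          where
          cells≤ : length ls + suc (length rs) ≤ 2 ^ p
          cells≤ = begin
            length ls + suc (length rs)       ≡⟨ cong (_+ suc (length rs)) (sym (length-reverse ls)) ⟩
            length (reverse ls) + suc (length rs) ≡⟨ sym (length-++ (reverse ls)) ⟩
            length (reverse ls ++ s ∷ rs)     ≡⟨ sym (+-identityʳ _) ⟩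
            length (reverse ls ++ s ∷ rs) + 0 ≤⟨ h ⟩
            2 ^ p                             ∎
          -- The space bound leaves at most `2 ^ p` minus 1 cells on either side of the head. A half
          -- of twice the size absorbs the margin required by `Fits`, even for `p` equal to 0.
          double : 1 + 2 ^ p ≤ r
          double = +-mono-≤ (m^n>0 2 p) (≤-reflexive (sym (+-identityʳ (2 ^ p))))
          left≤ : 2 + length ls ≤ r
          left≤ = ≤-trans (s≤s (≤-trans (≤-trans (s≤s (m≤m+n _ _))
              (≤-reflexive (sym (+-suc (length ls) (length rs))))) cells≤)) double
          right≤ : 2 + length rs ≤ r
          right≤ = ≤-trans (s≤s (≤-trans (m≤n+m _ (length ls)) cells≤)) double

      correct : A w ⇔ FinSat-FO²⟨≤₁,≾₂⟩ (reduction w)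
      correct = mk⇔ complete sound
        where
        complete : A w → FinSat-FO²⟨≤₁,≾₂⟩ (reduction w)
        complete a with to (proj₂ (proj₂ (decides w))) a
        ... | T₀ , halted , accepting = formula m w , write-formula c d w , formula-sentence m w ,
              Model.𝔄 M m n r N≡ n≡ w fits T₀ halted accepting ,
              Model.model M m n r N≡ n≡ w fits T₀ halted accepting
        sound : FinSat-FO²⟨≤₁,≾₂⟩ (reduction w) → A w
        sound (φ , e , _ , 𝔄 , sat) = from (proj₂ (proj₂ (decides w)))
          (Soundness.good⇒accepts M 𝔄 m n r N≡ n≡ w fits heads good (proj₁ (decides w)))
          where
          φ≡ : φ ≡ formula m w
          φ≡ = ⌜⌝-injective φ (formula m w) (trans (sym e) (write-formula c d w))
          semantics = Semantics.formula⇒good M 𝔄 m n N≡ w (subst (𝔄 ⊨_) φ≡ sat)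
          heads = proj₁ semantics
          good = proj₂ semantics

    polyTime : PolyTime reduction
    polyTime = write-polyTime c d

theorem4p1 : EXPSPACE-hard FinSat-FO²⟨≤₁,≾₂⟩
theorem4p1 A (M , c , d , decides) = reduction , polyTime , correct
  where open Reductions.Reduction M c d A decides
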